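{- For $w\in\mathfrak{S}_n$ the following are equivalent: (1) the bipartite graphs $\Gamma_w$ and $\Gamma^w$ are isomorphic; (2) $w$ avoids the patterns $3412$, $4231$, $34521$, $45321$, $54123$, and $54312$; (3) $w$ is polished; (4) the interval $[e,w]$ in Bruhat order is self-dual.
   Context: $\mathfrak{S}_n$ is the symmetric group as a Coxeter group of type $A_{n-1}$ with simple generators $S=\{s_1,\dots,s_{n-1}\}$, $s_i=(i\ i+1)$; its Dynkin diagram is the path $s_1 - s_2 - \cdots - s_{n-1}$. $\ell(w)$ is the number of inversions of $w$. Bruhat order is the transitive closure of $w<wt$ for transpositions $t$ with $\ell(wt)>\ell(w)$; $[e,w]=\{u:u\le w\}$ and $P^w_k=\{u\le w:\ell(u)=k\}$. $\Gamma_w$ is the bipartite graph on vertex set $P^w_1\sqcup P^w_2$ whose edges are the cover relations of Bruhat order between these sets; $\Gamma^w$ is the bipartite graph on $P^w_{\ell(w)-1}\sqcup P^w_{\ell(w)-2}$ with edges the cover relations between them. For $\pi\in\mathfrak{S}_m$, $w$ avoids $\pi$ if there are no indices $i_1<\dots<i_m$ with $w(i_1),\dots,w(i_m)$ in the same relative order as $\pi(1),\dots,\pi(m)$. For $J\subseteq S$, $W_J$ is the subgroup generated by $J$ and $w_0(J)$ its unique longest element. An element $w$ of a finite Coxeter system $(W,S)$ is polished if there exist pairwise disjoint subsets $S_1,\dots,S_k\subseteq S$, each a connected subset of the Dynkin diagram, and coverings $S_i=J_i\cup J_i'$ with $J_i\cap J_i'$ totally disconnected (no two elements adjacent in the Dynkin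 diagram) such that $w=\prod_{i=1}^k w_0(J_i)\,w_0(J_i\cap J_i')\,w_0(J_i')$, the product taken left to right in the order $i=1,\dots,k$ (for some ordering of the $S_i$). A poset is self-dual if it is isomorphic to its order dual. -}

module Defs where

open import Data.Nat as ℕ using (ℕ; zero; suc; _+_; pred)
open import Data.Fin as Fin using (Fin; zero; suc; toℕ; inject₁; #_)
open import Data.Fin.Subset using (Subset; _∈_; _∩_; _∪_)
open import Data.Vec using (Vec; []; _∷_; lookup; map; allFin; _[_]≔_)
open import Data.List using (List) renaming (map to lmap)
open import Data.Nat.ListAction using (sum)
open import Data.List.Base using () renaming (allFin to lallFin)
open import Data.Bool using (Bool; true; false; if_then_else_; _∧_)
open import Data.Product using (Σ; ∃; _×_; _,_)
open import Data.Sum using (_⊎_)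
open import Data.Empty using (⊥)
open import Data.Unit using (⊤)
open import Relation.Nullary using (¬_)
open import Relation.Nullary.Decidable using (⌊_⌋)
open import Relation.Binary.PropositionalEquality using (_≡_; _≢_)
open import Relation.Binary.Construct.Closure.ReflexiveTransitive using (Star)

-- Permutations of {0,…,n-1} in one-line notation: w = (w(0),…,w(n-1)).

Word : ℕ → Set
Word n = Vec (Fin n) n

IsPerm : ∀ {n} → Word n → Set
IsPerm {n} w = ∀ (i j : Fin n) → lookup w i ≡ lookup w j → i ≡ j

e : ∀ {n} → Word n
e {n} = allFin n

_·_ : ∀ {n} → Word n → Word n → Word n
u · v = map (lookup u) v

swapPos : ∀ {n} → Word n → Fin n → Fin n → Word n
swapPos w i j = (w [ i ]≔ lookup w j) [ j ]≔ lookup w i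

transposition : ∀ {n} → Fin n → Fin n → Word n
transposition i j = swapPos e i j

ℓ : ∀ {n} → Word n → ℕ
ℓ {n} w = sum (lmap (λ i → sum (lmap (λ j →
            if ⌊ i Fin.<? j ⌋ ∧ ⌊ lookup w j Fin.<? lookup w i ⌋ then 1 else 0)
            (lallFin n))) (lallFin n))

BruhatStep : ∀ {n} → Word n → Word n → Set
BruhatStep {n} u v = Σ (Fin n) λ i → Σ (Fin n) λ j →
  (i Fin.< j) × (v ≡ u · transposition i j) × (ℓ u ℕ.< ℓ v)

_≤B_ : ∀ {n} → Word n → Word n → Set
_≤B_ = Star BruhatStep

_<B_ : ∀ {n} → Word n → Word n → Set
u <B v = (u ≤B v) × (u ≢ v)

_⋖_ : ∀ {n} → Word n → Word n → Set
u ⋖ v = (u <B v) × ¬ (∃ λ z → (u <B z) × (z <B v))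

record Graph (V : Set) : Set₁ where
  field
    Vert : V → Set
    Adj  : V → V → Set

open Graph public

Isomorphic : ∀ {V : Set} → Graph V → Graph V → Set
Isomorphic {V} G H = Σ (V → V) λ f →
    (∀ x → Vert G x → Vert H (f x))
  × (∀ x y → Vert G x → Vert G y → f x ≡ f y → x ≡ y)
  × (∀ y → Vert H y → Σ V λ x → Vert G x × f x ≡ y)
  × (∀ x y → Vert G x → Vert G y → (Adj G x y → Adj H (f x) (f y)) × (Adj H (f x) (f y) → Adj G x y))

bipartiteLevels : ∀ {n} → Word n → (ℕ → Set) → (ℕ → Set) → Graph (Bool × Word n)
Vert (bipartiteLevels w A B) (false , u) = (u ≤B w) × A (ℓ u)
Vert (bipartiteLevels w A B) (true  , u) = (u ≤B w) × B (ℓ u)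
Adj  (bipartiteLevels w A B) (false , u) (true , v) = (u ⋖ v) ⊎ (v ⋖ u)
Adj  (bipartiteLevels w A B) (true , u) (false , v) = (u ⋖ v) ⊎ (v ⋖ u)
Adj  (bipartiteLevels w A B) (false , u) (false , v) = ⊥
Adj  (bipartiteLevels w A B) (true , u) (true , v) = ⊥

Γ_ : ∀ {n} → Word n → Graph (Bool × Word n)
Γ_ w = bipartiteLevels w (λ k → k ≡ 1) (λ k → k ≡ 2)

Γ^ : ∀ {n} → Word n → Graph (Bool × Word n)
Γ^ w = bipartiteLevels w (λ k → k + 1 ≡ ℓ w) (λ k → k + 2 ≡ ℓ w)

Contains : ∀ {n m} → Word n → Word m → Set
Contains {n} {m} w π = Σ (Fin m → Fin n) λ ι →
    (∀ a b → a Fin.< b → ι a Fin.< ι b)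
  × (∀ a b → (lookup w (ι a) Fin.< lookup w (ι b) → lookup π a Fin.< lookup π b)
           × (lookup π a Fin.< lookup π b → lookup w (ι a) Fin.< lookup w (ι b)))

Avoids : ∀ {n m} → Word n → Word m → Set
Avoids w π = ¬ Contains w π

-- patterns (one-line notation, shifted to 0-based values)
p3412 : Word 4
p3412 = # 2 ∷ # 3 ∷ # 0 ∷ # 1 ∷ []
p4231 : Word 4
p4231 = # 3 ∷ # 1 ∷ # 2 ∷ # 0 ∷ []
p34521 : Word 5
p34521 = # 2 ∷ # 3 ∷ # 4 ∷ # 1 ∷ # 0 ∷ []
p45321 : Word 5
p45321 = # 3 ∷ # 4 ∷ # 2 ∷ # 1 ∷ # 0 ∷ []
p54123 : Word 5
p54123 = # 4 ∷ # 3 ∷ # 0 ∷ # 1 ∷ # 2 ∷ []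
p54312 : Word 5
p54312 = # 4 ∷ # 3 ∷ # 2 ∷ # 0 ∷ # 1 ∷ []

-- Coxeter structure of type A_{n-1}: simple generators indexed by
-- Fin (pred n); generator i is s_{i+1} = (i+1 i+2) (1-based), i.e. it
-- swaps 0-based positions i and i+1.

s : ∀ {n} → Fin (pred n) → Word n
s {suc n} i = transposition (inject₁ i) (suc i)

DynkinAdj : ∀ {m} → Fin m → Fin m → Set
DynkinAdj i j = (suc (toℕ i) ≡ toℕ j) ⊎ (suc (toℕ j) ≡ toℕ i)

Connected : ∀ {m} → Subset m → Set
Connected {m} X = ∀ a b → a ∈ X → b ∈ X →
  Star (λ i j → (i ∈ X) × (j ∈ X) × DynkinAdj i j) a b

TotallyDisconnected : ∀ {m} → Subset m → Set
TotallyDisconnected X = ∀ a b → a ∈ X → b ∈ X → ¬ DynkinAdj a b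

Disjoint : ∀ {m} → Subset m → Subset m → Set
Disjoint X Y = ∀ a → a ∈ X → a ∈ Y → ⊥

data InParabolic {n} (J : Subset (pred n)) : Word n → Set where
  unit : InParabolic J e
  step : ∀ {u} j → j ∈ J → InParabolic J u → InParabolic J (u · s j)

IsLongest : ∀ {n} → Subset (pred n) → Word n → Set
IsLongest {n} J u = InParabolic {n} J u × (∀ v → InParabolic {n} J v → ℓ v ℕ.≤ ℓ u)

prod : ∀ {n k} → (Fin k → Word n) → Word n
prod {k = zero}  x = e
prod {k = suc k} x = x zero · prod (λ i → x (suc i))

Polished : ∀ {n} → Word n → Set
Polished {n} w =
  Σ ℕ λ k →
  Σ (Fin k → Subset (pred n)) λ S →
  Σ (Fin k → Subset (pred n)) λ J →
  Σ (Fin k → Subset (pred n)) λ J′ →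
    (∀ i j → i ≢ j → Disjoint (S i) (S j))
  × (∀ i → Connected (S i))
  × (∀ i → S i ≡ J i ∪ J′ i)
  × (∀ i → TotallyDisconnected (J i ∩ J′ i))
  × Σ (Fin k → Word n) λ a → Σ (Fin k → Word n) λ b → Σ (Fin k → Word n) λ c →
      (∀ i → IsLongest (J i) (a i))
    × (∀ i → IsLongest (J i ∩ J′ i) (b i))
    × (∀ i → IsLongest (J′ i) (c i))
    × (w ≡ prod (λ i → (a i · b i) · c i))

SelfDualInterval : ∀ {n} → Word n → Set
SelfDualInterval {n} w = Σ (Word n → Word n) λ f →
    (∀ x → x ≤B w → f x ≤B w)
  × (∀ x y → x ≤B w → y ≤B w → f x ≡ f y → x ≡ y)
  × (∀ y → y ≤B w → Σ (Word n) λ x → (x ≤B w) × f x ≡ y)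
  × (∀ x y → x ≤B w → y ≤B w → (x ≤B y → f y ≤B f x) × (f y ≤B f x → x ≤B y))

{-# OPTIONS --safe #-}

-- (4) ⇒ (1): Bruhat order is graded, so a duality of [e , w] complements ranks.
--
-- (3) ⇒ (4): with a, b, c the longest elements of W_J, W_(J ∩ J′), W_J′, the map y z ↦ a y b z c is
-- a well-defined involution of W_J W_J′ = [e , a b c].  A step of Bruhat order inside W_J W_J′ is an
-- inversion inside a block of J′, or is carried by z to one inside a block of J; the map turns both
-- kinds around.  Factors with disjoint supports multiply, since then each element of the interval
-- factors uniquely.
--
-- (1) ⇒ (2): the coatoms of [e , w] are the covers of the inversion order (i above j when i < j and
-- w i > w j).  If w avoids 4231, consecutive covers a > c > d share two lower neighbours in Γ^w,
-- whereas in Γ_w only the pairs of atoms s_i, s_(i±1) share two upper neighbours.  A cover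
-- consecutive to three others, or a square of consecutive covers, is thus excluded, and each of
-- 34521, 45321, 54123, 54312 and 45312 produces one of these.  A 4231, or a 3412 that does not extend
-- to 45312, yields instead a coatom outside the image of an injection from the support of w to the
-- coatoms, so that there are more coatoms than atoms.
--
-- (2) ⇒ (3): let P be the first moved position, a = w P and b = w⁻¹ P.  Avoiding 3412 forces, up to
-- inversion, all values below a to precede position b, and they decrease by 4231.  If no larger value
-- precedes the value P + 1, the reversal of [P , a] splits off as a left factor; otherwise 45321 and
-- 34521 show that it overlaps the next block in exactly two positions, and that this block is a
-- decreasing run of positions.

module Submission where

open import Defs
open import Data.Nat as ℕ using (ℕ; zero; suc; _+_; _∸_; s≤s; z≤n)
import Data.Nat.Properties as ℕₚ
open import Data.Nat.Properties using (<-trans; <-asym; <⇒≤; ≤-trans; <⇒≱; ≤-refl; ≤-reflexive; ≮⇒≥; <-irrefl; ≤-pred; ≰⇒>; ≤-<-trans; <-≤-trans; ≤-antisym)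
open import Data.Nat.ListAction using (sum)
open import Data.Fin as Fin using (Fin; zero; suc; toℕ; fromℕ<; inject₁; #_; _<_; _≤_; punchOut)
import Data.Fin.Properties as Finₚ
open import Data.Fin.Properties using (_≟_; any?; all?; _<?_; <-cmp; toℕ-injective; <⇒≢; ≤∧≢⇒<)
open import Data.Fin.Induction using (<-wellFounded; >-wellFounded; spo-wellFounded; spo-noetherian)
open import Data.Fin.Subset using (Subset; _∈_; _∩_; _∪_)
import Data.Fin.Subset.Properties as Subsetₚ
open import Data.Fin.Subset.Properties using (_∈?_)
open import Data.Vec as Vec using (Vec; []; _∷_; lookup; tabulate; _[_]≔_)
import Data.Vec.Properties as Vecₚ
import Data.List.Base as List
open import Data.List.Base using (List)
import Data.List.Properties as Listₚ
open import Data.List.Relation.Unary.All as All using (All)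
import Data.List.Relation.Unary.All.Properties as Allₚ
open import Data.List.Relation.Unary.AllPairs as AllPairs using (AllPairs)
import Data.List.Relation.Unary.AllPairs.Properties as AllPairsₚ
open import Data.Bool using (Bool; true; false; if_then_else_; _∧_)
open import Data.Product using (Σ; ∃; ∃₂; _×_; _,_; proj₁; proj₂; swap)
open import Data.Sum using (_⊎_; inj₁; inj₂; [_,_]′)
open import Data.Empty using (⊥; ⊥-elim)
open import Function.Base using (_∘_; id; flip; _$_; case_of_)
open import Function.Bundles using (_⇔_; mk⇔)
open import Induction.WellFounded using (Acc; acc)
open import Relation.Nullary using (¬_; Dec; yes; no; contradiction)
open import Relation.Nullary.Decidable using (⌊_⌋; _×-dec_; _⊎-dec_; _→-dec_; map′; does; dec-true; True; toWitness)
open import Relation.Binary.Definitions using (tri<; tri≈; tri>)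
open import Relation.Binary.Structures using (IsStrictPartialOrder)
open import Relation.Binary.PropositionalEquality using (_≡_; _≢_; refl; sym; trans; cong; cong₂; subst; subst₂; module ≡-Reasoning)
open import Relation.Binary.PropositionalEquality.Properties using (isEquivalence)
open import Relation.Binary.Construct.Closure.ReflexiveTransitive using (Star; ε; _◅_; _◅◅_; reverse)

-- The isomorphism in (1) does not mark the bipartition, so it may exchange the two levels, and this
-- shapes (1) ⇒ (2). A claw or a square is impossible even so: two elements of length two with two
-- common atoms are mutually inverse, hence the second level contributes only a matching. The count
-- of coatoms does need the levels. The surplus coatom is therefore chosen with three lower
-- neighbours; an element of length two covers at most two atoms, so this coatom is the image of an
-- atom, and since any two atoms below w have a common upper neighbour, no coatom is the image of an
-- element of length two. In (2) ⇒ (3) a block has to be attached to a piece found by recursion.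
-- This adds one generator to J ∩ J′, which must not be adjacent to the others, so the recursion
-- also returns which of J and J′ contains the first two generators. Passing to the inverse of w
-- exchanges J and J′, and this lets successive blocks alternate between the two.

infixl 9 _!_
infixr 6 _∙_

_!_ : ∀ {n} → Word n → Fin n → Fin n
w ! i = lookup w i

-- Abstract copies of the operations, so that their arguments can be inferred by unification.
abstract
  _∙_ : ∀ {n} → Word n → Word n → Word n
  u ∙ v = u · v

  tr : ∀ {n} → Fin n → Fin n → Word n
  tr = transposition

  ∙≡· : ∀ {n} (u v : Word n) → u ∙ v ≡ u · v
  ∙≡· u v = refl

  tr≡transposition : ∀ {n} (i j : Fin n) → tr i j ≡ transposition i j
  tr≡transposition i j = refl

∙-tr≡ : ∀ {n} (u : Word n) i j → u ∙ tr i j ≡ u · transposition i j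
∙-tr≡ u i j = trans (∙≡· u (tr i j)) (cong (u ·_) (tr≡transposition i j))

-- The symmetric group in one-line notation

word-ext : ∀ {n} {u v : Word n} → (∀ i → u ! i ≡ v ! i) → u ≡ v
word-ext {u = u} {v} h =
  trans (sym (Vecₚ.tabulate∘lookup u)) (trans (Vecₚ.tabulate-cong h) (Vecₚ.tabulate∘lookup v))

∙-! : ∀ {n} (u v : Word n) i → (u ∙ v) ! i ≡ u ! (v ! i)
∙-! u v i = trans (cong (_! i) (∙≡· u v)) (Vecₚ.lookup-map i (lookup u) v)

e-! : ∀ {n} (i : Fin n) → e ! i ≡ i
e-! = Vecₚ.lookup-allFin

∙-assoc : ∀ {n} (u v w : Word n) → (u ∙ v) ∙ w ≡ u ∙ (v ∙ w)
∙-assoc u v w = word-ext λ i → trans (∙-! (u ∙ v) w i) (trans (∙-! u v _)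
  (sym (trans (∙-! u (v ∙ w) i) (cong (u !_) (∙-! v w i)))))

∙-identityˡ : ∀ {n} (u : Word n) → e ∙ u ≡ u
∙-identityˡ u = word-ext λ i → trans (∙-! e u i) (e-! _)

∙-identityʳ : ∀ {n} (u : Word n) → u ∙ e ≡ u
∙-identityʳ u = word-ext λ i → trans (∙-! u e i) (cong (u !_) (e-! i))

-- A record, so that the word can be inferred from the hypothesis.
record Perm {n} (w : Word n) : Set where
  constructor mkPerm
  field injective : IsPerm w

open Perm public using (injective)

perm-e : ∀ {n} → Perm (e {n})
perm-e = mkPerm λ i j p → trans (sym (e-! i)) (trans p (e-! j))

perm-∙ : ∀ {n} {u v : Word n} → Perm u → Perm v → Perm (u ∙ v)
perm-∙ {u = u} {v} pu pv = mkPerm λ i j p → injective pv i j (injective pu _ _ (trans (sym (∙-! u v i)) (trans p (∙-! u v j))))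

-- A missed value could be punched out of the codomain, leaving an injection of `suc n` elements
-- into `n`.
perm-surjective : ∀ {n} {w : Word n} → Perm w → ∀ v → ∃ λ i → w ! i ≡ v
perm-surjective {suc n} {w} pw v with any? (λ i → w ! i ≟ v)
... | yes p = p
... | no ¬p = contradiction
        (Finₚ.injective⇒≤ {f = λ i → punchOut (miss i)}
          λ {i} {j} q → injective pw i j (Finₚ.punchOut-injective (miss i) (miss j) q)) ℕₚ.1+n≰n
  where
  miss : ∀ i → v ≢ w ! i
  miss i q = ¬p (i , sym q)

-- Total on all words, so that `inv` takes no proof as an argument.
preimage : ∀ {n} → Word n → Fin n → Fin n
preimage w v with any? (λ i → w ! i ≟ v)
... | yes (i , _) = i
... | no  _       = v

!-preimage : ∀ {n} {w : Word n} → Perm w → ∀ v → w ! preimage w v ≡ v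
!-preimage {w = w} pw v with any? (λ i → w ! i ≟ v)
... | yes (i , q) = q
... | no ¬p = ⊥-elim (¬p (perm-surjective pw v))

inv : ∀ {n} → Word n → Word n
inv w = tabulate (preimage w)

!-inv : ∀ {n} {w : Word n} → Perm w → ∀ v → w ! (inv w ! v) ≡ v
!-inv {w = w} pw v = trans (cong (w !_) (Vecₚ.lookup∘tabulate (preimage w) v)) (!-preimage pw v)

inv-! : ∀ {n} {w : Word n} → Perm w → ∀ i → inv w ! (w ! i) ≡ i
inv-! pw i = injective pw _ _ (!-inv pw _)

perm-inv : ∀ {n} {w : Word n} → Perm w → Perm (inv w)
perm-inv {w = w} pw = mkPerm λ i j p → trans (sym (!-inv pw i)) (trans (cong (w !_) p) (!-inv pw j))

inverseʳ : ∀ {n} {w : Word n} → Perm w → w ∙ inv w ≡ e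
inverseʳ {w = w} pw = word-ext λ i → trans (∙-! w (inv w) i) (trans (!-inv pw i) (sym (e-! i)))

inverseˡ : ∀ {n} {w : Word n} → Perm w → inv w ∙ w ≡ e
inverseˡ {w = w} pw = word-ext λ i → trans (∙-! (inv w) w i) (trans (inv-! pw i) (sym (e-! i)))

inv-unique : ∀ {n} {u w : Word n} → Perm w → u ∙ w ≡ e → inv w ≡ u
inv-unique {u = u} {w} pw p = begin
  inv w             ≡⟨ sym (∙-identityˡ _) ⟩
  e ∙ inv w         ≡⟨ cong (_∙ inv w) (sym p) ⟩
  (u ∙ w) ∙ inv w   ≡⟨ ∙-assoc u w (inv w) ⟩
  u ∙ (w ∙ inv w)   ≡⟨ cong (u ∙_) (inverseʳ pw) ⟩
  u ∙ e             ≡⟨ ∙-identityʳ u ⟩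
  u                 ∎
  where open ≡-Reasoning

inv-involutive : ∀ {n} {w : Word n} → Perm w → inv (inv w) ≡ w
inv-involutive pw = inv-unique (perm-inv pw) (inverseʳ pw)

inv-∙ : ∀ {n} {u v : Word n} → Perm u → Perm v → inv (u ∙ v) ≡ inv v ∙ inv u
inv-∙ {u = u} {v} pu pv = inv-unique (perm-∙ pu pv) (word-ext λ i →
  trans (∙-! (inv v ∙ inv u) (u ∙ v) i) (trans (∙-! (inv v) (inv u) _)
  (trans (cong (λ x → inv v ! (inv u ! x)) (∙-! u v i))
  (trans (cong (inv v !_) (inv-! pu _)) (trans (inv-! pv i) (sym (e-! i)))))))

∙-cancelˡ : ∀ {n} {u v w : Word n} → Perm u → u ∙ v ≡ u ∙ w → v ≡ w
∙-cancelˡ {u = u} {v} {w} pu p = word-ext λ i → injective pu _ _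
  (trans (sym (∙-! u v i)) (trans (cong (_! i) p) (∙-! u w i)))

tr-ʳ : ∀ {n} (i j : Fin n) → tr i j ! j ≡ i
tr-ʳ i j = trans (cong (_! j) (tr≡transposition i j)) $ trans (Vecₚ.lookup∘update j (e [ i ]≔ lookup e j) (lookup e i)) (e-! i)

tr-ˡ : ∀ {n} (i j : Fin n) → tr i j ! i ≡ j
tr-ˡ i j with i ≟ j
... | yes refl = tr-ʳ i i
... | no  i≢j  = trans (cong (_! i) (tr≡transposition i j)) $ trans (Vecₚ.lookup∘update′ i≢j (e [ i ]≔ lookup e j) (lookup e i))
                       (trans (Vecₚ.lookup∘update i e (lookup e j)) (e-! j))

tr-≢ : ∀ {n} {i j k : Fin n} → k ≢ i → k ≢ j → tr i j ! k ≡ k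
tr-≢ {i = i} {j} {k} k≢i k≢j = trans (cong (_! k) (tr≡transposition i j)) $ trans (Vecₚ.lookup∘update′ k≢j (e [ i ]≔ lookup e j) (lookup e i))
                       (trans (Vecₚ.lookup∘update′ k≢i e (lookup e j)) (e-! k))

tr-cases : ∀ {n} {P : Fin n → Fin n → Set} (i j : Fin n) → P i j → P j i →
           (∀ k → k ≢ i → k ≢ j → P k k) → ∀ k → P k (tr i j ! k)
tr-cases {P = P} i j p q r k with k ≟ i | k ≟ j
... | yes refl | _        = subst (P i) (sym (tr-ˡ i j)) p
... | no _     | yes refl = subst (P j) (sym (tr-ʳ i j)) q
... | no k≢i   | no k≢j   = subst (P k) (sym (tr-≢ k≢i k≢j)) (r k k≢i k≢j)

tr-tr : ∀ {n} (i j k : Fin n) → tr i j ! (tr i j ! k) ≡ k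
tr-tr i j = tr-cases {P = λ k l → tr i j ! l ≡ k} i j (tr-ʳ i j) (tr-ˡ i j) λ k → tr-≢

perm-tr : ∀ {n} (i j : Fin n) → Perm (tr i j)
perm-tr i j = mkPerm λ k l p → trans (sym (tr-tr i j k)) (trans (cong (tr i j !_) p) (tr-tr i j l))

tr-involutive : ∀ {n} (i j : Fin n) → tr i j ∙ tr i j ≡ e
tr-involutive i j = word-ext λ k → trans (∙-! (tr i j) (tr i j) k) (trans (tr-tr i j k) (sym (e-! k)))

∙-tr-ˡ : ∀ {n} (w : Word n) i j → (w ∙ tr i j) ! i ≡ w ! j
∙-tr-ˡ w i j = trans (∙-! w (tr i j) i) (cong (w !_) (tr-ˡ i j))

∙-tr-ʳ : ∀ {n} (w : Word n) i j → (w ∙ tr i j) ! j ≡ w ! i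
∙-tr-ʳ w i j = trans (∙-! w (tr i j) j) (cong (w !_) (tr-ʳ i j))

∙-tr-≢ : ∀ {n} (w : Word n) {i j k} → k ≢ i → k ≢ j → (w ∙ tr i j) ! k ≡ w ! k
∙-tr-≢ w {i} {j} {k} p q = trans (∙-! w (tr i j) k) (cong (w !_) (tr-≢ p q))

∙-tr-tr : ∀ {n} (w : Word n) i j → (w ∙ tr i j) ∙ tr i j ≡ w
∙-tr-tr w i j = trans (∙-assoc w (tr i j) (tr i j))
  (trans (cong (w ∙_) (tr-involutive i j)) (∙-identityʳ w))

tr-sym : ∀ {n} (i j : Fin n) → tr i j ≡ tr j i
tr-sym i j = word-ext (tr-cases {P = λ k l → l ≡ tr j i ! k} i j
  (sym (tr-ʳ j i)) (sym (tr-ˡ j i)) λ k p q → sym (tr-≢ q p))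

-- Conjugation: a swap of positions on the right of `g` becomes a swap of values on its left.
∙-tr : ∀ {n} {g : Word n} → Perm g → ∀ i j → g ∙ tr i j ≡ tr (g ! i) (g ! j) ∙ g
∙-tr {g = g} pg i j = word-ext λ k → trans (∙-! g (tr i j) k) (trans
  (tr-cases {P = λ k l → g ! l ≡ tr (g ! i) (g ! j) ! (g ! k)} i j
    (sym (tr-ˡ _ _)) (sym (tr-ʳ _ _))
    (λ k p q → sym (tr-≢ (λ r → p (injective pg _ _ r)) (λ r → q (injective pg _ _ r)))) k)
  (sym (∙-! (tr (g ! i) (g ! j)) g k)))

-- Length

Sum : ∀ {n} → (Fin n → ℕ) → ℕ
Sum {zero}  f = 0
Sum {suc n} f = f zero + Sum (f ∘ suc)

sum-map-allFin : ∀ {n} (f : Fin n → ℕ) → sum (List.map f (List.allFin n)) ≡ Sum f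
sum-map-allFin f = trans (cong sum (Listₚ.map-tabulate id f)) (go f)
  where
  go : ∀ {n} (f : Fin n → ℕ) → sum (List.tabulate f) ≡ Sum f
  go {zero}  f = refl
  go {suc n} f = cong (f zero +_) (go (f ∘ suc))

Sum-cong : ∀ {n} {f g : Fin n → ℕ} → (∀ i → f i ≡ g i) → Sum f ≡ Sum g
Sum-cong {zero}  h = refl
Sum-cong {suc n} h = cong₂ _+_ (h zero) (Sum-cong (h ∘ suc))

Sum-mono : ∀ {n} {f g : Fin n → ℕ} → (∀ i → f i ℕ.≤ g i) → Sum f ℕ.≤ Sum g
Sum-mono {zero}  h = z≤n
Sum-mono {suc n} h = ℕₚ.+-mono-≤ (h zero) (Sum-mono (h ∘ suc))

Sum-0 : ∀ n → Sum {n} (λ _ → 0) ≡ 0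
Sum-0 zero    = refl
Sum-0 (suc n) = Sum-0 n

+-interchange : ∀ a b c d → (a + b) + (c + d) ≡ (a + c) + (b + d)
+-interchange a b c d = begin
  (a + b) + (c + d)  ≡⟨ ℕₚ.+-assoc a b (c + d) ⟩
  a + (b + (c + d))  ≡⟨ cong (a +_) (sym (ℕₚ.+-assoc b c d)) ⟩
  a + ((b + c) + d)  ≡⟨ cong (λ z → a + (z + d)) (ℕₚ.+-comm b c) ⟩
  a + ((c + b) + d)  ≡⟨ cong (a +_) (ℕₚ.+-assoc c b d) ⟩
  a + (c + (b + d))  ≡⟨ sym (ℕₚ.+-assoc a c (b + d)) ⟩
  (a + c) + (b + d)  ∎
  where open ≡-Reasoning

Sum-+ : ∀ {n} (f g : Fin n → ℕ) → Sum (λ i → f i + g i) ≡ Sum f + Sum g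
Sum-+ {zero}  f g = refl
Sum-+ {suc n} f g = trans (cong (f zero + g zero +_) (Sum-+ (f ∘ suc) (g ∘ suc)))
  (+-interchange (f zero) (g zero) (Sum (f ∘ suc)) (Sum (g ∘ suc)))

without : ∀ {n} → Fin n → (Fin n → ℕ) → Fin n → ℕ
without i f k = if ⌊ k ≟ i ⌋ then 0 else f k

without-≢ : ∀ {n} {i k : Fin n} f → k ≢ i → without i f k ≡ f k
without-≢ {i = i} {k} f k≢i with k ≟ i
... | yes p = ⊥-elim (k≢i p)
... | no _  = refl

without-suc : ∀ {n} (i : Fin n) f k → without (suc i) f (suc k) ≡ without i (f ∘ suc) k
without-suc i f k with k ≟ i
... | yes _ = refl
... | no _  = refl

Sum-without : ∀ {n} i (f : Fin n → ℕ) → Sum f ≡ f i + Sum (without i f)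
Sum-without zero    f = refl
Sum-without (suc i) f = begin
  f zero + Sum (f ∘ suc)                            ≡⟨ cong (f zero +_) (Sum-without i (f ∘ suc)) ⟩
  f zero + (f (suc i) + Sum (without i (f ∘ suc)))  ≡⟨ sym (ℕₚ.+-assoc (f zero) (f (suc i)) _) ⟩
  (f zero + f (suc i)) + Sum (without i (f ∘ suc))  ≡⟨ cong (_+ Sum (without i (f ∘ suc))) (ℕₚ.+-comm (f zero) _) ⟩
  (f (suc i) + f zero) + Sum (without i (f ∘ suc))  ≡⟨ ℕₚ.+-assoc (f (suc i)) (f zero) _ ⟩
  f (suc i) + (f zero + Sum (without i (f ∘ suc)))  ≡⟨ cong (λ z → f (suc i) + (f zero + z)) (sym (Sum-cong (without-suc i f))) ⟩
  f (suc i) + Sum (without (suc i) f)               ∎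
  where open ≡-Reasoning

without₂ : ∀ {n} → Fin n → Fin n → (Fin n → ℕ) → Fin n → ℕ
without₂ i j f = without j (without i f)

Sum-without₂ : ∀ {n} {i j : Fin n} → i ≢ j → ∀ f → Sum f ≡ (f i + f j) + Sum (without₂ i j f)
Sum-without₂ {i = i} {j} i≢j f = begin
  Sum f                                            ≡⟨ Sum-without i f ⟩
  f i + Sum (without i f)                          ≡⟨ cong (f i +_) (Sum-without j (without i f)) ⟩
  f i + (without i f j + Sum (without₂ i j f))     ≡⟨ sym (ℕₚ.+-assoc (f i) _ _) ⟩
  (f i + without i f j) + Sum (without₂ i j f)     ≡⟨ cong (λ z → (f i + z) + Sum (without₂ i j f)) (without-≢ f (i≢j ∘ sym)) ⟩
  (f i + f j) + Sum (without₂ i j f)               ∎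
  where open ≡-Reasoning

without₂-rel : ∀ {n} (_~_ : ℕ → ℕ → Set) → 0 ~ 0 → ∀ (i j : Fin n) f g →
  (∀ k → k ≢ i → k ≢ j → f k ~ g k) → ∀ k → without₂ i j f k ~ without₂ i j g k
without₂-rel _~_ z i j f g h k with k ≟ j | k ≟ i
... | yes _ | _     = z
... | no _  | yes _ = z
... | no p  | no q  = h k q p

Sum-without₂-cong : ∀ {n} (i j : Fin n) {f g} → (∀ k → k ≢ i → k ≢ j → f k ≡ g k) →
  Sum (without₂ i j f) ≡ Sum (without₂ i j g)
Sum-without₂-cong i j {f} {g} h = Sum-cong (without₂-rel _≡_ refl i j f g h)

Sum-without₂-mono : ∀ {n} (i j : Fin n) {f g} → (∀ k → k ≢ i → k ≢ j → f k ℕ.≤ g k) →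
  Sum (without₂ i j f) ℕ.≤ Sum (without₂ i j g)
Sum-without₂-mono i j {f} {g} h = Sum-mono (without₂-rel ℕ._≤_ z≤n i j f g h)

without₂-+ : ∀ {n} (i j : Fin n) f g k →
  without₂ i j (λ k → f k + g k) k ≡ without₂ i j f k + without₂ i j g k
without₂-+ i j f g k with k ≟ j | k ≟ i
... | yes _ | _     = refl
... | no _  | yes _ = refl
... | no _  | no _  = refl

inversion : ∀ {n} → Fin n → Fin n → Fin n → Fin n → ℕ
inversion a b x y = if ⌊ a <? b ⌋ ∧ ⌊ y <? x ⌋ then 1 else 0

inversionAt : ∀ {n} → Word n → Fin n → Fin n → ℕ
inversionAt w a b = inversion a b (w ! a) (w ! b)

ℓ-Sum : ∀ {n} (w : Word n) → ℓ w ≡ Sum λ a → Sum λ b → inversionAt w a b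
ℓ-Sum w = trans (sum-map-allFin (λ a → sum (List.map (inversionAt w a) (List.allFin _))))
  (Sum-cong λ a → sum-map-allFin (inversionAt w a))

inversion-≡1 : ∀ {n} {a b x y : Fin n} → a < b → y < x → inversion a b x y ≡ 1
inversion-≡1 {a = a} {b} {x} {y} p q with a <? b | y <? x
... | yes _ | yes _ = refl
... | no ¬p | _     = ⊥-elim (¬p p)
... | yes _ | no ¬q = ⊥-elim (¬q q)

inversion-≡0 : ∀ {n} (a b x y : Fin n) → ¬ (a < b) ⊎ ¬ (y < x) → inversion a b x y ≡ 0
inversion-≡0 a b x y h with a <? b | y <? x | h
... | yes p | yes q | inj₁ ¬p = ⊥-elim (¬p p)
... | yes p | yes q | inj₂ ¬q = ⊥-elim (¬q q)
... | no _  | _     | _ = refl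
... | yes _ | no _  | _ = refl

inversion-diag : ∀ {n} (a x : Fin n) → inversion a a x x ≡ 0
inversion-diag a x = inversion-≡0 a a x x (inj₁ (<-irrefl refl))

module _ {n} {i j p q : Fin n} (i<j : i < j) (p<q : p < q) where

  -- Exchanging `p` at `i` with the larger `q` at `j` cannot lower the number of inversions with a
  -- third entry `x` at `k`. The number stays the same unless `k` lies between the positions and `x`
  -- between the values.
  row-≤ : ∀ k x → inversion i k p x + inversion j k q x ℕ.≤ inversion i k q x + inversion j k p x
  row-≤ k x with i <? k | j <? k | x <? p | x <? q
  ... | no ¬a | yes b | _     | _     = ⊥-elim (¬a (<-trans i<j b))
  ... | _     | _     | yes c | no ¬d = ⊥-elim (¬d (<-trans c p<q))
  ... | no _  | no _  | yes _ | yes _ = z≤n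
  ... | no _  | no _  | no _  | yes _ = z≤n
  ... | no _  | no _  | no _  | no _  = z≤n
  ... | yes _ | no _  | yes _ | yes _ = ≤-refl
  ... | yes _ | no _  | no _  | yes _ = z≤n
  ... | yes _ | no _  | no _  | no _  = z≤n
  ... | yes _ | yes _ | yes _ | yes _ = ≤-refl
  ... | yes _ | yes _ | no _  | yes _ = ≤-refl
  ... | yes _ | yes _ | no _  | no _  = z≤n

  row-≡ : ∀ k x → k ≢ j → x ≢ p → ¬ (i < k × k < j × p < x × x < q) →
          inversion i k q x + inversion j k p x ≡ inversion i k p x + inversion j k q x
  row-≡ k x k≢j x≢p h with i <? k | j <? k | x <? p | x <? q
  ... | no ¬a | yes b | _     | _     = ⊥-elim (¬a (<-trans i<j b))
  ... | _     | _     | yes c | no ¬d = ⊥-elim (¬d (<-trans c p<q))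
  ... | no _  | no _  | yes _ | yes _ = refl
  ... | no _  | no _  | no _  | yes _ = refl
  ... | no _  | no _  | no _  | no _  = refl
  ... | yes _ | no _  | yes _ | yes _ = refl
  ... | yes a | no ¬b | no ¬c | yes d = ⊥-elim (h (a , ≤∧≢⇒< (≮⇒≥ ¬b) k≢j ,
                                          ≤∧≢⇒< (≮⇒≥ ¬c) (x≢p ∘ sym) , d))
  ... | yes _ | no _  | no _  | no _  = refl
  ... | yes _ | yes _ | yes _ | yes _ = refl
  ... | yes _ | yes _ | no _  | yes _ = refl
  ... | yes _ | yes _ | no _  | no _  = refl

  col-≤ : ∀ k x → inversion k i x p + inversion k j x q ℕ.≤ inversion k i x q + inversion k j x p
  col-≤ k x with k <? i | k <? j | p <? x | q <? x
  ... | yes a | no ¬b | _     | _     = ⊥-elim (¬b (<-trans a i<j))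
  ... | _     | _     | no ¬c | yes d = ⊥-elim (¬c (<-trans p<q d))
  ... | no _  | no _  | yes _ | yes _ = z≤n
  ... | no _  | no _  | yes _ | no _  = z≤n
  ... | no _  | no _  | no _  | no _  = z≤n
  ... | no _  | yes _ | yes _ | yes _ = ≤-refl
  ... | no _  | yes _ | yes _ | no _  = z≤n
  ... | no _  | yes _ | no _  | no _  = z≤n
  ... | yes _ | yes _ | yes _ | yes _ = ≤-refl
  ... | yes _ | yes _ | yes _ | no _  = ≤-refl
  ... | yes _ | yes _ | no _  | no _  = z≤n

  col-≡ : ∀ k x → k ≢ i → x ≢ q → ¬ (i < k × k < j × p < x × x < q) →
          inversion k i x q + inversion k j x p ≡ inversion k i x p + inversion k j x q
  col-≡ k x k≢i x≢q h with k <? i | k <? j | p <? x | q <? x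
  ... | yes a | no ¬b | _     | _     = ⊥-elim (¬b (<-trans a i<j))
  ... | _     | _     | no ¬c | yes d = ⊥-elim (¬c (<-trans p<q d))
  ... | no _  | no _  | yes _ | yes _ = refl
  ... | no _  | no _  | yes _ | no _  = refl
  ... | no _  | no _  | no _  | no _  = refl
  ... | no _  | yes _ | yes _ | yes _ = refl
  ... | no ¬a | yes b | yes c | no ¬d = ⊥-elim (h (≤∧≢⇒< (≮⇒≥ ¬a) (k≢i ∘ sym) , b , c ,
                                          ≤∧≢⇒< (≮⇒≥ ¬d) x≢q))
  ... | no _  | yes _ | no _  | no _  = refl
  ... | yes _ | yes _ | yes _ | yes _ = refl
  ... | yes _ | yes _ | yes _ | no _  = refl
  ... | yes _ | yes _ | no _  | no _  = refl

-- The inversions are grouped by how many of their two positions are swapped.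
module _ {n} {i j : Fin n} (i≢j : i ≢ j) (w : Word n) where

  rowPart colPart restPart : Fin n → ℕ
  rowPart  k = inversionAt w i k + inversionAt w j k
  colPart  k = inversionAt w k i + inversionAt w k j
  restPart k = Sum (without₂ i j (inversionAt w k))

  corner : ℕ
  corner = (inversionAt w i i + inversionAt w i j) + (inversionAt w j i + inversionAt w j j)

  rows cols : ℕ
  rows = Sum (without₂ i j rowPart)
  cols = Sum (without₂ i j (λ k → colPart k + restPart k))

  ℓ-split : ℓ w ≡ corner + (rows + cols)
  ℓ-split = begin
    ℓ w                                              ≡⟨ ℓ-Sum w ⟩
    Sum R                                            ≡⟨ Sum-without₂ i≢j R ⟩
    (R i + R j) + Sum (without₂ i j R)               ≡⟨ cong₂ _+_ rows-≡ (Sum-without₂-cong i j λ k _ _ → split k) ⟩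
    (corner + rows) + cols                           ≡⟨ ℕₚ.+-assoc corner rows cols ⟩
    corner + (rows + cols)                           ∎
    where
    open ≡-Reasoning
    R : Fin n → ℕ
    R a = Sum (inversionAt w a)
    split : ∀ k → R k ≡ colPart k + restPart k
    split k = Sum-without₂ i≢j (inversionAt w k)
    rows-≡ : R i + R j ≡ corner + rows
    rows-≡ = begin
      R i + R j                                        ≡⟨ cong₂ _+_ (split i) (split j) ⟩
      (colPart i + restPart i) + (colPart j + restPart j) ≡⟨ +-interchange (colPart i) (restPart i) (colPart j) (restPart j) ⟩
      corner + (restPart i + restPart j)               ≡⟨ cong (corner +_) (sym (trans (Sum-cong (without₂-+ i j (inversionAt w i) (inversionAt w j))) (Sum-+ (without₂ i j (inversionAt w i)) (without₂ i j (inversionAt w j))))) ⟩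
      corner + rows                                    ∎

module _ {n} {w : Word n} {i j : Fin n} (pw : Perm w) (i<j : i < j) (wi<wj : w ! i < w ! j) where

  private
    w′ : Word n
    w′ = w ∙ tr i j

    i≢j : i ≢ j
    i≢j = <⇒≢ i<j

    rowPart′ : ∀ k → k ≢ i → k ≢ j → rowPart i≢j w′ k ≡ inversion i k (w ! j) (w ! k) + inversion j k (w ! i) (w ! k)
    rowPart′ k k≢i k≢j = cong₂ _+_ (cong₂ (inversion i k) (∙-tr-ˡ w i j) (∙-tr-≢ w k≢i k≢j))
                                   (cong₂ (inversion j k) (∙-tr-ʳ w i j) (∙-tr-≢ w k≢i k≢j))

    colPart′ : ∀ k → k ≢ i → k ≢ j → colPart i≢j w′ k ≡ inversion k i (w ! k) (w ! j) + inversion k j (w ! k) (w ! i)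
    colPart′ k k≢i k≢j = cong₂ _+_ (cong₂ (inversion k i) (∙-tr-≢ w k≢i k≢j) (∙-tr-ˡ w i j))
                                   (cong₂ (inversion k j) (∙-tr-≢ w k≢i k≢j) (∙-tr-ʳ w i j))

    restPart′ : ∀ k → k ≢ i → k ≢ j → restPart i≢j w′ k ≡ restPart i≢j w k
    restPart′ k k≢i k≢j = Sum-without₂-cong i j λ l l≢i l≢j →
      cong₂ (inversion k l) (∙-tr-≢ w k≢i k≢j) (∙-tr-≢ w l≢i l≢j)

    corner-w : corner i≢j w ≡ 0
    corner-w = cong₂ _+_
      (cong₂ _+_ (inversion-diag i (w ! i)) (inversion-≡0 i j (w ! i) (w ! j) (inj₂ (<-asym wi<wj))))
      (cong₂ _+_ (inversion-≡0 j i (w ! j) (w ! i) (inj₁ (<-asym i<j))) (inversion-diag j (w ! j)))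

    corner-w′ : corner i≢j w′ ≡ 1
    corner-w′ = cong₂ _+_
      (cong₂ _+_ (inversion-diag i (w′ ! i))
        (inversion-≡1 i<j (subst₂ _<_ (sym (∙-tr-ʳ w i j)) (sym (∙-tr-ˡ w i j)) wi<wj)))
      (cong₂ _+_ (inversion-≡0 j i (w′ ! j) (w′ ! i) (inj₁ (<-asym i<j))) (inversion-diag j (w′ ! j)))

  ℓ-swap-< : ℓ w ℕ.< ℓ (w ∙ tr i j)
  ℓ-swap-< = subst₂ ℕ._<_
    (sym (trans (ℓ-split i≢j w) (cong (_+ (rows i≢j w + cols i≢j w)) corner-w)))
    (sym (trans (ℓ-split i≢j w′) (cong (_+ (rows i≢j w′ + cols i≢j w′)) corner-w′)))
    (s≤s (ℕₚ.+-mono-≤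
      (Sum-without₂-mono i j λ k k≢i k≢j →
        subst (rowPart i≢j w k ℕ.≤_) (sym (rowPart′ k k≢i k≢j)) (row-≤ i<j wi<wj k (w ! k)))
      (Sum-without₂-mono i j λ k k≢i k≢j → ℕₚ.+-mono-≤
        (subst (colPart i≢j w k ℕ.≤_) (sym (colPart′ k k≢i k≢j)) (col-≤ i<j wi<wj k (w ! k)))
        (≤-reflexive (sym (restPart′ k k≢i k≢j))))))

  ℓ-swap-≡ : (∀ k → ¬ (i < k × k < j × w ! i < w ! k × w ! k < w ! j)) → ℓ (w ∙ tr i j) ≡ suc (ℓ w)
  ℓ-swap-≡ h = begin
    ℓ w′                                    ≡⟨ ℓ-split i≢j w′ ⟩
    corner i≢j w′ + (rows i≢j w′ + cols i≢j w′)   ≡⟨ cong₂ _+_ corner-w′ (cong₂ _+_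
      (Sum-without₂-cong i j λ k k≢i k≢j →
        trans (rowPart′ k k≢i k≢j) (row-≡ i<j wi<wj k (w ! k) k≢j (λ q → k≢i (injective pw _ _ q)) (h k)))
      (Sum-without₂-cong i j λ k k≢i k≢j → cong₂ _+_
        (trans (colPart′ k k≢i k≢j) (col-≡ i<j wi<wj k (w ! k) k≢i (λ q → k≢j (injective pw _ _ q)) (h k)))
        (restPart′ k k≢i k≢j))) ⟩
    suc (rows i≢j w + cols i≢j w)           ≡⟨ cong (λ c → suc (c + (rows i≢j w + cols i≢j w))) (sym corner-w) ⟩
    suc (corner i≢j w + (rows i≢j w + cols i≢j w)) ≡⟨ cong suc (sym (ℓ-split i≢j w)) ⟩
    suc (ℓ w)                               ∎
    where open ≡-Reasoning

-- Bruhat order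

step-down : ∀ {n} {v : Word n} {i j} → Perm v → i < j → v ! j < v ! i → BruhatStep (v ∙ tr i j) v
step-down {v = v} {i} {j} pv i<j h = i , j , i<j ,
  trans (sym (∙-tr-tr v i j)) (∙-tr≡ (v ∙ tr i j) i j) ,
  subst (ℓ (v ∙ tr i j) ℕ.<_) (cong ℓ (∙-tr-tr v i j))
    (ℓ-swap-< (perm-∙ pv (perm-tr i j)) i<j
      (subst₂ _<_ (sym (∙-tr-ˡ v i j)) (sym (∙-tr-ʳ v i j)) h))

step-up : ∀ {n} {u : Word n} {i j} → Perm u → i < j → u ! i < u ! j → BruhatStep u (u ∙ tr i j)
step-up {u = u} {i} {j} pu i<j h = i , j , i<j , ∙-tr≡ u i j , ℓ-swap-< pu i<j h

-- If `i`, `j` were not an inversion of `v`, swapping back would lengthen `v` to `u`, against the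
-- length condition of the step.
step-down⁻¹ : ∀ {n} {u v : Word n} → Perm v → BruhatStep u v →
  ∃₂ λ i j → i < j × v ! j < v ! i × u ≡ v ∙ tr i j
step-down⁻¹ {u = u} {v} pv (i , j , i<j , v≡· , lt) with trans v≡· (sym (∙-tr≡ u i j)) | <-cmp (v ! i) (v ! j)
... | v≡ | tri> _ _ h = i , j , i<j , h , u≡
  where
  u≡ : u ≡ v ∙ tr i j
  u≡ = trans (sym (∙-tr-tr u i j)) (cong (_∙ tr i j) (sym v≡))
... | _ | tri≈ _ q _ = ⊥-elim (<⇒≢ i<j (injective pv i j q))
... | v≡ | tri< h _ _ = ⊥-elim (<-asym lt (subst (ℓ v ℕ.<_)
        (cong ℓ (trans (cong (_∙ tr i j) v≡) (∙-tr-tr u i j))) (ℓ-swap-< pv i<j h)))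

perm-below : ∀ {n} {u v : Word n} → Perm v → BruhatStep u v → Perm u
perm-below {u = u} {v} pv st with step-down⁻¹ {u = u} {v} pv st
... | i , j , _ , _ , refl = perm-∙ pv (perm-tr i j)

perm-above : ∀ {n} {u v : Word n} → Perm u → BruhatStep u v → Perm v
perm-above {u = u} pu (i , j , _ , refl , _) = subst Perm (∙-tr≡ u i j) (perm-∙ pu (perm-tr i j))

step-up⁻¹ : ∀ {n} {u v : Word n} → Perm u → BruhatStep u v →
  ∃₂ λ i j → i < j × u ! i < u ! j × v ≡ u ∙ tr i j
step-up⁻¹ {u = u} {v} pu st with step-down⁻¹ {u = u} {v} (perm-above {u = u} {v} pu st) st
... | i , j , i<j , h , refl = i , j , i<j ,
        subst₂ _<_ (sym (∙-tr-ˡ v i j)) (sym (∙-tr-ʳ v i j)) h , sym (∙-tr-tr v i j)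

perm-≤ : ∀ {n} {u v : Word n} → Perm v → u ≤B v → Perm u
perm-≤ pv ε        = pv
perm-≤ pv (_◅_ {i = u} {v} s ss) = perm-below {u = u} {v} (perm-≤ pv ss) s

-- Induction down the Bruhat order: every step down from a permutation swaps the two positions of an
-- inversion.
down-closed : ∀ {n} (P : Word n → Set) →
  (∀ {v} i j → Perm v → P v → i < j → v ! j < v ! i → P (v ∙ tr i j)) →
  ∀ {u v} → Perm v → P v → u ≤B v → P u
down-closed P h pv Pv ε        = Pv
down-closed P h pv Pv (_◅_ {i = u} {v} s ss) with step-down⁻¹ {u = u} {v} (perm-≤ pv ss) s
... | i , j , i<j , lt , refl = h i j (perm-≤ pv ss) (down-closed P h pv Pv ss) i<j lt

ℓ-mono : ∀ {n} {u v : Word n} → u ≤B v → ℓ u ℕ.≤ ℓ v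
ℓ-mono ε = ≤-refl
ℓ-mono ((_ , _ , _ , _ , lt) ◅ ss) = ≤-trans (<⇒≤ lt) (ℓ-mono ss)

≤B∧ℓ≥⇒≡ : ∀ {n} {u v : Word n} → u ≤B v → ℓ v ℕ.≤ ℓ u → u ≡ v
≤B∧ℓ≥⇒≡ ε _ = refl
≤B∧ℓ≥⇒≡ ((_ , _ , _ , _ , lt) ◅ ss) ge =
  ⊥-elim (<⇒≱ lt (≤-trans (ℓ-mono ss) ge))

ℓ-strict : ∀ {n} {u v : Word n} → u <B v → ℓ u ℕ.< ℓ v
ℓ-strict (le , ne) = ≰⇒> λ ge → ne (≤B∧ℓ≥⇒≡ le ge)

increasing-≥ : ∀ {n} (f : Fin n → Fin n) → (∀ i j → i < j → f i < f j) → ∀ i → i ≤ f i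
increasing-≥ f mono i = go (toℕ i) i refl
  where
  go : ∀ k i → toℕ i ≡ k → k ℕ.≤ toℕ (f i)
  go zero    i       _ = z≤n
  go (suc k) (suc i) q = ≤-trans (s≤s (go k (inject₁ i) (trans (Finₚ.toℕ-inject₁ i) (ℕₚ.suc-injective q))))
    (mono (inject₁ i) (suc i) (≤-reflexive (cong suc (Finₚ.toℕ-inject₁ i))))

-- An increasing self-map of `Fin n` is nowhere below the identity. The inverse is increasing too,
-- which gives the other inequality.
increasing⇒e : ∀ {n} {w : Word n} → Perm w → (∀ i j → i < j → w ! i < w ! j) → w ≡ e
increasing⇒e {w = w} pw mono = word-ext λ i → trans
  (toℕ-injective (≤-antisym (upper i) (increasing-≥ (w !_) mono i))) (sym (e-! i))
  where
  mono⁻¹ : ∀ i j → i < j → inv w ! i < inv w ! j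
  mono⁻¹ i j i<j with <-cmp (inv w ! i) (inv w ! j)
  ... | tri< h _ _ = h
  ... | tri≈ _ q _ = ⊥-elim (<⇒≢ i<j (injective (perm-inv pw) i j q))
  ... | tri> _ _ h = ⊥-elim (<-asym i<j (subst₂ _<_ (!-inv pw j) (!-inv pw i) (mono _ _ h)))
  upper : ∀ i → w ! i ≤ i
  upper i = subst (toℕ (w ! i) ℕ.≤_) (cong toℕ (inv-! pw i)) (increasing-≥ (inv w !_) mono⁻¹ (w ! i))

inversion? : ∀ {n} (w : Word n) → Dec (∃₂ λ i j → i < j × w ! j < w ! i)
inversion? w = any? λ i → any? λ j → (i <? j) ×-dec (w ! j <? w ! i)

no-inversion⇒e : ∀ {n} {w : Word n} → Perm w → ¬ (∃₂ λ i j → i < j × w ! j < w ! i) → w ≡ e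
no-inversion⇒e {w = w} pw h = increasing⇒e pw λ i j i<j →
  ≤∧≢⇒< (≮⇒≥ λ lt → h (i , j , i<j , lt)) λ q → <⇒≢ i<j (injective pw i j q)

e≤ : ∀ {n} {w : Word n} → Perm w → e ≤B w
e≤ {w = w} pw = go (ℓ w) pw ≤-refl
  where
  go : ∀ d {w} → Perm w → ℓ w ℕ.≤ d → e ≤B w
  go d {w} pw le with inversion? w
  go d pw le | no h = subst (e ≤B_) (sym (no-inversion⇒e pw h)) ε
  go zero pw le | yes (i , j , i<j , lt) with step-down pw i<j lt
  ... | (_ , _ , _ , _ , l<) = ⊥-elim (<⇒≱ l< (≤-trans le z≤n))
  go (suc d) pw le | yes (i , j , i<j , lt) with step-down pw i<j lt
  ... | st@(_ , _ , _ , _ , l<) =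
    go d (perm-∙ pw (perm-tr i j)) (≤-pred (≤-trans l< le)) ◅◅ (st ◅ ε)

ℓ-e : ∀ n → ℓ (e {n}) ≡ 0
ℓ-e n = trans (ℓ-Sum (e {n})) (trans (Sum-cong λ a → trans (Sum-cong (zero-at a)) (Sum-0 n)) (Sum-0 n))
  where
  zero-at : ∀ a b → inversionAt (e {n}) a b ≡ 0
  zero-at a b = inversion-≡0 a b (e ! a) (e ! b) (case a <? b of λ where
    (no ¬p) → inj₁ ¬p
    (yes p) → inj₂ λ q → <-asym p (subst₂ _<_ (e-! b) (e-! a) q))

CoverStep : ∀ {n} → Word n → Word n → Set
CoverStep u v = BruhatStep u v × ℓ v ≡ suc (ℓ u)

-- A step that exchanges values a < b past an intermediate value c between
-- the two positions factors as (a,c,b) → (c,a,b) → (b,a,c) → (b,c,a).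
refine : ∀ {n} d {u v : Word n} → Perm u → BruhatStep u v → ℓ v ℕ.≤ ℓ u + d → Star CoverStep u v
refine zero {u} pu (_ , _ , _ , _ , lt) le =
  ⊥-elim (<⇒≱ lt (subst (_ ℕ.≤_) (ℕₚ.+-identityʳ (ℓ u)) le))
refine (suc d) {u} {v} pu st le with step-up⁻¹ {u = u} {v} pu st
... | i , j , i<j , h , refl
  with any? (λ k → (i <? k) ×-dec (k <? j) ×-dec (u ! i <? u ! k) ×-dec (u ! k <? u ! j))
... | no none = (st , ℓ-swap-≡ pu i<j h λ k q → none (k , q)) ◅ ε
... | yes (k , i<k , k<j , ik , kj) =
  -- Each of the three steps gains at least one in length, so each gains less than the whole and the
  -- smaller bound `d` suffices for it.
  refine d pu st₁ (≤-pred (≤-trans (<-trans l₂ l₃) le′))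
  ◅◅ refine d p₁ st₂ (≤-trans (<⇒≤ l₃) (≤-trans le′ (ℕₚ.+-monoˡ-≤ d l₁)))
  ◅◅ subst (Star CoverStep u₂) u₃≡ (refine d p₂ st₃ (≤-trans le′ (ℕₚ.+-monoˡ-≤ d (<-trans l₁ l₂))))
  where
  u₁ u₂ u₃ : Word _
  u₁ = u ∙ tr i k
  u₂ = u₁ ∙ tr i j
  u₃ = u₂ ∙ tr k j
  p₁ : Perm u₁
  p₁ = perm-∙ pu (perm-tr i k)
  p₂ : Perm u₂
  p₂ = perm-∙ p₁ (perm-tr i j)
  i≢k : i ≢ k
  i≢k = <⇒≢ i<k
  j≢k : j ≢ k
  j≢k = <⇒≢ k<j ∘ sym
  j≢i : j ≢ i
  j≢i = <⇒≢ i<j ∘ sym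
  st₁ : BruhatStep u u₁
  st₁ = step-up pu i<k ik
  st₂ : BruhatStep u₁ u₂
  st₂ = step-up p₁ i<j (subst₂ _<_ (sym (∙-tr-ˡ u i k)) (sym (∙-tr-≢ u j≢i j≢k)) kj)
  st₃ : BruhatStep u₂ u₃
  st₃ = step-up p₂ k<j (subst₂ _<_
    (sym (trans (∙-tr-≢ u₁ (i≢k ∘ sym) (j≢k ∘ sym)) (∙-tr-ʳ u i k)))
    (sym (trans (∙-tr-ʳ u₁ i j) (∙-tr-ˡ u i k))) ik)
  l₁ : ℓ u ℕ.< ℓ u₁
  l₁ = proj₂ (proj₂ (proj₂ (proj₂ st₁)))
  l₂ : ℓ u₁ ℕ.< ℓ u₂
  l₂ = proj₂ (proj₂ (proj₂ (proj₂ st₂)))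
  l₃ : ℓ u₂ ℕ.< ℓ u₃
  l₃ = proj₂ (proj₂ (proj₂ (proj₂ st₃)))
  u₃≡ : u₃ ≡ u ∙ tr i j
  u₃≡ = begin
    ((u ∙ tr i k) ∙ tr i j) ∙ tr k j   ≡⟨ ∙-assoc (u ∙ tr i k) (tr i j) (tr k j) ⟩
    (u ∙ tr i k) ∙ (tr i j ∙ tr k j)   ≡⟨ cong ((u ∙ tr i k) ∙_) (∙-tr (perm-tr i j) k j) ⟩
    (u ∙ tr i k) ∙ (tr (tr i j ! k) (tr i j ! j) ∙ tr i j)
      ≡⟨ cong₂ (λ x y → (u ∙ tr i k) ∙ (tr x y ∙ tr i j)) (tr-≢ (i≢k ∘ sym) (j≢k ∘ sym)) (tr-ʳ i j) ⟩
    (u ∙ tr i k) ∙ (tr k i ∙ tr i j)   ≡⟨ cong (λ t → (u ∙ tr i k) ∙ (t ∙ tr i j)) (tr-sym k i) ⟩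
    (u ∙ tr i k) ∙ (tr i k ∙ tr i j)   ≡⟨ sym (∙-assoc (u ∙ tr i k) (tr i k) (tr i j)) ⟩
    ((u ∙ tr i k) ∙ tr i k) ∙ tr i j   ≡⟨ cong (_∙ tr i j) (∙-tr-tr u i k) ⟩
    u ∙ tr i j                         ∎
    where open ≡-Reasoning
  le′ : ℓ u₃ ℕ.≤ suc (ℓ u + d)
  le′ = subst₂ ℕ._≤_ (cong ℓ (sym u₃≡)) (ℕₚ.+-suc (ℓ u) d) le

coverChain : ∀ {n} {u v : Word n} → Perm u → u ≤B v → Star CoverStep u v
coverChain pu ε        = ε
coverChain pu (_◅_ {i = u} {v} st ss) =
  refine (ℓ v) {u} {v} pu st (ℕₚ.m≤n+m (ℓ v) _) ◅◅ coverChain (perm-above {u = u} {v} pu st) ss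

ℓ-cover⇒⋖ : ∀ {n} {u v : Word n} → u ≤B v → ℓ v ≡ suc (ℓ u) → u ⋖ v
ℓ-cover⇒⋖ {u = u} {v} le q = (le , λ r → ℕₚ.1+n≢n (trans (sym q) (cong ℓ (sym r)))) ,
  λ (z , uz , zv) → <⇒≱ (ℓ-strict zv) (subst (ℕ._≤ ℓ z) (sym q) (ℓ-strict uz))

forget : ∀ {n} {u v : Word n} → Star CoverStep u v → u ≤B v
forget ε              = ε
forget ((st , _) ◅ ss) = st ◅ forget ss

-- From a duality of the interval to an isomorphism of the graphs

module SelfDual⇒Isomorphic {n} {w : Word n} (pw : Perm w) (sd : SelfDualInterval w) where

  private
    f : Word n → Word n
    f = proj₁ sd
    f-≤ : ∀ {x} → x ≤B w → f x ≤B w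
    f-≤ {x} = proj₁ (proj₂ sd) x
    f-inj : ∀ {x y} → x ≤B w → y ≤B w → f x ≡ f y → x ≡ y
    f-inj = proj₁ (proj₂ (proj₂ sd)) _ _
    f-surj : ∀ {y} → y ≤B w → Σ (Word n) λ x → (x ≤B w) × f x ≡ y
    f-surj = proj₁ (proj₂ (proj₂ (proj₂ sd))) _
    f-anti : ∀ {x y} → x ≤B w → y ≤B w → x ≤B y → f y ≤B f x
    f-anti p q = proj₁ (proj₂ (proj₂ (proj₂ (proj₂ sd))) _ _ p q)
    f-anti⁻¹ : ∀ {x y} → x ≤B w → y ≤B w → f y ≤B f x → x ≤B y
    f-anti⁻¹ p q = proj₂ (proj₂ (proj₂ (proj₂ (proj₂ sd))) _ _ p q)

    f-< : ∀ {x y} → x ≤B w → y ≤B w → x <B y → f y <B f x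
    f-< p q (le , ne) = f-anti p q le , λ r → ne (sym (f-inj q p r))

    f-<⁻¹ : ∀ {x y} → x ≤B w → y ≤B w → f y <B f x → x <B y
    f-<⁻¹ p q (le , ne) = f-anti⁻¹ p q le , λ r → ne (cong f (sym r))

    f-⋖ : ∀ {x y} → x ≤B w → y ≤B w → x ⋖ y → f y ⋖ f x
    f-⋖ p q (lt , none) = f-< p q lt , λ { (z , yz , zx) →
      let (z′ , p′ , fz′≡z) = f-surj (proj₁ zx ◅◅ f-≤ p)
      in none (z′ , f-<⁻¹ p p′ (subst (_<B _) (sym fz′≡z) zx) , f-<⁻¹ p′ q (subst (_ <B_) (sym fz′≡z) yz)) }

    f-⋖⁻¹ : ∀ {x y} → x ≤B w → y ≤B w → f y ⋖ f x → x ⋖ y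
    f-⋖⁻¹ p q (lt , none) = f-<⁻¹ p q lt , λ { (z , xz , zy) →
      let r = proj₁ zy ◅◅ q in none (f z , f-< r q zy , f-< p r xz) }

    -- Along a cover `ℓ` grows by exactly one while the length of the image drops by at least one,
    -- so the sum never grows.
    rank-sum-anti : ∀ {x y} → x ≤B w → y ≤B w → Star CoverStep x y → ℓ (f y) + ℓ y ℕ.≤ ℓ (f x) + ℓ x
    rank-sum-anti p q ε = ≤-refl
    rank-sum-anti {x} {y} p q (_◅_ {j = z} (st , ℓz) ss) = ≤-trans (rank-sum-anti r q ss) (begin
      ℓ (f z) + ℓ z        ≡⟨ cong (ℓ (f z) +_) ℓz ⟩
      ℓ (f z) + suc (ℓ x)  ≡⟨ ℕₚ.+-suc (ℓ (f z)) (ℓ x) ⟩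
      suc (ℓ (f z)) + ℓ x  ≤⟨ ℕₚ.+-monoˡ-≤ (ℓ x) (ℓ-strict (f-< p r x<z)) ⟩
      ℓ (f x) + ℓ x        ∎)
      where
      open ℕₚ.≤-Reasoning
      x<z : x <B z
      x<z = st ◅ ε , λ u → ℕₚ.1+n≢n (trans (sym ℓz) (cong ℓ (sym u)))
      r : z ≤B w
      r = forget ss ◅◅ q

    -- The sum is at most `ℓ w` at `e`, at least `ℓ w` at `w`, and weakly decreasing in between.
    rank-complement : ∀ {x} → x ≤B w → ℓ (f x) + ℓ x ≡ ℓ w
    rank-complement {x} p = ≤-antisym
      (begin
        ℓ (f x) + ℓ x  ≤⟨ rank-sum-anti (e≤ pw) p (coverChain perm-e (e≤ px)) ⟩
        ℓ (f e) + ℓ (e {n})  ≡⟨ cong (ℓ (f e) +_) (ℓ-e n) ⟩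
        ℓ (f e) + 0    ≡⟨ ℕₚ.+-identityʳ _ ⟩
        ℓ (f e)        ≤⟨ ℓ-mono (f-≤ (e≤ pw)) ⟩
        ℓ w            ∎)
      (begin
        ℓ w            ≤⟨ ℕₚ.m≤n+m (ℓ w) (ℓ (f w)) ⟩
        ℓ (f w) + ℓ w  ≤⟨ rank-sum-anti p ε (coverChain px p) ⟩
        ℓ (f x) + ℓ x  ∎)
      where
      open ℕₚ.≤-Reasoning
      px = perm-≤ pw p

    corank : ∀ {x} k → x ≤B w → ℓ x ≡ k → ℓ (f x) + k ≡ ℓ w
    corank k p refl = rank-complement p

    corank⁻¹ : ∀ {x} k → x ≤B w → ℓ (f x) + k ≡ ℓ w → ℓ x ≡ k
    corank⁻¹ {x} k p q = ℕₚ.+-cancelˡ-≡ (ℓ (f x)) _ _ (trans (rank-complement p) (sym q))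

    F : Bool × Word n → Bool × Word n
    F (b , x) = b , f x

    F-vert : ∀ x → Vert (Γ_ w) x → Vert (Γ^ w) (F x)
    F-vert (false , x) (p , q) = f-≤ p , corank 1 p q
    F-vert (true  , x) (p , q) = f-≤ p , corank 2 p q

    below : ∀ x → Vert (Γ_ w) x → proj₂ x ≤B w
    below (false , _) = proj₁
    below (true  , _) = proj₁

    F-surj : ∀ y → Vert (Γ^ w) y → Σ (Bool × Word n) λ x → Vert (Γ_ w) x × F x ≡ y
    F-surj (false , y) (p , q) with f-surj p
    ... | x , r , refl = (false , x) , (r , corank⁻¹ 1 r q) , refl
    F-surj (true  , y) (p , q) with f-surj p
    ... | x , r , refl = (true , x) , (r , corank⁻¹ 2 r q) , refl

    ⋖-adj : ∀ {x y} → x ≤B w → y ≤B w → ((x ⋖ y) ⊎ (y ⋖ x) → (f x ⋖ f y) ⊎ (f y ⋖ f x))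
                                     × ((f x ⋖ f y) ⊎ (f y ⋖ f x) → (x ⋖ y) ⊎ (y ⋖ x))
    ⋖-adj p q = (λ { (inj₁ r) → inj₂ (f-⋖ p q r) ; (inj₂ r) → inj₁ (f-⋖ q p r) })
             , (λ { (inj₁ r) → inj₂ (f-⋖⁻¹ q p r) ; (inj₂ r) → inj₁ (f-⋖⁻¹ p q r) })

    F-adj : ∀ x y → Vert (Γ_ w) x → Vert (Γ_ w) y →
      (Adj (Γ_ w) x y → Adj (Γ^ w) (F x) (F y)) × (Adj (Γ^ w) (F x) (F y) → Adj (Γ_ w) x y)
    F-adj (false , x) (false , y) _ _ = (λ ()) , λ ()
    F-adj (true  , x) (true  , y) _ _ = (λ ()) , λ ()
    F-adj (false , x) (true  , y) (p , _) (q , _) = ⋖-adj p q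
    F-adj (true  , x) (false , y) (p , _) (q , _) = ⋖-adj p q

  isomorphic : Isomorphic (Γ_ w) (Γ^ w)
  isomorphic = F , F-vert
    , (λ x y p q r → cong₂ _,_ (cong proj₁ r) (f-inj (below x p) (below y q) (cong proj₂ r)))
    , F-surj , F-adj

-- Block-preserving permutations

-- A partition of the positions into intervals. The permutations that preserve each block form a
-- standard parabolic subgroup; described this way, membership is a pointwise condition and
-- intersections are immediate.
record Blocks (n : ℕ) : Set₁ where
  field
    _∼_     : Fin n → Fin n → Set
    _∼?_    : ∀ i j → Dec (i ∼ j)
    ∼-refl  : ∀ {i} → i ∼ i
    ∼-sym   : ∀ {i j} → i ∼ j → j ∼ i
    ∼-trans : ∀ {i j k} → i ∼ j → j ∼ k → i ∼ k
    convex  : ∀ {i j k} → i < j → j < k → i ∼ k → i ∼ j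

  -- Two intervals that overlap in the opposite order would share a point by convexity, hence be one
  -- block.
  block-order : ∀ {i j i′ j′} → ¬ (i ∼ j) → i < j → i ∼ i′ → j ∼ j′ → i′ < j′
  block-order {i} {j} {i′} {j′} h i<j ii′ jj′ with <-cmp i′ j′
  ... | tri< lt _ _ = lt
  ... | tri≈ _ refl _ = ⊥-elim (h (∼-trans ii′ (∼-sym jj′)))
  ... | tri> _ _ gt with <-cmp j i′
  ...   | tri< lt _ _ = ⊥-elim (h (convex i<j lt ii′))
  ...   | tri≈ _ refl _ = ⊥-elim (h ii′)
  ...   | tri> _ _ i′<j = ⊥-elim (h (∼-trans ii′ (∼-trans (∼-sym (convex gt i′<j (∼-sym jj′))) (∼-sym jj′))))

  record Preserves (w : Word n) : Set where
    constructor mkPreserves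
    field stays : ∀ i → i ∼ (w ! i)

  open Preserves public

  preserves-∙ : ∀ {u v} → Preserves u → Preserves v → Preserves (u ∙ v)
  preserves-∙ {u} {v} pu pv = mkPreserves λ i →
    subst (i ∼_) (sym (∙-! u v i)) (∼-trans (stays pv i) (stays pu (v ! i)))

  preserves-e : Preserves e
  preserves-e = mkPreserves λ i → subst (i ∼_) (sym (e-! i)) ∼-refl

  preserves-inv : ∀ {u} → Perm u → Preserves u → Preserves (inv u)
  preserves-inv {u} pu h = mkPreserves λ i →
    subst (_∼ (inv u ! i)) (!-inv pu i) (∼-sym (stays h (inv u ! i)))

  preserves-tr : ∀ {i j} → i ∼ j → Preserves (tr i j)
  preserves-tr {i} {j} h = mkPreserves (tr-cases {P = _∼_} i j h (∼-sym h) λ _ _ _ → ∼-refl)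

  preserves-order : ∀ {w i j} → Preserves w → ¬ (i ∼ j) → i < j → w ! i < w ! j
  preserves-order h ¬p i<j = block-order ¬p i<j (stays h _) (stays h _)

  inversion-∼ : ∀ {w i j} → Preserves w → i < j → w ! j < w ! i → i ∼ j
  inversion-∼ {w} {i} {j} h i<j lt with i ∼? j
  ... | yes p = p
  ... | no ¬p = ⊥-elim (<-asym lt (preserves-order h ¬p i<j))

  preserves-below : ∀ {u v} → Perm v → Preserves v → u ≤B v → Preserves u
  preserves-below = down-closed Preserves λ i j pv h i<j lt →
    preserves-∙ h (preserves-tr (inversion-∼ h i<j lt))

  -- The longest element of the parabolic subgroup, described by its shape instead of its length.
  record Reversal (a : Word n) : Set where
    constructor mkReversal
    field
      perm      : Perm a
      preserves : Preserves a
      reverses  : ∀ {i j} → i < j → i ∼ j → a ! j < a ! i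

    -- Two reversals restore the order inside each block, and the order between blocks never
    -- changes, so the square is increasing.
    involutive : a ∙ a ≡ e
    involutive = increasing⇒e (perm-∙ perm perm) λ i j i<j →
      subst₂ _<_ (sym (∙-! a a i)) (sym (∙-! a a j)) (case i ∼? j of λ where
        (yes p) → reverses (reverses i<j p) (∼-trans (∼-sym (stays preserves j)) (∼-trans (∼-sym p) (stays preserves i)))
        (no ¬p) → block-order ¬p i<j (∼-trans (stays preserves i) (stays preserves _)) (∼-trans (stays preserves j) (stays preserves _)))

    !-! : ∀ i → a ! (a ! i) ≡ i
    !-! i = trans (sym (∙-! a a i)) (trans (cong (_! i) involutive) (e-! i))

_∧B_ : ∀ {n} → Blocks n → Blocks n → Blocks n
R ∧B R′ = record
  { _∼_     = λ i j → i ∼ j × i ∼′ j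
  ; _∼?_    = λ i j → (i ∼? j) ×-dec (i ∼′? j)
  ; ∼-refl  = ∼-refl , ∼′-refl
  ; ∼-sym   = λ (p , q) → ∼-sym p , ∼′-sym q
  ; ∼-trans = λ (p , q) (p′ , q′) → ∼-trans p p′ , ∼′-trans q q′
  ; convex  = λ l l′ (p , q) → convex l l′ p , convex′ l l′ q
  }
  where
  open Blocks R
  open Blocks R′ using () renaming
    (_∼_ to _∼′_; _∼?_ to _∼′?_; ∼-refl to ∼′-refl; ∼-sym to ∼′-sym; ∼-trans to ∼′-trans; convex to convex′)

-- Dualities on products of parabolic subgroups

search : ∀ {n m} {P : Vec (Fin n) m → Set} → (∀ v → Dec (P v)) → Dec (∃ P)
search {m = zero}  P? = map′ (λ p → [] , p) (λ { ([] , p) → p }) (P? [])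
search {m = suc m} P? = map′ (λ (x , v , p) → x ∷ v , p) (λ { (x ∷ v , p) → x , v , p })
  (any? λ x → search λ v → P? (x ∷ v))

perm? : ∀ {n} (w : Word n) → Dec (Perm w)
perm? w = map′ mkPerm injective (all? λ i → all? λ j → (w ! i ≟ w ! j) →-dec (i ≟ j))

-- An involution is asked for, since injectivity, surjectivity and reflection of the order then
-- follow from antitonicity alone.
record Duality {n} (w : Word n) : Set where
  field
    φ            : Word n → Word n
    φ-≤          : ∀ {x} → x ≤B w → φ x ≤B w
    φ-involutive : ∀ {x} → x ≤B w → φ (φ x) ≡ x
    φ-antitone   : ∀ {x y} → x ≤B y → y ≤B w → φ y ≤B φ x

  selfDual : SelfDualInterval w
  selfDual = φ , (λ _ → φ-≤)
    , (λ x y p q r → trans (sym (φ-involutive p)) (trans (cong φ r) (φ-involutive q)))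
    , (λ y p → φ y , φ-≤ p , φ-involutive p)
    , λ x y p q → (λ r → φ-antitone r q)
                , λ r → subst₂ _≤B_ (φ-involutive p) (φ-involutive q) (φ-antitone r (φ-≤ p))

-- W_R W_R′ is the set of products y ∙ z with y preserving R and z preserving R′.
module Factorization {n} (R R′ : Blocks n) where
  open Blocks R
  open Blocks R′ using () renaming
    (_∼_ to _∼′_; _∼?_ to _∼′?_; ∼-refl to ∼′-refl; ∼-sym to ∼′-sym; ∼-trans to ∼′-trans;
     Preserves to Preserves′; preserves-order to preserves′-order; block-order to block-order′;
     preserves-∙ to preserves′-∙; preserves-tr to preserves′-tr; preserves-inv to preserves′-inv)

  record Factors (x y z : Word n) : Set where
    constructor mkFactors
    field
      permˡ      : Perm y
      preservesˡ : Preserves y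
      permʳ      : Perm z
      preservesʳ : Preserves′ z
      product    : x ≡ y ∙ z

  factors? : ∀ x y z → Dec (Factors x y z)
  factors? x y z = map′ (λ (a , b , c , d , p) → mkFactors a (mkPreserves b) c (Blocks.mkPreserves d) p)
    (λ (mkFactors a b c d p) → a , stays b , c , Blocks.stays d , p)
    (perm? y ×-dec (all? λ i → i ∼? (y ! i)) ×-dec perm? z ×-dec (all? λ i → i ∼′? (z ! i))
      ×-dec Vecₚ.≡-dec _≟_ x (y ∙ z))

  -- Decidability by exhaustive search lets the duality be a function of the word itself instead of
  -- a chosen pair of factors.
  factorize : ∀ x → Dec (∃₂ (Factors x))
  factorize x = search λ y → search λ z → factors? x y z

  -- From `y ∙ z ≡ y′ ∙ z′` the element `z′ ∙ inv z` equals `inv y′ ∙ y`, so it lies in both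
  -- subgroups; this is the whole ambiguity of a factorization.
  factors-differ : ∀ {x y z y′ z′} → Factors x y z → Factors x y′ z′ →
    let k = z′ ∙ inv z in Perm k × Preserves k × Preserves′ k × y ≡ y′ ∙ k × z′ ≡ k ∙ z
  factors-differ {y = y} {z} {y′} {z′} (mkFactors py h pz g refl) (mkFactors py′ h′ pz′ g′ q) =
    perm-∙ pz′ (perm-inv pz) , k-pres , preserves′-∙ g′ (preserves′-inv pz g) , y≡ , z′≡
    where
    k = z′ ∙ inv z
    z′≡ : z′ ≡ k ∙ z
    z′≡ = sym (trans (∙-assoc z′ (inv z) z) (trans (cong (z′ ∙_) (inverseˡ pz)) (∙-identityʳ z′)))
    y≡ : y ≡ y′ ∙ k
    y≡ = begin
      y                    ≡⟨ sym (∙-identityʳ y) ⟩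
      y ∙ e                ≡⟨ cong (y ∙_) (sym (inverseʳ pz)) ⟩
      y ∙ (z ∙ inv z)      ≡⟨ sym (∙-assoc y z (inv z)) ⟩
      (y ∙ z) ∙ inv z      ≡⟨ cong (_∙ inv z) q ⟩
      (y′ ∙ z′) ∙ inv z    ≡⟨ ∙-assoc y′ z′ (inv z) ⟩
      y′ ∙ k               ∎
      where open ≡-Reasoning
    k-pres : Preserves k
    k-pres = mkPreserves λ i → ∼-trans (stays h i) (subst (_∼ (k ! i)) (sym (trans (cong (_! i) y≡) (∙-! y′ k i)))
      (∼-sym (stays h′ (k ! i))))

  -- An inversion i < j of y ∙ z is an inversion of z inside an R′-block, or
  -- is carried by z to an inversion of y inside an R-block.
  data Lowering (y z : Word n) (i j : Fin n) : Set where
    right : i ∼′ j → y ! (z ! j) < y ! (z ! i) → Lowering y z i j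
    left  : ¬ (i ∼′ j) → (z ! i) ∼ (z ! j) → z ! i < z ! j → y ! (z ! j) < y ! (z ! i) → Lowering y z i j

  lowering : ∀ {x y z i j} → Factors x y z → i < j → x ! j < x ! i → Lowering y z i j
  lowering {y = y} {z} {i} {j} (mkFactors py h pz g refl) i<j lt with i ∼′? j
  ... | yes p = right p (subst₂ _<_ (∙-! y z j) (∙-! y z i) lt)
  ... | no ¬p = left ¬p (inversion-∼ h zi<zj lt′) zi<zj lt′
    where
    zi<zj = preserves′-order g ¬p i<j
    lt′ = subst₂ _<_ (∙-! y z j) (∙-! y z i) lt

  right-factors : ∀ {x y z i j} → Factors x y z → i ∼′ j → Factors (x ∙ tr i j) y (z ∙ tr i j)
  right-factors {y = y} {z} {i} {j} (mkFactors py h pz g refl) p =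
    mkFactors py h (perm-∙ pz (perm-tr i j)) (preserves′-∙ g (preserves′-tr p)) (∙-assoc y z (tr i j))

  left-factors : ∀ {x y z i j} → Factors x y z → (z ! i) ∼ (z ! j) →
    Factors (x ∙ tr i j) (y ∙ tr (z ! i) (z ! j)) z
  left-factors {y = y} {z} {i} {j} (mkFactors py h pz g refl) p =
    mkFactors (perm-∙ py (perm-tr _ _)) (preserves-∙ h (preserves-tr p)) pz g
      (trans (∙-assoc y z (tr i j)) (trans (cong (y ∙_) (∙-tr pz i j)) (sym (∙-assoc y _ z))))

  lower-factors : ∀ {x y z i j} → Factors x y z → Lowering y z i j → ∃₂ (Factors (x ∙ tr i j))
  lower-factors f (right p _)    = _ , _ , right-factors f p
  lower-factors f (left _ p _ _) = _ , _ , left-factors f p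

  factors-below : ∀ {x w} → Perm w → ∃₂ (Factors w) → x ≤B w → ∃₂ (Factors x)
  factors-below = down-closed (λ x → ∃₂ (Factors x)) λ i j _ (_ , _ , f) i<j lt →
    lower-factors f (lowering f i<j lt)

-- The intersections of an R-block with an R′-block have at most two elements, so the
-- reversal b of these intersections commutes with W_R ∩ W_R′; hence y ∙ z ↦ a ∙ y ∙ b ∙ z ∙ c
-- is well defined on W_R W_R′.
module TwoReversals {n} (R R′ : Blocks n)
  (thin : ∀ {i j k : Fin n} → i < j → j < k → Blocks._∼_ (R ∧B R′) i k → ⊥)
  {a b c : Word n} (rev-a : Blocks.Reversal R a) (rev-b : Blocks.Reversal (R ∧B R′) b)
  (rev-c : Blocks.Reversal R′ c) where

  open Factorization R R′
  open Blocks R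
  open Blocks R′ using () renaming
    (_∼_ to _∼′_; ∼-refl to ∼′-refl; ∼-sym to ∼′-sym; ∼-trans to ∼′-trans; preserves-e to preserves′-e;
     Preserves to Preserves′; stays to stays′; preserves-∙ to preserves′-∙; block-order to block-order′)
  open Blocks (R ∧B R′) using () renaming (_∼_ to _≈_; ∼-sym to ≈-sym; ∼-trans to ≈-trans; ∼-refl to ≈-refl)

  private
    module A = Reversal rev-a
    module B = Blocks.Reversal rev-b
    module C = Blocks.Reversal rev-c

    B-stays : ∀ i → i ≈ (b ! i)
    B-stays = Blocks.stays B.preserves
    B-preserves : Preserves b
    B-preserves = mkPreserves (proj₁ ∘ B-stays)
    B-preserves′ : Preserves′ b
    B-preserves′ = Blocks.mkPreserves (proj₂ ∘ B-stays)

  pair : ∀ {p q x} → p < q → p ≈ q → p ≈ x → x ≡ p ⊎ x ≡ q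
  pair {p} {q} {x} p<q p≈q p≈x with <-cmp x p | <-cmp x q
  ... | tri≈ _ r _ | _          = inj₁ r
  ... | _          | tri≈ _ r _ = inj₂ r
  ... | tri< lt _ _ | _         = ⊥-elim (thin lt p<q (≈-trans (≈-sym p≈x) p≈q))
  ... | tri> _ _ gt | tri< lt _ _ = ⊥-elim (thin gt lt p≈q)
  ... | tri> _ _ _ | tri> _ _ gt = ⊥-elim (thin p<q gt p≈x)

  pair≢ : ∀ {p q x} → p ≢ q → p ≈ q → p ≈ x → x ≡ p ⊎ x ≡ q
  pair≢ {p} {q} p≢q p≈q p≈x with <-cmp p q
  ... | tri< lt _ _ = pair lt p≈q p≈x
  ... | tri≈ _ r _  = ⊥-elim (p≢q r)
  ... | tri> _ _ gt with pair gt (≈-sym p≈q) (≈-trans (≈-sym p≈q) p≈x)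
  ...   | inj₁ r = inj₂ r
  ...   | inj₂ r = inj₁ r

  b-swaps< : ∀ {p q} → p < q → p ≈ q → b ! p ≡ q
  b-swaps< {p} {q} p<q p≈q with pair p<q p≈q (B-stays p)
  ... | inj₂ r = r
  ... | inj₁ r with pair p<q p≈q (≈-trans p≈q (B-stays q))
  ...   | inj₁ r′ = ⊥-elim (<⇒≢ p<q (injective B.perm p q (trans r (sym r′))))
  ...   | inj₂ r′ = ⊥-elim (<-asym p<q (subst₂ _<_ r′ r (B.reverses p<q p≈q)))

  b-swaps : ∀ {p q} → p ≢ q → p ≈ q → b ! p ≡ q
  b-swaps {p} {q} p≢q p≈q with <-cmp p q
  ... | tri< lt _ _ = b-swaps< lt p≈q
  ... | tri≈ _ r _  = ⊥-elim (p≢q r)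
  ... | tri> _ _ gt = trans (cong (b !_) (sym (b-swaps< gt (≈-sym p≈q)))) (B.!-! q)

  -- A class of the intersection has at most two elements, and permutations of such a class commute.
  b-commutes : ∀ {k} → Perm k → Preserves k → Preserves′ k → k ∙ b ≡ b ∙ k
  b-commutes {k} pk h h′ = word-ext λ m → trans (∙-! k b m) (trans (at m) (sym (∙-! b k m)))
    where
    k≈ : ∀ m → m ≈ (k ! m)
    k≈ m = stays h m , stays′ h′ m
    at : ∀ m → k ! (b ! m) ≡ b ! (k ! m)
    at m with b ! m ≟ m
    ... | yes bm≡m with k ! m ≟ m
    ...   | yes km≡m = trans (cong (k !_) bm≡m) (trans km≡m (sym (trans (cong (b !_) km≡m) bm≡m)))
    ...   | no  km≢m = ⊥-elim (km≢m (trans (sym (b-swaps (km≢m ∘ sym) (k≈ m))) bm≡m))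
    at m | no bm≢m with pair≢ (bm≢m ∘ sym) (B-stays m) (k≈ m)
                      | pair≢ (bm≢m ∘ sym) (B-stays m) (≈-trans (B-stays m) (k≈ (b ! m)))
    ...   | inj₁ p | inj₂ q = trans q (sym (cong (b !_) p))
    ...   | inj₂ p | inj₁ q = trans q (sym (trans (cong (b !_) p) (B.!-! m)))
    ...   | inj₁ p | inj₁ q = ⊥-elim (bm≢m (injective pk _ _ (trans q (sym p))))
    ...   | inj₂ p | inj₂ q = ⊥-elim (bm≢m (injective pk _ _ (trans q (sym p))))

  Φ : Word n → Word n → Word n
  Φ y z = (a ∙ y) ∙ (b ∙ (z ∙ c))

  Φ-! : ∀ y z i → Φ y z ! i ≡ a ! (y ! (b ! (z ! (c ! i))))
  Φ-! y z i = trans (∙-! (a ∙ y) (b ∙ (z ∙ c)) i) (trans (∙-! a y _)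
    (cong (λ t → a ! (y ! t)) (trans (∙-! b (z ∙ c) i) (cong (b !_) (∙-! z c i)))))

  φ : Word n → Word n
  φ x with factorize x
  ... | yes (y , z , _) = Φ y z
  ... | no _            = x

  -- Independence of the factorization: the ambiguity `k` is split off the second factor, passes
  -- through `b`, and is absorbed by the first factor.
  φ-Φ : ∀ {x y z} → Factors x y z → φ x ≡ Φ y z
  φ-Φ {x} {y} {z} f with factorize x
  ... | no none = ⊥-elim (none (y , z , f))
  ... | yes (y′ , z′ , f′) with factors-differ f f′
  ...   | pk , h , h′ , y≡ , z′≡ = begin
    (a ∙ y′) ∙ (b ∙ (z′ ∙ c))       ≡⟨ cong (λ t → (a ∙ y′) ∙ (b ∙ (t ∙ c))) z′≡ ⟩
    (a ∙ y′) ∙ (b ∙ ((k ∙ z) ∙ c))  ≡⟨ cong (λ t → (a ∙ y′) ∙ (b ∙ t)) (∙-assoc k z c) ⟩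
    (a ∙ y′) ∙ (b ∙ (k ∙ (z ∙ c)))  ≡⟨ cong ((a ∙ y′) ∙_) (sym (∙-assoc b k (z ∙ c))) ⟩
    (a ∙ y′) ∙ ((b ∙ k) ∙ (z ∙ c))  ≡⟨ cong (λ t → (a ∙ y′) ∙ (t ∙ (z ∙ c))) (sym (b-commutes pk h h′)) ⟩
    (a ∙ y′) ∙ ((k ∙ b) ∙ (z ∙ c))  ≡⟨ cong ((a ∙ y′) ∙_) (∙-assoc k b (z ∙ c)) ⟩
    (a ∙ y′) ∙ (k ∙ (b ∙ (z ∙ c)))  ≡⟨ sym (∙-assoc (a ∙ y′) k (b ∙ (z ∙ c))) ⟩
    ((a ∙ y′) ∙ k) ∙ (b ∙ (z ∙ c))  ≡⟨ cong (_∙ (b ∙ (z ∙ c))) (∙-assoc a y′ k) ⟩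
    (a ∙ (y′ ∙ k)) ∙ (b ∙ (z ∙ c))  ≡⟨ cong (λ t → (a ∙ t) ∙ (b ∙ (z ∙ c))) (sym y≡) ⟩
    Φ y z                           ∎
    where
    open ≡-Reasoning
    k = z′ ∙ inv z

  Φ-factors : ∀ {x y z} → Factors x y z → Factors (Φ y z) ((a ∙ y) ∙ b) (z ∙ c)
  Φ-factors {y = y} {z} (mkFactors py h pz g refl) = mkFactors
    (perm-∙ (perm-∙ A.perm py) B.perm)
    (preserves-∙ (preserves-∙ A.preserves h) B-preserves)
    (perm-∙ pz C.perm) (preserves′-∙ g C.preserves) (sym (∙-assoc (a ∙ y) b (z ∙ c)))

  Φ-involutive : ∀ y z → Φ ((a ∙ y) ∙ b) (z ∙ c) ≡ y ∙ z
  Φ-involutive y z = word-ext λ i → begin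
    Φ ((a ∙ y) ∙ b) (z ∙ c) ! i
      ≡⟨ Φ-! ((a ∙ y) ∙ b) (z ∙ c) i ⟩
    a ! (((a ∙ y) ∙ b) ! (b ! ((z ∙ c) ! (c ! i))))
      ≡⟨ cong (λ t → a ! (((a ∙ y) ∙ b) ! (b ! t))) (trans (∙-! z c _) (cong (z !_) (C.!-! i))) ⟩
    a ! (((a ∙ y) ∙ b) ! (b ! (z ! i)))
      ≡⟨ cong (a !_) (trans (∙-! (a ∙ y) b _) (trans (cong ((a ∙ y) !_) (B.!-! _)) (∙-! a y _))) ⟩
    a ! (a ! (y ! (z ! i)))
      ≡⟨ A.!-! _ ⟩
    y ! (z ! i)
      ≡⟨ sym (∙-! y z i) ⟩
    (y ∙ z) ! i ∎
    where open ≡-Reasoning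

  -- In a common `R`-block the swap by `b` and the reversal by `a` cancel in their effect on the
  -- order. In different `R`-blocks `q < p` already, as `y` preserves `R`, and none of `b`, `y`, `a`
  -- changes the order of elements of different blocks.
  Φ-reverses : ∀ {y p q} → Perm y → Preserves y → p ∼′ q → y ! q < y ! p → a ! (y ! (b ! q)) < a ! (y ! (b ! p))
  Φ-reverses {y} {p} {q} py h p∼′q lt with p ∼? q
  ... | yes p∼q = subst₂ (λ s t → a ! (y ! s) < a ! (y ! t))
          (sym (b-swaps (p≢q ∘ sym) (∼-sym p∼q , ∼′-sym p∼′q))) (sym (b-swaps p≢q (p∼q , p∼′q)))
          (A.reverses lt (∼-trans (∼-sym (stays h q)) (∼-trans (∼-sym p∼q) (stays h p))))
    where
    p≢q : p ≢ q
    p≢q r = <-irrefl (cong (toℕ ∘ (y !_)) (sym r)) lt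
  ... | no ¬p∼q with <-cmp p q
  ...   | tri< p<q _ _ = ⊥-elim (<-asym lt (block-order ¬p∼q p<q (stays h p) (stays h q)))
  ...   | tri≈ _ r _   = ⊥-elim (<-irrefl (cong (toℕ ∘ (y !_)) (sym r)) lt)
  ...   | tri> _ _ q<p = block-order (¬p∼q ∘ ∼-sym) q<p (moved q) (moved p)
    where
    moved : ∀ m → m ∼ (a ! (y ! (b ! m)))
    moved m = ∼-trans (proj₁ (B-stays m)) (∼-trans (stays h _) (stays A.preserves _))

  -- An inversion inside an `R′`-block has its positions turned around by `c`. One inside an
  -- `R`-block has its values turned around by `a`, while its positions keep their order because `i`
  -- and `j` lie in different `R′`-blocks.
  Φ-antitone : ∀ {x y z i j} → Factors x y z → i < j → Lowering y z i j →
    BruhatStep (φ x) (φ (x ∙ tr i j))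
  Φ-antitone {x} {y} {z} {i} {j} f@(mkFactors py h pz g refl) i<j (right i∼′j lt) =
    subst₂ BruhatStep (sym (φ-Φ f)) (trans Φ≡ (sym (φ-Φ (right-factors f i∼′j))))
      (step-up (Factors.permˡ ff `∙ Factors.permʳ ff) (C.reverses i<j i∼′j) order)
    where
    ff = Φ-factors f
    _`∙_ : Perm ((a ∙ y) ∙ b) → Perm (z ∙ c) → Perm (Φ y z)
    p `∙ q = subst Perm (∙-assoc (a ∙ y) b (z ∙ c)) (perm-∙ p q)
    at : ∀ m → Φ y z ! (c ! m) ≡ a ! (y ! (b ! (z ! m)))
    at m = trans (Φ-! y z (c ! m)) (cong (λ t → a ! (y ! (b ! (z ! t)))) (C.!-! m))
    order : Φ y z ! (c ! j) < Φ y z ! (c ! i)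
    order = subst₂ _<_ (sym (at j)) (sym (at i))
      (Φ-reverses py h (∼′-trans (∼′-sym (stays′ g i)) (∼′-trans i∼′j (stays′ g j))) lt)
    Φ≡ : Φ y z ∙ tr (c ! j) (c ! i) ≡ Φ y (z ∙ tr i j)
    Φ≡ = word-ext λ m → begin
      (Φ y z ∙ tr (c ! j) (c ! i)) ! m            ≡⟨ ∙-! (Φ y z) (tr (c ! j) (c ! i)) m ⟩
      Φ y z ! (tr (c ! j) (c ! i) ! m)            ≡⟨ Φ-! y z _ ⟩
      a ! (y ! (b ! (z ! (c ! (tr (c ! j) (c ! i) ! m)))))
        ≡⟨ cong (λ t → a ! (y ! (b ! (z ! t)))) (begin
            c ! (tr (c ! j) (c ! i) ! m)           ≡⟨ sym (∙-! c _ m) ⟩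
            (c ∙ tr (c ! j) (c ! i)) ! m           ≡⟨ cong (_! m) (∙-tr C.perm (c ! j) (c ! i)) ⟩
            (tr (c ! (c ! j)) (c ! (c ! i)) ∙ c) ! m
              ≡⟨ cong₂ (λ s t → (tr s t ∙ c) ! m) (C.!-! j) (C.!-! i) ⟩
            (tr j i ∙ c) ! m                       ≡⟨ cong (λ t → (t ∙ c) ! m) (tr-sym j i) ⟩
            (tr i j ∙ c) ! m                       ≡⟨ ∙-! (tr i j) c m ⟩
            tr i j ! (c ! m)                       ∎) ⟩
      a ! (y ! (b ! (z ! (tr i j ! (c ! m)))))     ≡⟨ cong (λ t → a ! (y ! (b ! t))) (sym (∙-! z (tr i j) (c ! m))) ⟩
      a ! (y ! (b ! ((z ∙ tr i j) ! (c ! m))))     ≡⟨ sym (Φ-! y (z ∙ tr i j) m) ⟩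
      Φ y (z ∙ tr i j) ! m                         ∎
      where open ≡-Reasoning
  Φ-antitone {x} {y} {z} {i} {j} f@(mkFactors py h pz g refl) i<j (left ¬i∼′j p∼q p<q lt) =
    subst₂ BruhatStep (sym (φ-Φ f)) (trans Φ≡ (sym (φ-Φ (left-factors f p∼q))))
      (step-up (perm-∙ (perm-∙ A.perm py) pd) P<Q order)
    where
    p = z ! i
    q = z ! j
    d = b ∙ (z ∙ c)
    pd : Perm d
    pd = perm-∙ B.perm (perm-∙ pz C.perm)
    d∼′ : Preserves′ d
    d∼′ = preserves′-∙ B-preserves′ (preserves′-∙ g C.preserves)
    P = inv d ! p
    Q = inv d ! q
    back : ∀ m → m ∼′ (inv d ! (z ! m))
    back m = ∼′-trans (stays′ g m) (stays′ (Blocks.preserves-inv R′ pd d∼′) (z ! m))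
    P<Q : P < Q
    P<Q = block-order′ ¬i∼′j i<j (back i) (back j)
    at : ∀ m → Φ y z ! (inv d ! m) ≡ a ! (y ! m)
    at m = trans (∙-! (a ∙ y) d _) (trans (∙-! a y _) (cong (λ t → a ! (y ! t)) (!-inv pd m)))
    order : Φ y z ! P < Φ y z ! Q
    order = subst₂ _<_ (sym (at p)) (sym (at q))
      (A.reverses lt (∼-trans (∼-sym (stays h q)) (∼-trans (∼-sym p∼q) (stays h p))))
    Φ≡ : Φ y z ∙ tr P Q ≡ Φ (y ∙ tr p q) z
    Φ≡ = begin
      ((a ∙ y) ∙ d) ∙ tr P Q           ≡⟨ ∙-assoc (a ∙ y) d (tr P Q) ⟩
      (a ∙ y) ∙ (d ∙ tr P Q)           ≡⟨ cong ((a ∙ y) ∙_) (∙-tr pd P Q) ⟩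
      (a ∙ y) ∙ (tr (d ! P) (d ! Q) ∙ d) ≡⟨ cong₂ (λ s t → (a ∙ y) ∙ (tr s t ∙ d)) (!-inv pd p) (!-inv pd q) ⟩
      (a ∙ y) ∙ (tr p q ∙ d)           ≡⟨ sym (∙-assoc (a ∙ y) (tr p q) d) ⟩
      ((a ∙ y) ∙ tr p q) ∙ d           ≡⟨ cong (_∙ d) (∙-assoc a y (tr p q)) ⟩
      (a ∙ (y ∙ tr p q)) ∙ d           ∎
      where open ≡-Reasoning

  w : Word n
  w = (a ∙ b) ∙ c

  perm-w : Perm w
  perm-w = perm-∙ (perm-∙ A.perm B.perm) C.perm

  w-factors : ∃₂ (Factors w)
  w-factors = a ∙ b , c , mkFactors (perm-∙ A.perm B.perm)
    (preserves-∙ A.preserves B-preserves) C.perm C.preserves refl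

  φ-e : φ e ≡ w
  φ-e = trans (φ-Φ (mkFactors perm-e preserves-e perm-e preserves′-e (sym (∙-identityˡ e))))
    (trans (cong₂ (λ s t → s ∙ (b ∙ t)) (∙-identityʳ a) (∙-identityˡ c)) (sym (∙-assoc a b c)))

  antitone : ∀ {x y} → x ≤B y → y ≤B w → φ y ≤B φ x
  antitone ε q = ε
  antitone (_◅_ {i = u} {v} st ss) q
    with step-down⁻¹ {u = u} {v} (perm-≤ perm-w (ss ◅◅ q)) st | factors-below perm-w w-factors (ss ◅◅ q)
  ... | i , j , i<j , lt , refl | _ , _ , f =
    antitone ss q ◅◅ (Φ-antitone f i<j (lowering f i<j lt) ◅ ε)

  duality : Duality w
  duality = record
    { φ            = φ
    ; φ-≤          = λ p → subst (φ _ ≤B_) φ-e (antitone (e≤ (perm-≤ perm-w p)) p)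
    ; φ-involutive = λ p → let (y , z , f) = factors-below perm-w w-factors p in
        trans (cong φ (φ-Φ f)) (trans (φ-Φ (Φ-factors f)) (trans (Φ-involutive y z) (sym (Factors.product f))))
    ; φ-antitone   = antitone
    }

module DisjointProduct {n} (R R′ : Blocks n)
  (disjoint : ∀ {i j : Fin n} → Blocks._∼_ (R ∧B R′) i j → i ≡ j)
  {w₁ w₂ : Word n} (p₁ : Perm w₁) (h₁ : Blocks.Preserves R w₁) (D₁ : Duality w₁)
  (p₂ : Perm w₂) (h₂ : Blocks.Preserves R′ w₂) (D₂ : Duality w₂) where

  open Factorization R R′
  open Blocks R
  open Blocks R′ using () renaming
    (_∼_ to _∼′_; ∼-sym to ∼′-sym; ∼-trans to ∼′-trans; Preserves to Preserves′; stays to stays′;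
     preserves-inv to preserves′-inv; preserves-order to preserves′-order;
     inversion-∼ to inversion-∼′; preserves-below to preserves′-below)

  private
    module D₁ = Duality D₁
    module D₂ = Duality D₂

    apart : ∀ {x : Word n} {i j} → x ! j < x ! i → (x ! j) ∼ (x ! i) → ¬ ((x ! j) ∼′ (x ! i))
    apart lt p q = <-irrefl (cong toℕ (disjoint (p , q))) lt

  -- The two values of an inversion of `v` lie in one `R′`-block, hence in different `R`-blocks, and
  -- `g` does not change their order.
  ∙-monoʳ : ∀ {g x x′} → Perm g → Preserves g → Perm x′ → Preserves′ x′ → x ≤B x′ → (g ∙ x) ≤B (g ∙ x′)
  ∙-monoʳ pg h px′ h′ ε = ε
  ∙-monoʳ {g} {x} pg h px′ h′ (_◅_ {j = v} st ss) with step-down⁻¹ {u = x} {v} (perm-≤ px′ ss) st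
  ... | i , j , i<j , lt , refl = subst (λ t → BruhatStep t (g ∙ v)) (∙-assoc g v (tr i j))
          (step-down (perm-∙ pg pv) i<j
            (subst₂ _<_ (sym (∙-! g v j)) (sym (∙-! g v i)) (preserves-order h (λ p → apart {v} lt p rel) lt)))
        ◅ ∙-monoʳ pg h px′ h′ ss
    where
    pv = perm-≤ px′ ss
    hv = preserves′-below px′ h′ ss
    rel : (v ! j) ∼′ (v ! i)
    rel = ∼′-trans (∼′-sym (stays′ hv j)) (∼′-trans (∼′-sym (inversion-∼′ hv i<j lt)) (stays′ hv i))

  -- Here the positions move, by the inverse of `g`. Those of an inversion lie in one `R`-block,
  -- hence in different `R′`-blocks, and keep their order.
  ∙-monoˡ : ∀ {g x x′} → Perm g → Preserves′ g → Perm x′ → Preserves x′ → x ≤B x′ → (x ∙ g) ≤B (x′ ∙ g)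
  ∙-monoˡ pg h px′ h′ ε = ε
  ∙-monoˡ {g} {x} pg h px′ h′ (_◅_ {j = v} st ss) with step-down⁻¹ {u = x} {v} (perm-≤ px′ ss) st
  ... | i , j , i<j , lt , refl = subst (λ t → BruhatStep t (v ∙ g)) moved
          (step-down (perm-∙ pv pg) (preserves′-order (preserves′-inv pg h) not-rel i<j)
            (subst₂ _<_ (sym (at j)) (sym (at i)) lt))
        ◅ ∙-monoˡ pg h px′ h′ ss
    where
    pv = perm-≤ px′ ss
    hv = preserves-below px′ h′ ss
    not-rel : ¬ (i ∼′ j)
    not-rel q = <-irrefl (cong toℕ (disjoint (inversion-∼ hv i<j lt , q))) i<j
    at : ∀ m → (v ∙ g) ! (inv g ! m) ≡ v ! m
    at m = trans (∙-! v g _) (cong (v !_) (!-inv pg m))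
    moved : (v ∙ g) ∙ tr (inv g ! i) (inv g ! j) ≡ (v ∙ tr i j) ∙ g
    moved = begin
      (v ∙ g) ∙ tr (inv g ! i) (inv g ! j)             ≡⟨ ∙-assoc v g _ ⟩
      v ∙ (g ∙ tr (inv g ! i) (inv g ! j))             ≡⟨ cong (v ∙_) (∙-tr pg _ _) ⟩
      v ∙ (tr (g ! (inv g ! i)) (g ! (inv g ! j)) ∙ g) ≡⟨ cong₂ (λ s t → v ∙ (tr s t ∙ g)) (!-inv pg i) (!-inv pg j) ⟩
      v ∙ (tr i j ∙ g)                                 ≡⟨ sym (∙-assoc v (tr i j) g) ⟩
      (v ∙ tr i j) ∙ g                                 ∎
      where open ≡-Reasoning

  w : Word n
  w = w₁ ∙ w₂

  perm-w : Perm w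
  perm-w = perm-∙ p₁ p₂

  FactorsBelow : Word n → Set
  FactorsBelow x = ∃₂ λ y z → Factors x y z × y ≤B w₁ × z ≤B w₂

  factors-unique : ∀ {x y z y′ z′} → Factors x y z → Factors x y′ z′ → y ≡ y′ × z ≡ z′
  factors-unique {y = y} {z} {y′} {z′} f f′ with factors-differ f f′
  ... | pk , h , h′ , y≡ , z′≡ = trans y≡ (trans (cong (y′ ∙_) k≡e) (∙-identityʳ y′))
                               , sym (trans z′≡ (trans (cong (_∙ z) k≡e) (∙-identityˡ z)))
    where
    k≡e : z′ ∙ inv z ≡ e
    k≡e = word-ext λ i → trans (sym (disjoint (stays h i , stays′ h′ i))) (sym (e-! i))

  -- The inversion cannot come from `y`, because the values of `z` at `i` and `j` lie in one
  -- `R′`-block and so in different `R`-blocks.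
  lowerʳ : ∀ {y z i j} → Perm z → Preserves y → Preserves′ z → i < j → i ∼′ j → y ! (z ! j) < y ! (z ! i) →
    BruhatStep (z ∙ tr i j) z
  lowerʳ {y} {z} {i} {j} pz h h′ i<j i∼′j lt = step-down pz i<j (case <-cmp (z ! i) (z ! j) of λ where
    (tri< l _ _) → ⊥-elim (<-asym lt (preserves-order h (λ p → apart {z} {j} {i} l p zz) l))
    (tri≈ _ q _) → ⊥-elim (<-irrefl (cong (toℕ ∘ (y !_)) (sym q)) lt)
    (tri> _ _ l) → l)
    where
    zz : (z ! i) ∼′ (z ! j)
    zz = ∼′-trans (∼′-sym (stays′ h′ i)) (∼′-trans i∼′j (stays′ h′ j))

  below : ∀ {x} → x ≤B w → FactorsBelow x
  below = down-closed FactorsBelow lower perm-w (w₁ , w₂ , mkFactors p₁ h₁ p₂ h₂ refl , ε , ε)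
    where
    lower : ∀ {v} i j → Perm v → FactorsBelow v → i < j → v ! j < v ! i → FactorsBelow (v ∙ tr i j)
    lower i j _ (y , z , f@(mkFactors py h pz h′ _) , le , le′) i<j lt with lowering f i<j lt
    ... | right i∼′j lt′ = _ , _ , right-factors f i∼′j , le , lowerʳ pz h h′ i<j i∼′j lt′ ◅ le′
    ... | left _ p∼q p<q lt′ = _ , _ , left-factors f p∼q , step-down py p<q lt′ ◅ le , le′

  φ : Word n → Word n
  φ x with factorize x
  ... | yes (y , z , _) = D₁.φ y ∙ D₂.φ z
  ... | no _            = x

  φ-∙ : ∀ {x y z} → Factors x y z → φ x ≡ D₁.φ y ∙ D₂.φ z
  φ-∙ {x} {y} {z} f with factorize x
  ... | no none = ⊥-elim (none (y , z , f))
  ... | yes (y′ , z′ , f′) with factors-unique f f′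
  ...   | refl , refl = refl

  φ-factors : ∀ {y z} → y ≤B w₁ → z ≤B w₂ → Factors (D₁.φ y ∙ D₂.φ z) (D₁.φ y) (D₂.φ z)
  φ-factors p q = mkFactors (perm-≤ p₁ (D₁.φ-≤ p)) (preserves-below p₁ h₁ (D₁.φ-≤ p))
    (perm-≤ p₂ (D₂.φ-≤ q)) (preserves′-below p₂ h₂ (D₂.φ-≤ q)) refl

  φ-≤ : ∀ {x} → x ≤B w → φ x ≤B w
  φ-≤ {x} p with below p
  ... | y , z , f , le , le′ = subst (_≤B w) (sym (φ-∙ f))
    (∙-monoʳ (Factors.permˡ ff) (Factors.preservesˡ ff) p₂ h₂ (D₂.φ-≤ le′) ◅◅ ∙-monoˡ p₂ h₂ p₁ h₁ (D₁.φ-≤ le))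
    where ff = φ-factors le le′

  φ-involutive : ∀ {x} → x ≤B w → φ (φ x) ≡ x
  φ-involutive p with below p
  ... | y , z , f , le , le′ = trans (cong φ (φ-∙ f)) (trans (φ-∙ (φ-factors le le′))
    (trans (cong₂ _∙_ (D₁.φ-involutive le) (D₂.φ-involutive le′)) (sym (Factors.product f))))

  φ-antitone : ∀ {x y} → x ≤B y → y ≤B w → φ y ≤B φ x
  φ-antitone ε q = ε
  φ-antitone (_◅_ {i = u} {v} st ss) q
    with step-down⁻¹ {u = u} {v} (perm-≤ perm-w (ss ◅◅ q)) st | below (ss ◅◅ q)
  ... | i , j , i<j , lt , refl | y , z , f@(mkFactors py h pz h′ _) , le , le′ with lowering f i<j lt
  ...   | right i∼′j lt′ = φ-antitone ss q ◅◅ subst₂ _≤B_ (sym (φ-∙ f)) (sym (φ-∙ (right-factors f i∼′j)))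
            (∙-monoʳ (Factors.permˡ ff) (Factors.preservesˡ ff) (Factors.permʳ ff′) (Factors.preservesʳ ff′)
              (D₂.φ-antitone st′ le′))
    where
    st′ = lowerʳ pz h h′ i<j i∼′j lt′ ◅ ε
    ff = φ-factors le le′
    ff′ = φ-factors le (st′ ◅◅ le′)
  ...   | left _ p∼q p<q lt′ = φ-antitone ss q ◅◅ subst₂ _≤B_ (sym (φ-∙ f)) (sym (φ-∙ (left-factors f p∼q)))
            (∙-monoˡ (Factors.permʳ ff) (Factors.preservesʳ ff) (Factors.permˡ ff′) (Factors.preservesˡ ff′)
              (D₁.φ-antitone st′ le))
    where
    st′ = step-down py p<q lt′ ◅ ε
    ff = φ-factors le le′
    ff′ = φ-factors (st′ ◅◅ le) le′

  duality : Duality w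
  duality = record { φ = φ ; φ-≤ = φ-≤ ; φ-involutive = φ-involutive ; φ-antitone = φ-antitone }

-- Parabolic subgroups and polished elements in terms of blocks

consecutive : ∀ {m} {R : Fin (suc m) → Fin (suc m) → Set} → (∀ {i j k} → R i j → R j k → R i k) →
  ∀ {i j} → (∀ k → toℕ i ℕ.≤ toℕ k → toℕ k ℕ.< toℕ j → R (inject₁ k) (suc k)) → i < j → R i j
consecutive {m} {R} tran {i} {j} h i<j = go (toℕ j) j refl h i<j
  where
  go : ∀ d j → toℕ j ≡ d → (∀ k → toℕ i ℕ.≤ toℕ k → toℕ k ℕ.< toℕ j → R (inject₁ k) (suc k)) → i < j → R i j
  go (suc d) (suc j) q h (s≤s i≤j) with ℕₚ.m≤n⇒m<n∨m≡n i≤j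
  ... | inj₂ i≡j = subst (λ t → R t (suc j)) (toℕ-injective (trans (Finₚ.toℕ-inject₁ j) (sym i≡j)))
                     (h j i≤j ≤-refl)
  ... | inj₁ i<j = tran
          (go d (inject₁ j) (trans (Finₚ.toℕ-inject₁ j) (ℕₚ.suc-injective q))
            (λ k l l′ → h k l (ℕₚ.m<n⇒m<1+n (subst (toℕ k ℕ.<_) (Finₚ.toℕ-inject₁ j) l′)))
            (subst (toℕ i ℕ.<_) (sym (Finₚ.toℕ-inject₁ j)) i<j))
          (h j i≤j ≤-refl)

-- Generator k joins the positions k and k+1.
Between : ∀ {m} → Fin (suc m) → Fin m → Fin (suc m) → Set
Between i k j = (toℕ i ℕ.≤ toℕ k × toℕ k ℕ.< toℕ j) ⊎ (toℕ j ℕ.≤ toℕ k × toℕ k ℕ.< toℕ i)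

between-trans : ∀ {m} {i j : Fin (suc m)} {k} l → Between i k j → Between i k l ⊎ Between l k j
between-trans {k = k} l (inj₁ (p , q)) with toℕ l ℕₚ.≤? toℕ k
... | yes r = inj₂ (inj₁ (r , q))
... | no ¬r = inj₁ (inj₁ (p , ≰⇒> ¬r))
between-trans {k = k} l (inj₂ (p , q)) with toℕ l ℕₚ.≤? toℕ k
... | yes r = inj₁ (inj₂ (r , q))
... | no ¬r = inj₂ (inj₂ (p , ≰⇒> ¬r))

between-sym : ∀ {m} {i j : Fin (suc m)} {k} → Between i k j → Between j k i
between-sym (inj₁ p) = inj₂ p
between-sym (inj₂ p) = inj₁ p

¬between-self : ∀ {m} {i : Fin (suc m)} {k} → ¬ Between i k i
¬between-self (inj₁ (p , q)) = <⇒≱ q p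
¬between-self (inj₂ (p , q)) = <⇒≱ q p

-- The blocks are the orbits of the generators in `G` on the positions. A predicate is used instead
-- of a subset so that a union of supports can be taken directly.
generated : ∀ {m} (G : Fin m → Set) → (∀ k → Dec (G k)) → Blocks (suc m)
generated G G? = record
  { _∼_     = λ i j → ∀ k → Between i k j → G k
  ; _∼?_    = λ i j → all? λ k → between? i k j →-dec G? k
  ; ∼-refl  = λ k b → ⊥-elim (¬between-self b)
  ; ∼-sym   = λ h k b → h k (between-sym b)
  ; ∼-trans = λ {_} {j} h h′ k b → [ h k , h′ k ]′ (between-trans j b)
  ; convex  = λ i<j j<l h → λ { k (inj₁ (p , q)) → h k (inj₁ (p , <-trans q j<l))
                              ; k (inj₂ (p , q)) → ⊥-elim (<⇒≱ i<j (≤-trans p (<⇒≤ q))) }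
  }
  where
  between? : ∀ i k j → Dec (Between i k j)
  between? i k j = ((toℕ i ℕₚ.≤? toℕ k) ×-dec (toℕ k ℕₚ.<? toℕ j)) ⊎-dec ((toℕ j ℕₚ.≤? toℕ k) ×-dec (toℕ k ℕₚ.<? toℕ i))

between-adjacent : ∀ {m} (k : Fin m) → Between (inject₁ k) k (suc k)
between-adjacent k = inj₁ (≤-reflexive (Finₚ.toℕ-inject₁ k) , ≤-refl)

inject₁<suc : ∀ {m} (k : Fin m) → inject₁ k < suc k
inject₁<suc k = ≤-reflexive (cong suc (Finₚ.toℕ-inject₁ k))

between-adjacent⁻¹ : ∀ {m} (k l : Fin m) → Between (inject₁ k) l (suc k) → l ≡ k
between-adjacent⁻¹ k l (inj₁ (p , q)) =
  toℕ-injective (≤-antisym (≤-pred q) (subst (ℕ._≤ toℕ l) (Finₚ.toℕ-inject₁ k) p))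
between-adjacent⁻¹ k l (inj₂ (p , q)) =
  ⊥-elim (<⇒≱ p (<⇒≤ (subst (toℕ l ℕ.<_) (Finₚ.toℕ-inject₁ k) q)))

generatorAt : ∀ {m} {i j : Fin (suc m)} → i < j → Σ (Fin m) λ k → toℕ k ≡ toℕ i
generatorAt {i = i} {j} i<j = fromℕ< bound , Finₚ.toℕ-fromℕ< bound
  where bound = <-≤-trans i<j (≤-pred (Finₚ.toℕ<n j))

simple : ∀ {m} → Fin m → Word (suc m)
simple k = tr (inject₁ k) (suc k)

∙-simple≡ : ∀ {m} (u : Word (suc m)) k → u ∙ simple k ≡ u · s k
∙-simple≡ u k = ∙-tr≡ u (inject₁ k) (suc k)

descent? : ∀ {m} (w : Word (suc m)) → Dec (∃ λ k → w ! suc k < w ! inject₁ k)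
descent? w = any? λ k → w ! suc k <? w ! inject₁ k

ascent : ∀ {m} {w : Word (suc m)} → Perm w → ∀ k → ¬ (w ! suc k < w ! inject₁ k) → w ! inject₁ k < w ! suc k
ascent pw k h = ≤∧≢⇒< (≮⇒≥ h) λ q → <⇒≢ (inject₁<suc k) (injective pw _ _ q)

no-descent⇒e : ∀ {m} {w : Word (suc m)} → Perm w → ¬ (∃ λ k → w ! suc k < w ! inject₁ k) → w ≡ e
no-descent⇒e {w = w} pw h = increasing⇒e pw λ i j → consecutive {R = λ i j → w ! i < w ! j} <-trans
  λ k _ _ → ascent pw k λ lt → h (k , lt)

ℓ-descent : ∀ {m} {w : Word (suc m)} → Perm w → ∀ k → w ! suc k < w ! inject₁ k → ℓ w ≡ suc (ℓ (w ∙ simple k))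
ℓ-descent {w = w} pw k lt = trans (cong ℓ (sym (∙-tr-tr w _ _)))
  (ℓ-swap-≡ (perm-∙ pw (perm-tr _ _)) (inject₁<suc k)
    (subst₂ _<_ (sym (∙-tr-ˡ w _ _)) (sym (∙-tr-ʳ w _ _)) lt)
    λ { j (p , q , _) → <⇒≱ p (≤-trans (≤-pred q) (≤-reflexive (sym (Finₚ.toℕ-inject₁ k)))) })

module _ {m : ℕ} (J : Subset m) where

  blocks : Blocks (suc m)
  blocks = generated (_∈ J) (_∈? J)

  open Blocks blocks

  parabolic⇒preserves : ∀ {u} → InParabolic J u → Perm u × Preserves u
  parabolic⇒preserves unit = perm-e , preserves-e
  parabolic⇒preserves (step {u} j j∈J q) with parabolic⇒preserves q
  ... | pu , h = subst Perm (∙-simple≡ u j) (perm-∙ pu (perm-tr _ _))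
               , subst Preserves (∙-simple≡ u j) (preserves-∙ h (preserves-tr
                   λ k b → subst (_∈ J) (sym (between-adjacent⁻¹ j k b)) j∈J))

  -- Sorting by adjacent swaps: a descent is an inversion inside a block, so its generator lies in
  -- `J`, and removing it shortens the word.
  preserves⇒parabolic : ∀ {u} → Perm u → Preserves u → InParabolic J u
  preserves⇒parabolic {u} = go (ℓ u) ≤-refl
    where
    go : ∀ d {u} → ℓ u ℕ.≤ d → Perm u → Preserves u → InParabolic J u
    go d {u} le pu h with descent? u
    ... | no none = subst (InParabolic J) (sym (no-descent⇒e pu none)) unit
    go zero {u} le pu h | yes (k , lt) =
      ⊥-elim (ℕₚ.1+n≰n (≤-trans (subst (ℕ._≤ 0) (ℓ-descent pu k lt) le) z≤n))
    go (suc d) {u} le pu h | yes (k , lt) = subst (InParabolic J)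
      (trans (sym (∙-simple≡ (u ∙ simple k) k)) (∙-tr-tr u _ _))
      (step k k∈J (go d (≤-pred (subst (ℕ._≤ suc d) (ℓ-descent pu k lt) le))
        (perm-∙ pu (perm-tr _ _)) (preserves-∙ h (preserves-tr linked))))
      where
      linked = inversion-∼ h (inject₁<suc k) lt
      k∈J = linked k (between-adjacent k)

  -- A generator of `J` that is not a descent could be appended to get a longer element of the
  -- subgroup.
  longest⇒reversal : ∀ {a} → IsLongest J a → Reversal a
  longest⇒reversal {a} (q , longest) = mkReversal pa ha λ {i} {j} i<j linked →
    consecutive {R = λ i j → a ! j < a ! i} (λ p q → <-trans q p)
      (λ k p q → descends k (linked k (inj₁ (p , q)))) i<j
    where
    pa = proj₁ (parabolic⇒preserves q)
    ha = proj₂ (parabolic⇒preserves q)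
    descends : ∀ k → k ∈ J → a ! suc k < a ! inject₁ k
    descends k k∈J with a ! suc k <? a ! inject₁ k
    ... | yes lt = lt
    ... | no ¬lt = ⊥-elim (<⇒≱ (ℓ-swap-< pa (inject₁<suc k) (ascent pa k ¬lt))
            (subst (λ t → ℓ t ℕ.≤ ℓ a) (sym (∙-simple≡ a k)) (longest _ (step k k∈J q))))

  -- All inversions of an element of the subgroup lie inside blocks, where the reversal inverts
  -- every pair; so the sums compare term by term.
  reversal⇒longest : ∀ {a} → Reversal a → IsLongest J a
  reversal⇒longest {a} (mkReversal pa ha reverses) = preserves⇒parabolic pa ha , λ v q →
    subst₂ ℕ._≤_ (sym (ℓ-Sum v)) (sym (ℓ-Sum a))
      (Sum-mono λ i → Sum-mono λ j → at v (proj₂ (parabolic⇒preserves q)) i j (i <? j) (v ! j <? v ! i))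
    where
    at : ∀ v → Preserves v → ∀ i j → Dec (i < j) → Dec (v ! j < v ! i) → inversionAt v i j ℕ.≤ inversionAt a i j
    at v hv i j (no ¬p) _       = subst (ℕ._≤ inversionAt a i j) (sym (inversion-≡0 i j (v ! i) (v ! j) (inj₁ ¬p))) z≤n
    at v hv i j (yes _) (no ¬q) = subst (ℕ._≤ inversionAt a i j) (sym (inversion-≡0 i j (v ! i) (v ! j) (inj₂ ¬q))) z≤n
    at v hv i j (yes p) (yes q) = ≤-reflexive (trans (inversion-≡1 p q)
      (sym (inversion-≡1 p (reverses p (inversion-∼ hv p q)))))

Reversal-⇔ : ∀ {n} (R R′ : Blocks n) → (∀ {i j} → Blocks._∼_ R i j → Blocks._∼_ R′ i j) →
  (∀ {i j} → Blocks._∼_ R′ i j → Blocks._∼_ R i j) → ∀ {a} → Blocks.Reversal R a → Blocks.Reversal R′ a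
Reversal-⇔ R R′ f g rev = Blocks.mkReversal perm (Blocks.mkPreserves λ i → f (Blocks.stays preserves i))
  λ i<j p → reverses i<j (g p)
  where open Blocks.Reversal rev

blocks-∩ : ∀ {m} (J J′ : Subset m) {a} →
  Blocks.Reversal (blocks (J ∩ J′)) a → Blocks.Reversal (blocks J ∧B blocks J′) a
blocks-∩ J J′ = Reversal-⇔ (blocks (J ∩ J′)) (blocks J ∧B blocks J′)
  (λ h → (λ k b → proj₁ (Subsetₚ.x∈p∩q⁻ J J′ (h k b))) , λ k b → proj₂ (Subsetₚ.x∈p∩q⁻ J J′ (h k b)))
  (λ (h , h′) k b → Subsetₚ.x∈p∩q⁺ (h k b , h′ k b))

-- Three positions of one class, the first being `i`, are joined through the generators of index
-- `toℕ i` and `suc (toℕ i)`, which are adjacent.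
totallyDisconnected⇒thin : ∀ {m} (J J′ : Subset m) → TotallyDisconnected (J ∩ J′) →
  ∀ {i j k} → i < j → j < k → Blocks._∼_ (blocks J ∧B blocks J′) i k → ⊥
totallyDisconnected⇒thin J J′ td {i} {j} {k} i<j j<k (h , h′) = td g g′ (both g b) (both g′ b′) (inj₁ (trans (cong suc eq) (sym eq′)))
  where
  g = proj₁ (generatorAt i<j)
  eq = proj₂ (generatorAt i<j)
  bound : suc (toℕ i) ℕ.< _
  bound = ≤-<-trans i<j (<-≤-trans j<k (≤-pred (Finₚ.toℕ<n k)))
  g′ = fromℕ< bound
  eq′ : toℕ g′ ≡ suc (toℕ i)
  eq′ = Finₚ.toℕ-fromℕ< bound
  b : Between i g k
  b = inj₁ (≤-reflexive (sym eq) , subst (ℕ._< toℕ k) (sym eq) (<-trans i<j j<k))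
  b′ : Between i g′ k
  b′ = inj₁ (subst (toℕ i ℕ.≤_) (sym eq′) (ℕₚ.n≤1+n _) , subst (ℕ._< toℕ k) (sym eq′) (≤-<-trans i<j j<k))
  both : ∀ l → Between i l k → l ∈ J ∩ J′
  both l b = Subsetₚ.x∈p∩q⁺ (h l b , h′ l b)

duality-e : ∀ {n} → Duality (e {n})
duality-e {n} = record
  { φ            = id
  ; φ-≤          = id
  ; φ-involutive = λ _ → refl
  ; φ-antitone   = λ p q → subst₂ _≤B_ (sym (bottom q)) (sym (bottom (p ◅◅ q))) ε
  }
  where
  bottom : ∀ {x : Word n} → x ≤B e → x ≡ e
  bottom {x} p = ≤B∧ℓ≥⇒≡ p (subst (ℕ._≤ ℓ x) (sym (ℓ-e n)) z≤n)

-- The induction hypothesis over the factors. Besides the duality it records where the product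
-- lives, so that the next factor can be recognized as disjoint from it.
record Dualizable {m} (G : Fin m → Set) (G? : ∀ k → Dec (G k)) (w : Word (suc m)) : Set where
  field
    perm      : Perm w
    preserves : Blocks.Preserves (generated G G?) w
    duality   : Duality w

polished⇒dualizable : ∀ {m k} (S J J′ : Fin k → Subset m) (a b c : Fin k → Word (suc m)) →
  (∀ i j → i ≢ j → Disjoint (S i) (S j)) → (∀ i → S i ≡ J i ∪ J′ i) →
  (∀ i → TotallyDisconnected (J i ∩ J′ i)) →
  (∀ i → IsLongest (J i) (a i)) → (∀ i → IsLongest (J i ∩ J′ i) (b i)) → (∀ i → IsLongest (J′ i) (c i)) →
  Dualizable (λ g → ∃ λ i → g ∈ S i) (λ g → any? λ i → g ∈? S i) (prod (λ i → (a i · b i) · c i))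
polished⇒dualizable {k = zero} S J J′ a b c dis S≡ td la lb lc = record
  { perm = perm-e ; preserves = Blocks.preserves-e (generated _ _) ; duality = duality-e }
polished⇒dualizable {m} {suc k} S J J′ a b c dis S≡ td la lb lc = record
  { perm      = subst Perm prod≡ DP.perm-w
  ; preserves = subst (Blocks.Preserves Support) prod≡ (Blocks.preserves-∙ Support
      (Blocks.mkPreserves λ i g q → zero , Blocks.stays pres₁ i g q)
      (Blocks.mkPreserves λ i g q → let (l , p) = Blocks.stays (Dualizable.preserves rest) i g q in suc l , p))
  ; duality   = subst Duality prod≡ DP.duality
  }
  where
  Support = generated (λ g → ∃ λ i → g ∈ S i) (λ g → any? λ i → g ∈? S i)
  rest = polished⇒dualizable (S ∘ suc) (J ∘ suc) (J′ ∘ suc) (a ∘ suc) (b ∘ suc) (c ∘ suc)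
    (λ i j i≢j → dis (suc i) (suc j) (i≢j ∘ Finₚ.suc-injective)) (S≡ ∘ suc) (td ∘ suc) (la ∘ suc) (lb ∘ suc) (lc ∘ suc)
  rev-a = longest⇒reversal (J zero) (la zero)
  rev-b = longest⇒reversal (J zero ∩ J′ zero) (lb zero)
  rev-c = longest⇒reversal (J′ zero) (lc zero)
  module TR = TwoReversals (blocks (J zero)) (blocks (J′ zero)) (totallyDisconnected⇒thin (J zero) (J′ zero) (td zero))
    rev-a (blocks-∩ (J zero) (J′ zero) rev-b) rev-c
  J⊆S : ∀ {g} → g ∈ J zero → g ∈ S zero
  J⊆S p = subst (_ ∈_) (sym (S≡ zero)) (Subsetₚ.x∈p∪q⁺ (inj₁ p))
  J′⊆S : ∀ {g} → g ∈ J′ zero → g ∈ S zero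
  J′⊆S p = subst (_ ∈_) (sym (S≡ zero)) (Subsetₚ.x∈p∪q⁺ (inj₂ p))
  pres₁ : Blocks.Preserves (blocks (S zero)) TR.w
  pres₁ = Blocks.preserves-∙ (blocks (S zero)) (Blocks.preserves-∙ (blocks (S zero))
    (Blocks.mkPreserves λ i g q → J⊆S (Blocks.stays (Blocks.Reversal.preserves rev-a) i g q))
    (Blocks.mkPreserves λ i g q → J⊆S (proj₁ (Subsetₚ.x∈p∩q⁻ (J zero) (J′ zero) (Blocks.stays (Blocks.Reversal.preserves rev-b) i g q)))))
    (Blocks.mkPreserves λ i g q → J′⊆S (Blocks.stays (Blocks.Reversal.preserves rev-c) i g q))
  disjoint : ∀ {i j} → (∀ g → Between i g j → g ∈ S zero) × (∀ g → Between i g j → ∃ λ l → g ∈ S (suc l)) → i ≡ j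
  disjoint {i} {j} (h , h′) with <-cmp i j
  ... | tri≈ _ q _ = q
  ... | tri< lt _ _ = let (g , eq) = generatorAt lt
                          b = inj₁ (≤-reflexive (sym eq) , subst (ℕ._< toℕ j) (sym eq) lt)
                          (l , p) = h′ g b
                      in ⊥-elim (dis zero (suc l) (λ ()) g (h g b) p)
  ... | tri> _ _ gt = let (g , eq) = generatorAt gt
                          b = inj₂ (≤-reflexive (sym eq) , subst (ℕ._< toℕ i) (sym eq) gt)
                          (l , p) = h′ g b
                      in ⊥-elim (dis zero (suc l) (λ ()) g (h g b) p)
  module DP = DisjointProduct (blocks (S zero)) (generated (λ g → ∃ λ l → g ∈ S (suc l)) (λ g → any? λ l → g ∈? S (suc l)))
    disjoint TR.perm-w pres₁ TR.duality (Dualizable.perm rest) (Dualizable.preserves rest) (Dualizable.duality rest)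
  prod≡ : DP.w ≡ prod (λ i → (a i · b i) · c i)
  prod≡ = trans (∙≡· _ _) (cong (_· prod (λ i → (a (suc i) · b (suc i)) · c (suc i)))
    (trans (∙≡· _ _) (cong (_· c zero) (∙≡· _ _))))

polished⇒selfDual : ∀ {n} {w : Word n} → Polished w → SelfDualInterval w
polished⇒selfDual {zero} {[]} _ = Duality.selfDual duality-e
polished⇒selfDual {suc m} (k , S , J , J′ , dis , _ , S≡ , td , a , b , c , la , lb , lc , refl) =
  Duality.selfDual (Dualizable.duality (polished⇒dualizable S J J′ a b c dis S≡ td la lb lc))

-- Elements of length at most two

-- An abstract copy of ℓ, which is not unfolded during unification.
abstract
  len : ∀ {n} → Word n → ℕ
  len = ℓ

  len≡ℓ : ∀ {n} (w : Word n) → len w ≡ ℓ w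
  len≡ℓ w = refl

len-descent : ∀ {m} {w : Word (suc m)} → Perm w → ∀ k → w ! suc k < w ! inject₁ k → len w ≡ 1 + len (w ∙ simple k)
len-descent {w = w} pw k lt = trans (len≡ℓ w) (trans (ℓ-descent pw k lt) (cong (1 +_) (sym (len≡ℓ (w ∙ simple k)))))

len-e : ∀ n → len (e {n}) ≡ 0
len-e n = trans (len≡ℓ e) (ℓ-e n)

len-mono : ∀ {n} {u v : Word n} → u ≤B v → len u ℕ.≤ len v
len-mono {u = u} {v} le = subst₂ ℕ._≤_ (sym (len≡ℓ u)) (sym (len≡ℓ v)) (ℓ-mono le)

perm-simple : ∀ {m} (k : Fin m) → Perm (simple k)
perm-simple k = perm-tr (inject₁ k) (suc k)

simple-involutive : ∀ {m} (k : Fin m) (p : Fin (suc m)) → simple k ! (simple k ! p) ≡ p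
simple-involutive k p = tr-tr (inject₁ k) (suc k) p

∙-simple-simple : ∀ {m} (w : Word (suc m)) k → (w ∙ simple k) ∙ simple k ≡ w
∙-simple-simple w k = ∙-tr-tr w (inject₁ k) (suc k)

len-ascent : ∀ {m} {w : Word (suc m)} → Perm w → ∀ k → w ! inject₁ k < w ! suc k → len (w ∙ simple k) ≡ suc (len w)
len-ascent {w = w} pw k lt = trans
  (len-descent (perm-∙ pw (perm-simple k)) k
    (subst₂ _<_ (sym (∙-tr-ʳ w (inject₁ k) (suc k))) (sym (∙-tr-ˡ w (inject₁ k) (suc k))) lt))
  (cong (λ x → 1 + len x) (∙-simple-simple w k))

len≡0⇒e : ∀ {m} {u : Word (suc m)} → Perm u → len u ≡ 0 → u ≡ e
len≡0⇒e pu q = no-descent⇒e pu λ (k , lt) → ℕₚ.0≢1+n (trans (sym q) (len-descent pu k lt))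

opaque
  len-suc : ∀ {m} {u : Word (suc m)} {d} → Perm u → len u ≡ suc d → ∃ λ k → u ! suc k < u ! inject₁ k × len (u ∙ simple k) ≡ d
  len-suc {u = u} pu q with descent? u
  ... | yes (k , lt) = k , lt , ℕₚ.suc-injective (trans (sym (len-descent pu k lt)) q)
  ... | no none = ⊥-elim (ℕₚ.0≢1+n (trans (sym (trans (cong len (no-descent⇒e pu none)) (len-e (suc _)))) q))

opaque
  len≡1⇒simple : ∀ {m} {u : Word (suc m)} → Perm u → len u ≡ 1 → ∃ λ k → u ≡ simple k
  len≡1⇒simple {u = u} pu q with len-suc pu q
  ... | k , _ , q′ = k , trans (sym (∙-simple-simple u _))
          (trans (cong (_∙ simple k) (len≡0⇒e (perm-∙ pu (perm-simple _)) q′)) (∙-identityˡ (simple k)))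

opaque
  len-simple : ∀ {m} (k : Fin m) → len (simple k) ≡ 1
  len-simple {m} k = trans (cong len (sym (∙-identityˡ (simple k))))
    (trans (len-ascent perm-e k (subst₂ _<_ (sym (e-! (inject₁ k))) (sym (e-! (suc k))) (inject₁<suc k))) (cong suc (len-e (suc m))))

opaque
  len≡2⇒simple∙simple : ∀ {m} {u : Word (suc m)} → Perm u → len u ≡ 2 → ∃₂ λ a b → a ≢ b × u ≡ simple a ∙ simple b
  len≡2⇒simple∙simple {m} {u} pu q with len-suc pu q
  ... | b , _ , q′ with len≡1⇒simple (perm-∙ pu (perm-simple _)) q′
  ...   | a , r = a , b , a≢b , u≡
    where
    u≡ : u ≡ simple a ∙ simple b
    u≡ = trans (sym (∙-simple-simple u _)) (cong (_∙ simple b) r)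
    a≢b : a ≢ b
    a≢b refl = ℕₚ.0≢1+n (trans (sym (trans (cong len (trans u≡ (tr-involutive (inject₁ a) (suc a)))) (len-e (suc m)))) q)

opaque
  generated-∼⇒ : ∀ {m} (G : Fin m → Set) (G? : ∀ k → Dec (G k)) {u : Word (suc m)} →
    Blocks.Preserves (generated G G?) u → ∀ k → simple k ≡ u → G k
  generated-∼⇒ G G? h k refl = Blocks.inversion-∼ (generated G G?) h (inject₁<suc k)
    (subst₂ _<_ (sym (tr-ʳ (inject₁ k) (suc k))) (sym (tr-ˡ (inject₁ k) (suc k))) (inject₁<suc k)) k (between-adjacent k)

preserves-simple : ∀ {m} (G : Fin m → Set) (G? : ∀ k → Dec (G k)) {k} → G k → Blocks.Preserves (generated G G?) (simple k)
preserves-simple G G? {k} g = Blocks.preserves-tr (generated G G?)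
  λ l b → subst G (sym (between-adjacent⁻¹ k l b)) g

simple-injective : ∀ {m} {i j : Fin m} → simple i ≡ simple j → i ≡ j
simple-injective {j = j} q = generated-∼⇒ (_≡ j) (_≟ j) (preserves-simple (_≡ j) (_≟ j) refl) _ q

opaque
  -- Parabolic subgroups are lower ideals, so everything below the product lies in the one generated
  -- by `a` and `b`.
  simple-≤-∙ : ∀ {m} {i a b : Fin m} → simple i ≤B (simple a ∙ simple b) → i ≡ a ⊎ i ≡ b
  simple-≤-∙ {m} {i} {a} {b} le = generated-∼⇒ G G? (preserves-below (perm-∙ (perm-simple _) (perm-simple _))
    (preserves-∙ (preserves-simple G G? (inj₁ refl)) (preserves-simple G G? (inj₂ refl))) le) i refl
    where
    G : Fin m → Set
    G k = k ≡ a ⊎ k ≡ b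
    G? : ∀ k → Dec (G k)
    G? k = (k ≟ a) ⊎-dec (k ≟ b)
    open Blocks (generated G G?)

opaque
  simple-order : ∀ {m} (k : Fin m) {i j} → i < j → (simple k ! i < simple k ! j) ⊎ (i ≡ inject₁ k × j ≡ suc k)
  simple-order {m} k {i} {j} i<j with Blocks._∼?_ (generated (_≡ k) (_≟ k)) i j
  ... | no ¬p = inj₁ (Blocks.preserves-order (generated (_≡ k) (_≟ k)) (preserves-simple (_≡ k) (_≟ k) refl) ¬p i<j)
  ... | yes h = inj₂ (toℕ-injective (trans i≡k (sym (Finₚ.toℕ-inject₁ k))) , toℕ-injective (≤-antisym j≤ (subst (λ t → suc t ℕ.≤ toℕ j) i≡k i<j)))
    where
    g : Fin m
    g = proj₁ (generatorAt i<j)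
    eq : toℕ g ≡ toℕ i
    eq = proj₂ (generatorAt i<j)
    i≡k : toℕ i ≡ toℕ k
    i≡k = trans (sym eq) (cong toℕ (h g (inj₁ (≤-reflexive (sym eq) , subst (ℕ._< toℕ j) (sym eq) i<j))))
    j≤ : toℕ j ℕ.≤ suc (toℕ k)
    j≤ = ≮⇒≥ λ lt →
      let bound = <-≤-trans lt (≤-pred (Finₚ.toℕ<n j))
          eq′ = Finₚ.toℕ-fromℕ< bound
      in ℕₚ.1+n≢n (trans (sym eq′) (cong toℕ (h (fromℕ< bound) (inj₁
           ( subst (toℕ i ℕ.≤_) (sym eq′) (subst (ℕ._≤ suc (toℕ k)) (sym i≡k) (ℕₚ.n≤1+n _))
           , subst (ℕ._< toℕ j) (sym eq′) lt)))))

simple-ascent : ∀ {m} {i k : Fin m} → i ≢ k → simple i ! inject₁ k < simple i ! suc k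
simple-ascent {i = i} {k} i≢k with simple-order i (inject₁<suc k)
... | inj₁ lt = lt
... | inj₂ (_ , q) = ⊥-elim (i≢k (sym (Finₚ.suc-injective q)))

-- The lifting property of Bruhat order for right multiplication by one simple reflection.
module Lifting {m} (k : Fin m) where

  Desc Asc : Word (suc m) → Set
  Desc x = x ! suc k < x ! inject₁ k
  Asc  x = x ! inject₁ k < x ! suc k

  compare : ∀ {x} → Perm x → Asc x ⊎ Desc x
  compare {x} px with x ! suc k <? x ! inject₁ k
  ... | yes p = inj₂ p
  ... | no ¬p = inj₁ (ascent px k ¬p)

  up : ∀ {x} → Perm x → Asc x → BruhatStep x (x ∙ simple k)
  up px a = step-up px (inject₁<suc k) a

  down : ∀ {x} → Perm x → Desc x → BruhatStep (x ∙ simple k) x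
  down px d = step-down px (inject₁<suc k) d

  -- Conjugation by `simple k` keeps the order of the two swapped positions, unless they are the two
  -- positions that `k` itself exchanges.
  step-cases : ∀ {x y} → Perm y → BruhatStep x y →
    BruhatStep (x ∙ simple k) (y ∙ simple k) ⊎ (x ≡ y ∙ simple k × Desc y)
  step-cases {x} {y} py st with step-down⁻¹ {u = x} {y} py st
  ... | i , j , i<j , lt , refl with simple-order k i<j
  ...   | inj₂ (refl , refl) = inj₂ (refl , lt)
  ...   | inj₁ lt′ = inj₁ (subst (λ t → BruhatStep t (y ∙ simple k)) moved
            (step-down (perm-∙ py (perm-simple _)) lt′ (subst₂ _<_ (sym (at j)) (sym (at i)) lt)))
    where
    at : ∀ p → (y ∙ simple k) ! (simple k ! p) ≡ y ! p
    at p = trans (∙-! y (simple k) _) (cong (y !_) (simple-involutive k p))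
    moved : (y ∙ simple k) ∙ tr (simple k ! i) (simple k ! j) ≡ (y ∙ tr i j) ∙ simple k
    moved = begin
      (y ∙ simple k) ∙ tr (simple k ! i) (simple k ! j)  ≡⟨ ∙-assoc y (simple k) _ ⟩
      y ∙ (simple k ∙ tr (simple k ! i) (simple k ! j))  ≡⟨ cong (y ∙_) (∙-tr (perm-simple k) (simple k ! i) (simple k ! j)) ⟩
      y ∙ (tr (simple k ! (simple k ! i)) (simple k ! (simple k ! j)) ∙ simple k)
        ≡⟨ cong₂ (λ s t → y ∙ (tr s t ∙ simple k)) (simple-involutive k i) (simple-involutive k j) ⟩
      y ∙ (tr i j ∙ simple k)                            ≡⟨ sym (∙-assoc y (tr i j) (simple k)) ⟩
      (y ∙ tr i j) ∙ simple k                            ∎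
      where open ≡-Reasoning

  lift-up : ∀ {x y} → x ≤B y → Perm y → Desc y → (x ∙ simple k) ≤B y
  lift-up ε py d = down py d ◅ ε
  lift-up (_◅_ {i = x} {v} st ss) py d with step-cases {x} {v} pv st
    where pv = perm-≤ py ss
  ... | inj₁ st′ = st′ ◅ lift-up ss py d
  ... | inj₂ (refl , _) = subst (_≤B _) (sym (∙-simple-simple v k)) ss

  -- l is the smaller of x and x ∙ simple k; taking the smaller one is monotone.
  Lower : Word (suc m) → Word (suc m) → Set
  Lower x l = (Asc x × l ≡ x) ⊎ (Desc x × l ≡ x ∙ simple k)

  lower-step : ∀ {x y l l′} → Perm x → Perm y → BruhatStep x y → Lower x l → Lower y l′ → l ≤B l′
  lower-step {x} {y} px py st lx ly with step-cases {x} {y} py st | lx | ly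
  ... | inj₁ st′ | inj₁ (_ , refl) | inj₁ (_ , refl) = st ◅ ε
  ... | inj₁ st′ | inj₁ (a , refl) | inj₂ (_ , refl) = up px a ◅ st′ ◅ ε
  ... | inj₁ st′ | inj₂ (d , refl) | inj₁ (_ , refl) = down px d ◅ st ◅ ε
  ... | inj₁ st′ | inj₂ (_ , refl) | inj₂ (_ , refl) = st′ ◅ ε
  ... | inj₂ (refl , _) | inj₁ (_ , refl) | inj₂ (_ , refl) = ε
  ... | inj₂ (refl , d) | _ | inj₁ (a , _) = ⊥-elim (<-asym a d)
  ... | inj₂ (refl , d) | inj₂ (d′ , _) | _ =
    ⊥-elim (<-asym d (subst₂ _<_ (∙-tr-ʳ y (inject₁ k) (suc k)) (∙-tr-ˡ y (inject₁ k) (suc k)) d′))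

  lower-mono : ∀ {x y l l′} → Perm y → x ≤B y → Lower x l → Lower y l′ → l ≤B l′
  lower-mono py ε (inj₁ (_ , refl)) (inj₁ (_ , refl)) = ε
  lower-mono py ε (inj₂ (_ , refl)) (inj₂ (_ , refl)) = ε
  lower-mono py ε (inj₁ (a , _)) (inj₂ (d , _)) = ⊥-elim (<-asym a d)
  lower-mono py ε (inj₂ (d , _)) (inj₁ (a , _)) = ⊥-elim (<-asym a d)
  lower-mono py (_◅_ {i = x} {v} st ss) lx ly with perm-≤ py ss
  ... | pv with compare pv
  ...   | inj₁ a = lower-step (perm-below {v = v} pv st) pv st lx (inj₁ (a , refl)) ◅◅ lower-mono py ss (inj₁ (a , refl)) ly
  ...   | inj₂ d = lower-step (perm-below {v = v} pv st) pv st lx (inj₂ (d , refl)) ◅◅ lower-mono py ss (inj₂ (d , refl)) ly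

  lift-down : ∀ {x y} → x ≤B y → Perm y → Desc y → Asc x → x ≤B (y ∙ simple k)
  lift-down le py d a = lower-mono py le (inj₁ (a , refl)) (inj₂ (d , refl))

opaque
  -- Strip descents off `w`. If the descent is one of the two generators, lifting the other atom
  -- through it gives a product below `w`; if not, both atoms stay below the shorter element.
  simples-join : ∀ {m} {w : Word (suc m)} {i j} → Perm w → i ≢ j → simple i ≤B w → simple j ≤B w →
    ((simple i ∙ simple j) ≤B w) ⊎ ((simple j ∙ simple i) ≤B w)
  simples-join {m} {w} {i} {j} pw i≢j = go (len w) ≤-refl pw
    where
    go : ∀ d {w} → len w ℕ.≤ d → Perm w → simple i ≤B w → simple j ≤B w →
         ((simple i ∙ simple j) ≤B w) ⊎ ((simple j ∙ simple i) ≤B w)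
    go d {w} le pw p q with descent? w
    ... | no none = ⊥-elim (ℕₚ.1+n≰n (subst₂ ℕ._≤_ (len-simple i)
            (trans (cong len (no-descent⇒e pw none)) (len-e (suc m))) (len-mono p)))
    ... | yes (k , lt) with i ≟ k | j ≟ k
    ...   | yes refl | _ = inj₂ (Lifting.lift-up i q pw lt)
    ...   | no _ | yes refl = inj₁ (Lifting.lift-up j p pw lt)
    ...   | no i≢k | no j≢k with d
    ...     | zero = ⊥-elim (ℕₚ.1+n≰n (≤-trans (subst (ℕ._≤ 0) (len-descent pw k lt) le) z≤n))
    ...     | suc d = [ inj₁ ∘ (_◅◅ (st ◅ ε)) , inj₂ ∘ (_◅◅ (st ◅ ε)) ]′
              (go d (≤-pred (subst (ℕ._≤ suc d) (len-descent pw k lt) le)) (perm-∙ pw (perm-simple k))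
                (Lifting.lift-down k p pw lt (simple-ascent i≢k)) (Lifting.lift-down k q pw lt (simple-ascent j≢k)))
      where
      st : BruhatStep (w ∙ simple k) w
      st = Lifting.down k pw lt

len-simple∙simple : ∀ {m} {i j : Fin m} → i ≢ j → len (simple i ∙ simple j) ≡ 2
len-simple∙simple {i = i} {j} i≢j = trans (len-ascent (perm-simple i) j (simple-ascent i≢j)) (cong suc (len-simple i))

simpleˡ-≤ : ∀ {m} {i j : Fin m} → i ≢ j → simple i ≤B (simple i ∙ simple j)
simpleˡ-≤ {i = i} {j} i≢j = step-up (perm-simple i) (inject₁<suc j) (simple-ascent i≢j) ◅ ε

simpleʳ-≤ : ∀ {m} {i j : Fin m} → i ≢ j → simple j ≤B (simple i ∙ simple j)
simpleʳ-≤ {i = i} {j} i≢j = subst (λ t → BruhatStep (simple j) t) moved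
  (step-up (perm-simple j) (simple-ascent (i≢j ∘ sym))
    (subst₂ _<_ (sym (simple-involutive j (inject₁ i))) (sym (simple-involutive j (suc i))) (inject₁<suc i))) ◅ ε
  where
  moved : simple j ∙ tr (simple j ! inject₁ i) (simple j ! suc i) ≡ simple i ∙ simple j
  moved = trans (∙-tr (perm-simple j) (simple j ! inject₁ i) (simple j ! suc i))
    (cong₂ (λ s t → tr s t ∙ simple j) (simple-involutive j (inject₁ i)) (simple-involutive j (suc i)))

opaque
  two-simples-below : ∀ {m} {x : Word (suc m)} {i j} → Perm x → len x ≡ 2 → i ≢ j → simple i ≤B x → simple j ≤B x →
    x ≡ simple i ∙ simple j ⊎ x ≡ simple j ∙ simple i
  two-simples-below px q i≢j p p′ with len≡2⇒simple∙simple px q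
  ... | a , b , _ , refl with simple-≤-∙ p | simple-≤-∙ p′
  ...   | inj₁ refl | inj₁ refl = ⊥-elim (i≢j refl)
  ...   | inj₁ refl | inj₂ refl = inj₁ refl
  ...   | inj₂ refl | inj₁ refl = inj₂ refl
  ...   | inj₂ refl | inj₂ refl = ⊥-elim (i≢j refl)

simple-commute : ∀ {m} {i j : Fin m} → i ≢ j → ¬ DynkinAdj i j → simple i ∙ simple j ≡ simple j ∙ simple i
simple-commute {i = i} {j} i≢j far = trans (∙-tr (perm-simple i) (inject₁ j) (suc j))
  (cong₂ (λ s t → tr s t ∙ simple i) (tr-≢ ne₁ ne₂) (tr-≢ ne₃ ne₄))
  where
  ne₁ : inject₁ j ≢ inject₁ i
  ne₁ q = i≢j (sym (Finₚ.inject₁-injective q))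
  ne₂ : inject₁ j ≢ suc i
  ne₂ q = far (inj₁ (trans (sym (cong toℕ q)) (Finₚ.toℕ-inject₁ j)))
  ne₃ : suc j ≢ inject₁ i
  ne₃ q = far (inj₂ (trans (cong toℕ q) (Finₚ.toℕ-inject₁ i)))
  ne₄ : suc j ≢ suc i
  ne₄ q = i≢j (sym (Finₚ.suc-injective q))

-- The inversion order and its Hasse diagram

data Linked {n} : Fin n × Fin n → Fin n × Fin n → Set where
  down : ∀ {a b c} → Linked (a , b) (b , c)
  up   : ∀ {a b c} → Linked (b , c) (a , b)

linked-swap : ∀ {n} {x y : Fin n × Fin n} → Linked x y → Linked (swap x) (swap y)
linked-swap down = up
linked-swap up   = down

Covers : ∀ {n} → (Fin n → Fin n → Set) → Fin n → Fin n → Set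
Covers _≻_ a b = a ≻ b × ∀ k → ¬ (a ≻ k × k ≻ b)

Edge : ∀ {n} → (Fin n → Fin n → Set) → Fin n × Fin n → Set
Edge _≻_ (a , b) = Covers _≻_ a b

-- Edges of the Hasse diagram stand for coatoms. If 4231 is avoided, linked edges are coatoms with
-- two common lower neighbours, so a claw is a coatom with three such partners and a square is a
-- cycle of four.
record Claw {n} (_≻_ : Fin n → Fin n → Set) : Set where
  constructor claw
  field
    {centre leaf₁ leaf₂ leaf₃} : Fin n × Fin n
    centreᵉ : Edge _≻_ centre
    leaf₁ᵉ  : Edge _≻_ leaf₁
    leaf₂ᵉ  : Edge _≻_ leaf₂
    leaf₃ᵉ  : Edge _≻_ leaf₃
    link₁   : Linked centre leaf₁
    link₂   : Linked centre leaf₂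
    link₃   : Linked centre leaf₃
    leaf₁≢₂ : leaf₁ ≢ leaf₂
    leaf₁≢₃ : leaf₁ ≢ leaf₃
    leaf₂≢₃ : leaf₂ ≢ leaf₃

record Square {n} (_≻_ : Fin n → Fin n → Set) : Set where
  constructor square
  field
    {side₁ side₂ side₃ side₄} : Fin n × Fin n
    side₁ᵉ : Edge _≻_ side₁
    side₂ᵉ : Edge _≻_ side₂
    side₃ᵉ : Edge _≻_ side₃
    side₄ᵉ : Edge _≻_ side₄
    link₁₂ : Linked side₁ side₂
    link₂₃ : Linked side₂ side₃
    link₃₄ : Linked side₃ side₄
    link₄₁ : Linked side₄ side₁
    side₁≢₃ : side₁ ≢ side₃
    side₂≢₄ : side₂ ≢ side₄

covers-flip : ∀ {n} (_≻_ : Fin n → Fin n → Set) {a b} → Covers _≻_ a b → Covers (flip _≻_) b a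
covers-flip _ (p , none) = p , λ k (q , r) → none k (r , q)

claw-flip : ∀ {n} {_≻_ : Fin n → Fin n → Set} → Claw (flip _≻_) → Claw _≻_
claw-flip {_≻_ = _≻_} (claw {_ , _} {_ , _} {_ , _} {_ , _} c e₁ e₂ e₃ l₁ l₂ l₃ n₁₂ n₁₃ n₂₃) = claw
  (covers-flip (flip _≻_) c) (covers-flip (flip _≻_) e₁) (covers-flip (flip _≻_) e₂) (covers-flip (flip _≻_) e₃)
  (linked-swap l₁) (linked-swap l₂) (linked-swap l₃)
  (n₁₂ ∘ cong swap) (n₁₃ ∘ cong swap) (n₂₃ ∘ cong swap)

module HasseDiagram {n} {_≻_ : Fin n → Fin n → Set}
  (spo : IsStrictPartialOrder _≡_ _≻_) (_≻?_ : ∀ i j → Dec (i ≻ j)) where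

  ≻-trans : ∀ {i j k} → i ≻ j → j ≻ k → i ≻ k
  ≻-trans = IsStrictPartialOrder.trans spo

  ≻-irrefl : ∀ {i} → ¬ (i ≻ i)
  ≻-irrefl = IsStrictPartialOrder.irrefl spo refl

  _⋗_ : Fin n → Fin n → Set
  _⋗_ = Covers _≻_

  coverAbove : ∀ {a x} → a ≻ x → ∃ λ u → u ⋗ x × (u ≡ a ⊎ a ≻ u)
  coverAbove {a} {x} = go a (spo-noetherian spo a)
    where
    go : ∀ a → Acc (flip _≻_) a → a ≻ x → ∃ λ u → u ⋗ x × (u ≡ a ⊎ a ≻ u)
    go a (acc rs) p with any? (λ k → (a ≻? k) ×-dec (k ≻? x))
    ... | no none = a , (p , λ k q → none (k , q)) , inj₁ refl
    ... | yes (k , ak , kx) with go k (rs ak) kx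
    ...   | u , c , inj₁ refl = u , c , inj₂ ak
    ...   | u , c , inj₂ q    = u , c , inj₂ (≻-trans ak q)

  coverBelow : ∀ {x b} → x ≻ b → ∃ λ u → x ⋗ u × (u ≡ b ⊎ u ≻ b)
  coverBelow {x} {b} = go b (spo-wellFounded spo b)
    where
    go : ∀ b → Acc _≻_ b → x ≻ b → ∃ λ u → x ⋗ u × (u ≡ b ⊎ u ≻ b)
    go b (acc rs) p with any? (λ k → (x ≻? k) ×-dec (k ≻? b))
    ... | no none = b , (p , λ k q → none (k , q)) , inj₁ refl
    ... | yes (k , xk , kb) with go k (rs kb) xk
    ...   | u , c , inj₁ refl = u , c , inj₂ kb
    ...   | u , c , inj₂ q    = u , c , inj₂ (≻-trans q kb)

  _∥_ : Fin n → Fin n → Set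
  a ∥ b = a ≢ b × ¬ (a ≻ b) × ¬ (b ≻ a)

  record Branch (a b x : Fin n) : Set where
    constructor branch
    field
      {node u₁ u₂} : Fin n
      above : node ≡ x ⊎ node ≻ x
      a≻    : a ≻ node
      b≻    : b ≻ node
      u₁⋗   : u₁ ⋗ node
      u₂⋗   : u₂ ⋗ node
      u₁≢u₂ : u₁ ≢ u₂

  -- Climb from `x` as long as one upper cover leads to both `a` and `b`. As these are incomparable,
  -- the climb ends at a node below both.
  branching : ∀ {a b x} → a ∥ b → a ≻ x → b ≻ x → Branch a b x
  branching {a} {b} (a≢b , a⊁b , b⊁a) = go _ (spo-wellFounded spo _)
    where
    go : ∀ x → Acc _≻_ x → a ≻ x → b ≻ x → Branch a b x
    go x (acc rs) ax bx with coverAbove ax | coverAbove bx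
    ... | u , uc , ul | v , vc , vl with u ≟ v
    ...   | no u≢v = branch (inj₁ refl) ax bx uc vc u≢v
    ...   | yes refl with ul | vl
    ...     | inj₁ refl | inj₁ refl = ⊥-elim (a≢b refl)
    ...     | inj₁ refl | inj₂ bu   = ⊥-elim (b⊁a bu)
    ...     | inj₂ au   | inj₁ refl = ⊥-elim (a⊁b au)
    ...     | inj₂ au   | inj₂ bu with go u (rs (proj₁ uc)) au bu
    ...       | branch (inj₁ refl) p q c d ne = branch (inj₂ (proj₁ uc)) p q c d ne
    ...       | branch (inj₂ r)    p q c d ne = branch (inj₂ (≻-trans r (proj₁ uc))) p q c d ne

  below-node : ∀ {a b x y} (B : Branch a b x) → x ≻ y → Branch.node B ≻ y
  below-node (branch (inj₁ refl) _ _ _ _ _) p = p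
  below-node (branch (inj₂ q)    _ _ _ _ _) p = ≻-trans q p

  -- The centre is the edge from the branching node down to a cover `v`. Two edges arrive at the
  -- node, and one leaves `v`, which is not minimal because the chain has two steps below `x`.
  claw-chain : ∀ {a b x y z} → a ∥ b → a ≻ x → b ≻ x → x ≻ y → y ≻ z → Claw _≻_
  claw-chain par ax bx xy yz with branching par ax bx
  ... | B with coverBelow (below-node B xy)
  ...   | v , xv , vl with coverBelow ([ (λ { refl → yz }) , (λ vy → ≻-trans vy yz) ]′ vl)
  ...     | t , vt , _ = claw xv u₁⋗ u₂⋗ vt up up down
    (u₁≢u₂ ∘ cong proj₁)
    (λ q → ≻-irrefl (≻-trans (proj₁ xv) (subst (_≻ node) (cong proj₁ q) (proj₁ u₁⋗))))
    (λ q → ≻-irrefl (≻-trans (proj₁ xv) (subst (_≻ node) (cong proj₁ q) (proj₁ u₂⋗))))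
    where open Branch B

  claw-meet : ∀ {a b u x y} → a ∥ b → u ⋗ x → (u ≡ a ⊎ a ≻ u) → (u ≡ b ⊎ b ≻ u) → x ≻ y → Claw _≻_
  claw-meet (ne , _ , _) _  (inj₁ refl) (inj₁ refl) _  = ⊥-elim (ne refl)
  claw-meet (_ , _ , ba) _  (inj₁ refl) (inj₂ bu)   _  = ⊥-elim (ba bu)
  claw-meet (_ , ab , _) _  (inj₂ au)   (inj₁ refl) _  = ⊥-elim (ab au)
  claw-meet par          uc (inj₂ au)   (inj₂ bu)   xy = claw-chain par au bu (proj₁ uc) xy

  -- Three distinct upper covers of `x` give the leaves around an edge below `x`. If two of them
  -- coincide, the chain from that cover through `x` to `y` puts us in the case of `claw-chain`.
  claw-three : ∀ {a b c x y} → a ∥ b → a ∥ c → b ∥ c → a ≻ x → b ≻ x → c ≻ x → x ≻ y → Claw _≻_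
  claw-three {a} {b} {c} {x} {y} ab ac bc ax bx cx xy with coverAbove ax | coverAbove bx | coverAbove cx | coverBelow xy
  ... | u , uc , ul | v , vc , vl | t , tc , tl | z , xz , _ with u ≟ v | u ≟ t | v ≟ t
  ... | yes refl | _ | _ = claw-meet ab uc ul vl xy
  ... | no _ | yes refl | _ = claw-meet ac uc ul tl xy
  ... | no _ | no _ | yes refl = claw-meet bc vc vl tl xy
  ... | no u≢v | no u≢t | no v≢t = claw xz uc vc tc up up up
    (λ { refl → u≢v refl }) (λ { refl → u≢t refl }) (λ { refl → v≢t refl })

flip-spo : ∀ {n} {_≻_ : Fin n → Fin n → Set} → IsStrictPartialOrder _≡_ _≻_ → IsStrictPartialOrder _≡_ (flip _≻_)
flip-spo spo = record
  { isEquivalence = isEquivalence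
  ; irrefl        = λ { refl → IsStrictPartialOrder.irrefl spo refl }
  ; trans         = λ p q → IsStrictPartialOrder.trans spo q p
  ; <-resp-≈      = (λ { refl p → p }) , (λ { refl p → p })
  }

module HasseDual {n} {_≻_ : Fin n → Fin n → Set}
  (spo : IsStrictPartialOrder _≡_ _≻_) (_≻?_ : ∀ i j → Dec (i ≻ j)) where

  open HasseDiagram spo _≻?_
  module Op = HasseDiagram (flip-spo spo) (flip _≻?_)

  flip-∥ : ∀ {a b} → a ∥ b → a Op.∥ b
  flip-∥ (ne , p , q) = ne , q , p

  claw-chainᵒ : ∀ {a b x y z} → a ∥ b → x ≻ a → x ≻ b → y ≻ x → z ≻ y → Claw _≻_
  claw-chainᵒ par p q r t = claw-flip (Op.claw-chain (flip-∥ par) p q r t)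

  claw-threeᵒ : ∀ {a b c x y} → a ∥ b → a ∥ c → b ∥ c → x ≻ a → x ≻ b → x ≻ c → y ≻ x → Claw _≻_
  claw-threeᵒ ab ac bc p q r t = claw-flip (Op.claw-three (flip-∥ ab) (flip-∥ ac) (flip-∥ bc) p q r t)

  -- If a branching happens away from `x`, the additional step makes a chain long enough for
  -- `claw-chain` or its dual. If both happen at `x`, two edges arriving and two leaving form the
  -- square.
  hourglass : ∀ {a b x d f} → a ∥ b → d ∥ f → a ≻ x → b ≻ x → x ≻ d → x ≻ f → Claw _≻_ ⊎ Square _≻_
  hourglass ab df ax bx xd xf with branching ab ax bx | Op.branching (flip-∥ df) xd xf
  ... | branch (inj₂ r) p q _ _ _ | _ = inj₁ (claw-chain ab p q r xd)
  ... | branch (inj₁ refl) _ _ _ _ _ | Op.branch (inj₂ r) p q _ _ _ = inj₁ (claw-chainᵒ df p q r ax)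
  ... | branch (inj₁ refl) _ _ c₁ c₂ ne | Op.branch (inj₁ refl) _ _ d₁ d₂ ne′ = inj₂ (square
        c₁ (covers-flip (flip _≻_) d₁) c₂ (covers-flip (flip _≻_) d₂) down up down up
        (λ { refl → ne refl }) (λ { refl → ne′ refl }))

Inv : ∀ {n} → Word n → Fin n → Fin n → Set
Inv w i j = i < j × w ! j < w ! i

inv-spo : ∀ {n} (w : Word n) → IsStrictPartialOrder _≡_ (Inv w)
inv-spo w = record
  { isEquivalence = isEquivalence
  ; irrefl        = λ { refl (p , _) → <-irrefl refl p }
  ; trans         = λ (p , q) (p′ , q′) → <-trans p p′ , <-trans q′ q
  ; <-resp-≈      = (λ { refl p → p }) , (λ { refl p → p })
  }

inv? : ∀ {n} (w : Word n) i j → Dec (Inv w i j)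
inv? w i j = (i <? j) ×-dec (w ! j <? w ! i)

Cov : ∀ {n} → Word n → Fin n → Fin n → Set
Cov w = Covers (Inv w)

mkCov : ∀ {n} (w : Word n) {i j x y} → w ! i ≡ x → w ! j ≡ y → i < j → y < x →
  (∀ k → i < k → k < j → y < w ! k → w ! k < x → ⊥) → Cov w i j
mkCov w refl refl i<j lt h = (i<j , lt) , λ k ((ik , ki) , (kj , jk)) → h k ik kj jk ki

cov-ℓ : ∀ {n} {w : Word n} {i j} → Perm w → Cov w i j → ℓ w ≡ suc (ℓ (w ∙ tr i j))
cov-ℓ {w = w} {i} {j} pw ((i<j , lt) , none) = trans (cong ℓ (sym (∙-tr-tr w i j)))
  (ℓ-swap-≡ (perm-∙ pw (perm-tr i j)) i<j
    (subst₂ _<_ (sym (∙-tr-ˡ w i j)) (sym (∙-tr-ʳ w i j)) lt)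
    λ k (ik , kj , p , q) →
      let wk = ∙-tr-≢ w (<⇒≢ ik ∘ sym) (<⇒≢ kj) in
      none k ((ik , subst₂ _<_ wk (∙-tr-ʳ w i j) q) , (kj , subst₂ _<_ (∙-tr-ˡ w i j) wk p)))

cov-⋖ : ∀ {n} {w : Word n} {i j} → Perm w → Cov w i j → (w ∙ tr i j) ⋖ w
cov-⋖ pw c@((i<j , lt) , _) = ℓ-cover⇒⋖ (step-down pw i<j lt ◅ ε) (cov-ℓ pw c)

Avoids4231 : ∀ {n} → Word n → Set
Avoids4231 w = ∀ {i j k l} → i < j → j < k → k < l → w ! l < w ! j → w ! j < w ! k → w ! k < w ! i → ⊥

record CommonLower {n} (u v : Word n) : Set where
  constructor commonLower
  field
    {x y} : Word n
    x⋖u   : x ⋖ u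
    x⋖v   : x ⋖ v
    y⋖u   : y ⋖ u
    y⋖v   : y ⋖ v
    x≢y   : x ≢ y
    ℓ-x   : ℓ u ≡ suc (ℓ x)
    ℓ-y   : ℓ u ≡ suc (ℓ y)

-- On the positions a < c < d the word reads 3 2 1, the coatoms read 2 3 1 and 3 1 2,
-- and without 4231 both 1 3 2 and 2 1 3 lie two levels below w.
consecutive-covers : ∀ {n} {w : Word n} {a c d} → Perm w → Avoids4231 w → Cov w a c → Cov w c d →
  CommonLower (w ∙ tr a c) (w ∙ tr c d)
consecutive-covers {w = w} {a} {c} {d} pw av ((a<c , wc<wa) , none) ((c<d , wd<wc) , none′) = commonLower
  (cov-⋖ p₁ V₁-ad)
  (subst (_⋖ V₂) (sym x≡) (cov-⋖ p₂ V₂-ac))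
  (cov-⋖ p₁ V₁-cd)
  (subst (_⋖ V₂) (sym y≡) (cov-⋖ p₂ V₂-ad))
  (λ q → a≢c (injective p₁ a c (trans (sym (∙-tr-ʳ V₁ a d)) (trans (cong (_! d) q) (∙-tr-ʳ V₁ c d)))))
  (cov-ℓ p₁ V₁-ad) (cov-ℓ p₁ V₁-cd)
  where
  V₁ V₂ : Word _
  V₁ = w ∙ tr a c
  V₂ = w ∙ tr c d
  p₁ : Perm V₁
  p₁ = perm-∙ pw (perm-tr a c)
  p₂ : Perm V₂
  p₂ = perm-∙ pw (perm-tr c d)
  a<d : a < d
  a<d = <-trans a<c c<d
  wd<wa : w ! d < w ! a
  wd<wa = <-trans wd<wc wc<wa
  a≢c : a ≢ c
  a≢c = <⇒≢ a<c
  c≢d : c ≢ d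
  c≢d = <⇒≢ c<d
  a≢d : a ≢ d
  a≢d = <⇒≢ a<d
  V₁d : V₁ ! d ≡ w ! d
  V₁d = ∙-tr-≢ w (a≢d ∘ sym) (c≢d ∘ sym)
  V₂a : V₂ ! a ≡ w ! a
  V₂a = ∙-tr-≢ w a≢c a≢d
  gt⇒≢ : ∀ {i j} → i < j → j ≢ i
  gt⇒≢ p q = <⇒≢ p (sym q)
  V₁-ad : Cov V₁ a d
  V₁-ad = mkCov V₁ (∙-tr-ˡ w a c) V₁d a<d wd<wc λ k ak kd lo hi → case <-cmp k c of λ where
    (tri≈ _ refl _) → <-asym (subst (_< w ! c) (∙-tr-ʳ w a c) hi) wc<wa
    (tri< k<c k≢c _) → let q = ∙-tr-≢ w (gt⇒≢ ak) k≢c in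
      av ak k<c c<d (subst (w ! d <_) q lo) (subst (_< w ! c) q hi) wc<wa
    (tri> _ k≢c c<k) → let q = ∙-tr-≢ w (gt⇒≢ ak) k≢c in
      none′ k ((c<k , subst (_< w ! c) q hi) , (kd , subst (w ! d <_) q lo))
  V₁-cd : Cov V₁ c d
  V₁-cd = mkCov V₁ (∙-tr-ʳ w a c) V₁d c<d wd<wa λ k ck kd lo hi →
    let q = ∙-tr-≢ w (gt⇒≢ (<-trans a<c ck)) (gt⇒≢ ck)
        lo′ = subst (w ! d <_) q lo
        hi′ = subst (_< w ! a) q hi
    in case <-cmp (w ! k) (w ! c) of λ where
      (tri< l _ _) → none′ k ((ck , l) , (kd , lo′))
      (tri≈ _ r _) → gt⇒≢ ck (injective pw k c r)
      (tri> _ _ g) → av a<c ck kd wd<wc g hi′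
  V₂-ac : Cov V₂ a c
  V₂-ac = mkCov V₂ V₂a (∙-tr-ˡ w c d) a<c wd<wa λ k ak kc lo hi →
    let q = ∙-tr-≢ w (<⇒≢ kc) (<⇒≢ (<-trans kc c<d))
        lo′ = subst (w ! d <_) q lo
        hi′ = subst (_< w ! a) q hi
    in case <-cmp (w ! k) (w ! c) of λ where
      (tri< l _ _) → av ak kc c<d lo′ l wc<wa
      (tri≈ _ r _) → <⇒≢ kc (injective pw k c r)
      (tri> _ _ g) → none k ((ak , hi′) , (kc , g))
  V₂-ad : Cov V₂ a d
  V₂-ad = mkCov V₂ V₂a (∙-tr-ʳ w c d) a<d wc<wa λ k ak kd lo hi → case <-cmp k c of λ where
    (tri≈ _ refl _) → <-asym (subst (w ! c <_) (∙-tr-ˡ w c d) lo) wd<wc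
    (tri< k<c k≢c _) → let q = ∙-tr-≢ w k≢c (<⇒≢ kd) in
      none k ((ak , subst (_< w ! a) q hi) , (k<c , subst (w ! c <_) q lo))
    (tri> _ k≢c c<k) → let q = ∙-tr-≢ w k≢c (<⇒≢ kd) in
      av a<c c<k kd wd<wc (subst (w ! c <_) q lo) (subst (_< w ! a) q hi)
  open ≡-Reasoning
  x≡ : V₁ ∙ tr a d ≡ V₂ ∙ tr a c
  x≡ = begin
    (w ∙ tr a c) ∙ tr a d                        ≡⟨ ∙-assoc w (tr a c) (tr a d) ⟩
    w ∙ (tr a c ∙ tr a d)                        ≡⟨ cong (w ∙_) (∙-tr (perm-tr a c) a d) ⟩
    w ∙ (tr (tr a c ! a) (tr a c ! d) ∙ tr a c)  ≡⟨ cong₂ (λ s t → w ∙ (tr s t ∙ tr a c)) (tr-ˡ a c) (tr-≢ (a≢d ∘ sym) (c≢d ∘ sym)) ⟩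
    w ∙ (tr c d ∙ tr a c)                        ≡⟨ sym (∙-assoc w (tr c d) (tr a c)) ⟩
    V₂ ∙ tr a c                                  ∎
  y≡ : V₁ ∙ tr c d ≡ V₂ ∙ tr a d
  y≡ = sym (begin
    (w ∙ tr c d) ∙ tr a d                        ≡⟨ ∙-assoc w (tr c d) (tr a d) ⟩
    w ∙ (tr c d ∙ tr a d)                        ≡⟨ cong (w ∙_) (∙-tr (perm-tr c d) a d) ⟩
    w ∙ (tr (tr c d ! a) (tr c d ! d) ∙ tr c d)  ≡⟨ cong₂ (λ s t → w ∙ (tr s t ∙ tr c d)) (tr-≢ a≢c a≢d) (tr-ʳ c d) ⟩
    w ∙ (tr a c ∙ tr c d)                        ≡⟨ sym (∙-assoc w (tr a c) (tr c d)) ⟩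
    V₁ ∙ tr c d                                  ∎)

swapped : ∀ {n} → Word n → Fin n × Fin n → Word n
swapped w (i , j) = w ∙ tr i j

tr-pair : ∀ {n} {i j i′ j′ : Fin n} → i < j → i′ < j′ → tr i j ≡ tr i′ j′ → (i , j) ≡ (i′ , j′)
tr-pair {i = i} {j} {i′} {j′} i<j i′<j′ q with i ≟ i′ | i ≟ j′
... | yes refl | _ = cong (i ,_) (trans (sym (tr-ˡ i j)) (trans (cong (_! i) q) (tr-ˡ i j′)))
... | no _ | yes refl = ⊥-elim (<-asym i<j (subst (_< i) (sym (trans (sym (tr-ˡ i j)) (trans (cong (_! i) q) (tr-ʳ i′ i)))) i′<j′))
... | no i≢i′ | no i≢j′ = ⊥-elim (<⇒≢ i<j (sym (trans (sym (tr-ˡ i j)) (trans (cong (_! i) q) (tr-≢ i≢i′ i≢j′)))))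

swapped-injective : ∀ {n} {w : Word n} {x y : Fin n × Fin n} → Perm w →
  proj₁ x < proj₂ x → proj₁ y < proj₂ y → swapped w x ≡ swapped w y → x ≡ y
swapped-injective pw p q r = tr-pair p q (∙-cancelˡ pw r)

-- Coatoms tagged by the boundaries they cross, and untagged ones from 4231 and 3412

last-before : ∀ {n} {P : Fin n → Set} → (∀ i → Dec (P i)) → ∀ {z j : Fin n} → z < j → P z →
  ∃ λ x → x < j × P x × (∀ y → x < y → y < j → ¬ P y)
last-before {P = P} P? {z} {j} = go z (>-wellFounded z)
  where
  go : ∀ z → Acc Fin._>_ z → z < j → P z → ∃ λ x → x < j × P x × (∀ y → x < y → y < j → ¬ P y)
  go z (acc rs) z<j pz with any? (λ y → (z <? y) ×-dec (y <? j) ×-dec P? y)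
  ... | yes (y , z<y , y<j , py) = go y (rs z<y) y<j py
  ... | no none = z , z<j , pz , λ y p q r → none (y , p , q , r)

first-after : ∀ {n} {P : Fin n → Set} → (∀ i → Dec (P i)) → ∀ {j z : Fin n} → j < z → P z →
  ∃ λ l → j < l × P l × (∀ y → j < y → y < l → ¬ P y)
first-after {P = P} P? {j} {z} = go z (<-wellFounded z)
  where
  go : ∀ z → Acc Fin._<_ z → j < z → P z → ∃ λ x → j < x × P x × (∀ y → j < y → y < x → ¬ P y)
  go z (acc rs) j<z pz with any? (λ y → (j <? y) ×-dec (y <? z) ×-dec P? y)
  ... | yes (y , j<y , y<z , py) = go y (rs y<z) j<y py
  ... | no none = z , j<z , pz , λ y p q r → none (y , p , q , r)

-- A cover of the inversion order that crosses the boundary between j-1 and j, chosen so that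
-- j can be recovered from it: either j is its right end and nothing in between exceeds j,
-- or j is a left-to-right maximum.
data Tag {n} (w : Word n) (j : Fin n) : Fin n → Fin n → Set where
  nearest : ∀ {x} → (∀ y → x < y → y < j → w ! y < w ! j) → Tag w j x j
  record′ : ∀ {x l} → x < j → j < l → w ! l < w ! j → (∀ y → x < y → y < j → w ! y < w ! l) →
            (∀ z y → z < j → j ≤ y → y < l → w ! z < w ! y) → Tag w j x l

-- A `record′` boundary is a position between `x` and `l` with a value above that at `l`. This
-- contradicts `nearest`, and of two such boundaries the larger one excludes the smaller.
tag-injective : ∀ {n} {w : Word n} {i j x l} → w ! l < w ! x → Tag w i x l → Tag w j x l → i ≡ j
tag-injective lt (nearest _) (nearest _) = refl
tag-injective lt (nearest h) (record′ p q r _ _) = ⊥-elim (<-asym r (h _ p q))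
tag-injective lt (record′ p q r _ _) (nearest h) = ⊥-elim (<-asym r (h _ p q))
tag-injective {w = w} {i} {j} lt (record′ p q r s _) (record′ p′ q′ r′ s′ _) with <-cmp i j
... | tri< i<j _ _ = ⊥-elim (<-asym r (s′ i p i<j))
... | tri≈ _ eq _  = eq
... | tri> _ _ j<i = ⊥-elim (<-asym r′ (s j p′ j<i))

≮∧≢⇒> : ∀ {n} {w : Word n} → Perm w → ∀ {i j} → i ≢ j → ¬ (w ! i < w ! j) → w ! j < w ! i
≮∧≢⇒> pw i≢j h = ≤∧≢⇒< (≮⇒≥ h) λ q → i≢j (injective pw _ _ (sym q))

nearest-cover : ∀ {n} {w : Word n} → Perm w → ∀ {z j} → z < j → w ! j < w ! z →
  ∃ λ x → Cov w x j × (∀ y → x < y → y < j → w ! y < w ! j)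
nearest-cover {w = w} pw {z} {j} z<j lt with last-before {P = λ y → w ! j < w ! y} (λ y → w ! j <? w ! y) z<j lt
... | x , x<j , lt′ , none = x , ((x<j , lt′) , λ k ((xk , _) , (kj , p)) → none k xk kj p)
      , λ y xy yj → ≮∧≢⇒> pw (<⇒≢ yj ∘ sym) (none y xy yj)

-- If a larger entry precedes `j`, the nearest one on its left does. If not, let `l` be the first
-- position after `j` whose value is below some entry before `j`, and let `x` be the last such
-- entry.
tagged-cover : ∀ {n} {w : Word n} → Perm w → ∀ {a j b} → a < j → j ≤ b → w ! b < w ! a →
  ∃₂ λ x l → Cov w x l × Tag w j x l
tagged-cover {w = w} pw {a} {j} {b} a<j j≤b lt with any? (λ z → (z <? j) ×-dec (w ! j <? w ! z))
... | yes (z , z<j , lt′) with nearest-cover pw z<j lt′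
...   | x , c , h = x , j , c , nearest h
tagged-cover {w = w} pw {a} {j} {b} a<j j≤b lt | no record-j
  with first-after {P = λ l → ∃ λ z → z < j × w ! l < w ! z} (λ l → any? λ z → (z <? j) ×-dec (w ! l <? w ! z)) j<b (a , a<j , lt)
  where
  j<b : j < b
  j<b = ≤∧≢⇒< j≤b λ { refl → record-j (a , a<j , lt) }
... | l , j<l , (z , z<j , wl<wz) , early with last-before {P = λ x → w ! l < w ! x} (λ x → w ! l <? w ! x) z<j wl<wz
...   | x , x<j , wl<wx , late = x , l , (((<-trans x<j j<l) , wl<wx) , none)
        , record′ x<j j<l (<-trans wl<wx (max x x<j)) low high
  where
  max : ∀ z → z < j → w ! z < w ! j
  max z z<j = ≮∧≢⇒> pw (<⇒≢ z<j ∘ sym) λ p → record-j (z , z<j , p)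
  low : ∀ y → x < y → y < j → w ! y < w ! l
  low y xy yj = ≮∧≢⇒> pw (<⇒≢ (<-trans yj j<l) ∘ sym) (late y xy yj)
  high : ∀ z y → z < j → j ≤ y → y < l → w ! z < w ! y
  high z y z<j j≤y y<l with j ≟ y
  ... | yes refl = max z z<j
  ... | no j≢y = ≮∧≢⇒> pw (<⇒≢ (<-≤-trans z<j j≤y) ∘ sym)
                   λ p → early y (≤∧≢⇒< j≤y j≢y) y<l (z , z<j , p)
  none : ∀ k → ¬ (Inv w x k × Inv w k l)
  none k ((xk , p) , (kl , q)) with <-cmp k j
  ... | tri< k<j _ _ = <-asym q (low k xk k<j)
  ... | tri≈ _ refl _ = <-asym p (max x x<j)
  ... | tri> _ _ j<k = <-asym p (high x k x<j (<⇒≤ j<k) kl)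

-- The three edges exhibit three lower neighbours of the coatom, one more than an element of length
-- two can have.
record Superfluous {n} (w : Word n) : Set where
  constructor superfluous
  field
    {x l} : Fin n
    cover    : Cov w x l
    untagged : ∀ j → ¬ Tag w j x l
    {e₁ e₂ e₃} : Fin n × Fin n
    edge₁    : Edge (Inv (w ∙ tr x l)) e₁
    edge₂    : Edge (Inv (w ∙ tr x l)) e₂
    edge₃    : Edge (Inv (w ∙ tr x l)) e₃
    e₁≢e₂    : e₁ ≢ e₂
    e₁≢e₃    : e₁ ≢ e₃
    e₂≢e₃    : e₂ ≢ e₃

shorten : ∀ {l x k} d → l ℕ.≤ suc d + x → x ℕ.< k → l ℕ.≤ d + k
shorten {x = x} {k} d le lt = ≤-trans le (subst (ℕ._≤ d + k) (ℕₚ.+-suc d x) (ℕₚ.+-monoʳ-≤ d lt))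

-- The coatom exchanges the 2 and the 1. An entry that prevents them from being a cover replaces one
-- of the two, so the window shrinks until they are. The 3 between them and the 4 before them
-- exclude every tag.
superfluous-4231 : ∀ {n} {w : Word n} → Perm w → ∀ {z x j l} → z < x → x < j → j < l →
  w ! l < w ! x → w ! x < w ! j → w ! j < w ! z → Superfluous w
superfluous-4231 {n} {w} pw {z} {x} {j} {l} = go (toℕ l) (ℕₚ.m≤m+n _ _)
  where
  at : ∀ {z x j l} → Cov w x l → z < x → x < j → j < l → w ! x < w ! j → w ! j < w ! z → Superfluous w
  at {z} {x} {j} {l} c@((x<l , lx) , none) zx xj jl xj′ jz′
    with nearest-cover pv {z} {x} zx (subst₂ _<_ (sym vx) (sym vz) (<-trans lx (<-trans xj′ jz′)))
       | nearest-cover pv {z} {j} (<-trans zx xj) (subst₂ _<_ (sym vj) (sym vz) jz′)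
       | nearest-cover pv {j} {l} jl (subst₂ _<_ (sym vl) (sym vj) xj′)
    where
    v = w ∙ tr x l
    pv = perm-∙ pw (perm-tr x l)
    vx = ∙-tr-ˡ w x l
    vl = ∙-tr-ʳ w x l
    vj = ∙-tr-≢ w {x} {l} {j} (<⇒≢ xj ∘ sym) (<⇒≢ jl)
    vz = ∙-tr-≢ w {x} {l} {z} (<⇒≢ zx) (<⇒≢ (<-trans zx x<l))
  ... | a , ca , _ | b , cb , _ | d , cd , _ = superfluous c untagged ca cb cd
        (<⇒≢ xj ∘ cong proj₂) (<⇒≢ x<l ∘ cong proj₂) (<⇒≢ jl ∘ cong proj₂)
    where
    untagged : ∀ i → ¬ Tag w i x l
    untagged i (nearest h) = <-asym (<-trans lx xj′) (h j xj jl)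
    untagged i (record′ xi il r low high) with <-cmp j i
    ... | tri< j<i _ _  = <-asym (<-trans lx xj′) (low j xj j<i)
    ... | tri≈ _ refl _ = <-asym jz′ (high z j (<-trans zx xi) ≤-refl jl)
    ... | tri> _ _ i<j  = <-asym jz′ (high z j (<-trans zx xi) (<⇒≤ i<j) jl)
  go : ∀ d {z x j l} → toℕ l ℕ.≤ d + toℕ x → z < x → x < j → j < l →
       w ! l < w ! x → w ! x < w ! j → w ! j < w ! z → Superfluous w
  go zero le zx xj jl _ _ _ = ⊥-elim (<⇒≱ (<-trans xj jl) le)
  go (suc d) {z} {x} {j} {l} le zx xj jl lx xj′ jz′
    with any? (λ k → (x <? k) ×-dec (k <? l) ×-dec (w ! l <? w ! k) ×-dec (w ! k <? w ! x))
  ... | no none = at (mkCov w refl refl (<-trans xj jl) lx λ k a b c d → none (k , a , b , c , d)) zx xj jl xj′ jz′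
  ... | yes (k , xk , kl , lk , kx) with <-cmp k j
  ...   | tri< k<j _ _ = go d (shorten d le xk)
                             (<-trans zx xk) k<j jl lk (<-trans kx xj′) jz′
  ...   | tri≈ _ refl _ = ⊥-elim (<-asym kx xj′)
  ...   | tri> _ _ j<k = go d (≤-pred (≤-trans kl le)) zx xj j<k kx xj′ jz′

-- An occurrence of 45312, whose middle entry lies below two incomparable elements and above two
-- others in the inversion order.
record Hourglass {n} (w : Word n) : Set where
  constructor hourglass
  field
    {a b c d f} : Fin n
    a<b  : a < b
    b<c  : b < c
    c<d  : c < d
    d<f  : d < f
    wd<wf : w ! d < w ! f
    wf<wc : w ! f < w ! c
    wc<wa : w ! c < w ! a
    wa<wb : w ! a < w ! b

-- The coatom exchanges the 3 and the 2. The window shrinks as for 4231, except when the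
-- intermediate entry stands between the 4 and the 1; the five entries are then a 45312.
superfluous-3412 : ∀ {n} {w : Word n} → Perm w → ∀ {x j y l} → x < j → j < y → y < l →
  w ! y < w ! l → w ! l < w ! x → w ! x < w ! j → Superfluous w ⊎ Hourglass w
superfluous-3412 {n} {w} pw {x} {j} {y} {l} = go (toℕ l) (ℕₚ.m≤m+n _ _)
  where
  at : ∀ {x j y l} → Cov w x l → x < j → j < y → y < l → w ! y < w ! l → w ! x < w ! j → Superfluous w
  at {x} {j} {y} {l} c@((x<l , lx) , none) xj jy yl yl′ xj′
    with nearest-cover pv {j} {y} jy (subst₂ _<_ (sym vy) (sym vj) wy<wj)
       | nearest-cover pv {j} {l} (<-trans jy yl) (subst₂ _<_ (sym vl) (sym vj) xj′)
       | HasseDiagram.coverBelow (inv-spo (w ∙ tr x l)) (inv? (w ∙ tr x l)) {x} {y}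
           (<-trans xj jy , subst₂ _<_ (sym vy) (sym vx) yl′)
    where
    pv = perm-∙ pw (perm-tr x l)
    vx = ∙-tr-ˡ w x l
    vl = ∙-tr-ʳ w x l
    vj = ∙-tr-≢ w {x} {l} {j} (<⇒≢ xj ∘ sym) (<⇒≢ (<-trans jy yl))
    vy = ∙-tr-≢ w {x} {l} {y} (<⇒≢ (<-trans xj jy) ∘ sym) (<⇒≢ yl)
    wy<wj = <-trans yl′ (<-trans lx xj′)
  ... | a , ca , ha | b , cb , hb | d , cd , _ = superfluous c untagged ca cb cd
        (<⇒≢ yl ∘ cong proj₂)
        (λ q → <-asym (subst₂ _<_ (sym vy) (sym vj) wy<wj) (ha j (subst (_< j) (sym (cong proj₁ q)) xj) jy))
        (λ q → <-asym (subst₂ _<_ (sym vl) (sym vj) xj′) (hb j (subst (_< j) (sym (cong proj₁ q)) xj) (<-trans jy yl)))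
    where
    vl = ∙-tr-ʳ w x l
    vj = ∙-tr-≢ w {x} {l} {j} (<⇒≢ xj ∘ sym) (<⇒≢ (<-trans jy yl))
    vy = ∙-tr-≢ w {x} {l} {y} (<⇒≢ (<-trans xj jy) ∘ sym) (<⇒≢ yl)
    wl<wj = <-trans lx xj′
    wy<wj = <-trans yl′ wl<wj
    untagged : ∀ i → ¬ Tag w i x l
    untagged i (nearest h) = <-asym wl<wj (h j xj (<-trans jy yl))
    untagged i (record′ xi il r low high) with <-cmp j i
    ... | tri< j<i _ _  = <-asym wl<wj (low j xj j<i)
    ... | tri≈ _ refl _ = <-asym (<-trans yl′ lx) (high x y xi (<⇒≤ jy) yl)
    ... | tri> _ _ i<j  = <-asym (<-trans yl′ lx) (high x y xi (<⇒≤ (<-trans i<j jy)) yl)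
  go : ∀ d {x j y l} → toℕ l ℕ.≤ d + toℕ x → x < j → j < y → y < l →
       w ! y < w ! l → w ! l < w ! x → w ! x < w ! j → Superfluous w ⊎ Hourglass w
  go zero le xj jy yl _ _ _ = ⊥-elim (<⇒≱ (<-trans xj (<-trans jy yl)) le)
  go (suc d) {x} {j} {y} {l} le xj jy yl yl′ lx xj′
    with any? (λ k → (x <? k) ×-dec (k <? l) ×-dec (w ! l <? w ! k) ×-dec (w ! k <? w ! x))
  ... | no none = inj₁ (at (mkCov w refl refl (<-trans xj (<-trans jy yl)) lx
                    λ k a b c d → none (k , a , b , c , d)) xj jy yl yl′ xj′)
  ... | yes (k , xk , kl , lk , kx) with <-cmp k j | <-cmp k y
  ...   | tri< k<j _ _ | _ = go d (shorten d le xk) k<j jy yl yl′ lk (<-trans kx xj′)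
  ...   | tri≈ _ refl _ | _ = ⊥-elim (<-asym kx xj′)
  ...   | tri> _ _ j<k | tri< k<y _ _ = inj₂ (hourglass xj j<k k<y yl yl′ lk kx xj′)
  ...   | tri> _ _ j<k | tri≈ _ refl _ = ⊥-elim (<-asym lk yl′)
  ...   | tri> _ _ j<k | tri> _ _ y<k = go d (≤-pred (≤-trans kl le)) xj jy y<k (<-trans yl′ lk) kx xj′

-- Consequences of an isomorphism of the graphs

dynkin-three : ∀ {m} {i a b c : Fin m} → DynkinAdj i a → DynkinAdj i b → DynkinAdj i c → a ≡ b ⊎ a ≡ c ⊎ b ≡ c
dynkin-three (inj₁ p) (inj₁ q) _        = inj₁ (toℕ-injective (trans (sym p) q))
dynkin-three (inj₂ p) (inj₂ q) _        = inj₁ (toℕ-injective (ℕₚ.suc-injective (trans p (sym q))))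
dynkin-three (inj₁ p) (inj₂ q) (inj₁ r) = inj₂ (inj₁ (toℕ-injective (trans (sym p) r)))
dynkin-three (inj₁ p) (inj₂ q) (inj₂ r) = inj₂ (inj₂ (toℕ-injective (ℕₚ.suc-injective (trans q (sym r)))))
dynkin-three (inj₂ p) (inj₁ q) (inj₁ r) = inj₂ (inj₂ (toℕ-injective (trans (sym q) r)))
dynkin-three (inj₂ p) (inj₁ q) (inj₂ r) = inj₂ (inj₁ (toℕ-injective (ℕₚ.suc-injective (trans p (sym r)))))

dynkin-square : ∀ {m} {a b c d : Fin m} → DynkinAdj a b → DynkinAdj b c → DynkinAdj c d → DynkinAdj d a → a ≡ c ⊎ b ≡ d
dynkin-square (inj₁ p) (inj₂ q) _ _ = inj₁ (toℕ-injective (ℕₚ.suc-injective (trans p (sym q))))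
dynkin-square (inj₂ p) (inj₁ q) _ _ = inj₁ (toℕ-injective (trans (sym p) q))
dynkin-square _ (inj₁ q) (inj₂ r) _ = inj₂ (toℕ-injective (ℕₚ.suc-injective (trans q (sym r))))
dynkin-square _ (inj₂ q) (inj₁ r) _ = inj₂ (toℕ-injective (trans (sym q) r))
dynkin-square {a = a} (inj₁ p) (inj₁ q) (inj₁ r) (inj₁ t) =
  ⊥-elim (ℕₚ.m≢1+n+m (toℕ a) {3} (sym (trans (cong (3 +_) p) (trans (cong (2 +_) q) (trans (cong suc r) t)))))
dynkin-square {a = a} (inj₁ p) (inj₁ q) (inj₁ r) (inj₂ t) =
  ⊥-elim (ℕₚ.m≢1+n+m (suc (toℕ a)) {1} (trans t (sym (trans (cong (2 +_) p) (trans (cong suc q) r)))))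
dynkin-square {a = a} (inj₂ p) (inj₂ q) (inj₂ r) (inj₂ t) =
  ⊥-elim (ℕₚ.m≢1+n+m (toℕ a) {3} (sym (trans (cong (3 +_) t) (trans (cong (2 +_) r) (trans (cong suc q) p)))))
dynkin-square {d = d} (inj₂ p) (inj₂ q) (inj₂ r) (inj₁ t) =
  ⊥-elim (ℕₚ.m≢1+n+m (suc (toℕ d)) {1} (trans t (sym (trans (cong (2 +_) r) (trans (cong suc q) p)))))

opaque
  inv-simple∙simple : ∀ {m} (i j : Fin m) → inv (simple i ∙ simple j) ≡ simple j ∙ simple i
  inv-simple∙simple i j = trans (inv-∙ (perm-simple i) (perm-simple j))
    (cong₂ _∙_ (inv-unique (perm-simple j) (tr-involutive (inject₁ j) (suc j)))
               (inv-unique (perm-simple i) (tr-involutive (inject₁ i) (suc i))))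

dynkinAdj? : ∀ {m} (i j : Fin m) → Dec (DynkinAdj i j)
dynkinAdj? i j = (suc (toℕ i) ℕₚ.≟ toℕ j) ⊎-dec (suc (toℕ j) ℕₚ.≟ toℕ i)

opaque
  common-upper⇒adjacent : ∀ {m} {i j : Fin m} {a a′} → i ≢ j →
    Perm a → len a ≡ 2 → simple i ≤B a → simple j ≤B a →
    Perm a′ → len a′ ≡ 2 → simple i ≤B a′ → simple j ≤B a′ → a ≢ a′ → DynkinAdj i j
  common-upper⇒adjacent {i = i} {j} i≢j pa la p q pa′ la′ p′ q′ ne
    with dynkinAdj? i j | two-simples-below pa la i≢j p q | two-simples-below pa′ la′ i≢j p′ q′
  ... | yes d | _ | _ = d
  ... | no _ | inj₁ r | inj₁ t = ⊥-elim (ne (trans r (sym t)))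
  ... | no _ | inj₂ r | inj₂ t = ⊥-elim (ne (trans r (sym t)))
  ... | no far | inj₁ r | inj₂ t = ⊥-elim (ne (trans r (trans (simple-commute i≢j far) (sym t))))
  ... | no far | inj₂ r | inj₁ t = ⊥-elim (ne (trans r (trans (sym (simple-commute i≢j far)) (sym t))))

opaque
  common-lower⇒inv : ∀ {m} {i j : Fin m} {u v} → i ≢ j →
    Perm u → len u ≡ 2 → simple i ≤B u → simple j ≤B u →
    Perm v → len v ≡ 2 → simple i ≤B v → simple j ≤B v → u ≢ v → v ≡ inv u
  common-lower⇒inv {i = i} {j} i≢j pu lu p q pv lv p′ q′ ne
    with two-simples-below pu lu i≢j p q | two-simples-below pv lv i≢j p′ q′
  ... | inj₁ r | inj₁ t = ⊥-elim (ne (trans r (sym t)))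
  ... | inj₂ r | inj₂ t = ⊥-elim (ne (trans r (sym t)))
  ... | inj₁ r | inj₂ t = trans t (sym (trans (cong inv r) (inv-simple∙simple i j)))
  ... | inj₂ r | inj₁ t = trans t (sym (trans (cong inv r) (inv-simple∙simple j i)))

-- Contains all pairs of distinct vertices of `Γ_ w` with two common neighbours. Since the
-- isomorphism may exchange levels, elements of length two are included; the only possible partner
-- of `u` is its inverse.
Pair : ∀ {m} → Bool × Word (suc m) → Bool × Word (suc m) → Set
Pair {m} x y = (∃₂ λ i j → x ≡ (false , simple i) × y ≡ (false , simple j) × DynkinAdj i j)
         ⊎ (Σ (Word (suc m)) λ u → x ≡ (true , u) × y ≡ (true , inv u))

-- On atoms the pairs follow the Dynkin path, where a vertex has at most two neighbours; on the
-- other level a vertex has at most one partner.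
no-claw : ∀ {m} {c x y z : Bool × Word (suc m)} → Pair c x → Pair c y → Pair c z → x ≢ y → x ≢ z → y ≢ z → ⊥
no-claw (inj₂ (_ , refl , refl)) (inj₂ (_ , refl , refl)) _ xy _ _ = xy refl
no-claw (inj₂ (_ , refl , _)) (inj₁ (_ , _ , () , _)) _ _ _ _
no-claw (inj₁ (_ , _ , refl , _)) (inj₂ (_ , () , _)) _ _ _ _
no-claw (inj₁ (_ , _ , refl , _)) (inj₁ _) (inj₂ (_ , () , _)) _ _ _
no-claw (inj₁ (i , a , refl , refl , p)) (inj₁ (i′ , b , q , refl , p′)) (inj₁ (i″ , c , r , refl , p″)) ab ac bc
  with simple-injective (cong proj₂ q) | simple-injective (cong proj₂ r)
... | refl | refl with dynkin-three p p′ p″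
...   | inj₁ refl = ab refl
...   | inj₂ (inj₁ refl) = ac refl
...   | inj₂ (inj₂ refl) = bc refl

no-square : ∀ {m} {x y z t : Bool × Word (suc m)} → Pair x y → Pair y z → Pair z t → Pair t x → x ≢ z → y ≢ t → Perm (proj₂ x) → ⊥
no-square (inj₂ (u , refl , refl)) (inj₂ (_ , refl , refl)) _ _ xz _ pu = xz (cong (true ,_) (sym (inv-involutive pu)))
no-square (inj₂ (u , refl , refl)) (inj₁ (_ , _ , () , _)) _ _ _ _ _
no-square (inj₁ (_ , _ , refl , refl , _)) (inj₂ (_ , () , _)) _ _ _ _ _
no-square (inj₁ _) (inj₁ (_ , _ , _ , refl , _)) (inj₂ (_ , () , _)) _ _ _ _
no-square (inj₁ _) (inj₁ _) (inj₁ (_ , _ , _ , refl , _)) (inj₂ (_ , () , _)) _ _ _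
no-square (inj₁ (a , b , refl , refl , p)) (inj₁ (b′ , c , q , refl , p′)) (inj₁ (c′ , d , r , refl , p″)) (inj₁ (d′ , a′ , t , t′ , p‴)) xz yt _
  with simple-injective (cong proj₂ q) | simple-injective (cong proj₂ r) | simple-injective (cong proj₂ t) | simple-injective (cong proj₂ t′)
... | refl | refl | refl | refl with dynkin-square p p′ p″ p‴
...   | inj₁ refl = xz refl
...   | inj₂ refl = yt refl

corank₁ : ∀ {n} (u w : Word n) → ℓ w ≡ suc (ℓ u) → ℓ u + 1 ≡ ℓ w
corank₁ u w q = trans (ℕₚ.+-comm (ℓ u) 1) (sym q)

corank₂ : ∀ {n} (x u w : Word n) → ℓ u ≡ suc (ℓ x) → ℓ w ≡ suc (ℓ u) → ℓ x + 2 ≡ ℓ w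
corank₂ x u w p q = trans (ℕₚ.+-comm (ℓ x) 2) (trans (cong ℕ.suc (sym p)) (sym q))

record Doubled {V : Set} (G : Graph V) (x y : V) : Set where
  constructor doubled
  field
    {a a′} : V
    vert   : Vert G a
    vert′  : Vert G a′
    a≢a′   : a ≢ a′
    x-a    : Adj G x a
    y-a    : Adj G y a
    x-a′   : Adj G x a′
    y-a′   : Adj G y a′

doubled-sym : ∀ {V : Set} {G : Graph V} {x y} → Doubled G x y → Doubled G y x
doubled-sym (doubled v v′ ne x y x′ y′) = doubled v v′ ne y x y′ x′

Crossing : ∀ {m} → Word (suc m) → Fin m → Set
Crossing w k = ∃₂ λ a b → a < Fin.suc k × Fin.suc k ≤ b × w ! b < w ! a

crossing? : ∀ {m} (w : Word (suc m)) k → Dec (Crossing w k)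
crossing? w k = any? λ a → any? λ b → (a <? suc k) ×-dec (suc k Finₚ.≤? b) ×-dec (w ! b <? w ! a)

opaque
  -- The permutations with no inversion across `k` form a lower ideal, and `simple k` is not one of
  -- them.
  simple≤⇒crossing : ∀ {m} {w : Word (suc m)} {k} → Perm w → simple k ≤B w → Crossing w k
  simple≤⇒crossing {m} {w} {k} pw le with crossing? w k
  ... | yes c = c
  ... | no ¬c = ⊥-elim (down-closed (λ v → ¬ Crossing v k) lower pw ¬c le
          (inject₁ k , suc k , inject₁<suc k , ≤-refl ,
           subst₂ _<_ (sym (tr-ʳ (inject₁ k) (suc k))) (sym (tr-ˡ (inject₁ k) (suc k))) (inject₁<suc k)))
    where
    -- If no inversion crosses k, a swap along an inversion moves no position across k.
    lower : ∀ {v} i j → Perm v → ¬ Crossing v k → i < j → v ! j < v ! i → ¬ Crossing (v ∙ tr i j) k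
    lower {v} i j pv ¬c i<j lt (a , b , a≤k , k<b , q) = ¬c
      ( tr i j ! a , tr i j ! b , left-side a a≤k , right-side b k<b
      , subst₂ _<_ (∙-! v (tr i j) b) (∙-! v (tr i j) a) q)
      where
      left-side : ∀ a → a < Fin.suc k → (tr i j ! a) < Fin.suc k
      left-side a a≤k with (suc k) Finₚ.≤? j
      ... | no j≤k = tr-cases {P = λ x y → x < Fin.suc k → y < Fin.suc k} i j (λ _ → ≰⇒> j≤k)
              (λ _ → <-trans i<j (≰⇒> j≤k)) (λ _ _ _ p → p) a a≤k
      ... | yes k<j with i <? Fin.suc k
      ...   | yes i≤k = ⊥-elim (¬c (i , j , i≤k , k<j , lt))
      ...   | no k<i = tr-cases {P = λ x y → x < Fin.suc k → y < Fin.suc k} i j (λ p → ⊥-elim (k<i p))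
              (λ p → ⊥-elim (<⇒≱ p k<j)) (λ _ _ _ p → p) a a≤k
      right-side : ∀ b → Fin.suc k ≤ b → Fin.suc k ≤ (tr i j ! b)
      right-side b k<b with (suc k) Finₚ.≤? j
      ... | no j≤k = tr-cases {P = λ x y → Fin.suc k ≤ x → Fin.suc k ≤ y} i j
              (λ p → ⊥-elim (j≤k (≤-trans p (<⇒≤ i<j)))) (λ p → ⊥-elim (j≤k p)) (λ _ _ _ p → p) b k<b
      ... | yes k<j with i <? Fin.suc k
      ...   | yes i≤k = ⊥-elim (¬c (i , j , i≤k , k<j , lt))
      ...   | no k<i = tr-cases {P = λ x y → Fin.suc k ≤ x → Fin.suc k ≤ y} i j (λ _ → k<j)
              (λ _ → ≮⇒≥ k<i) (λ _ _ _ p → p) b k<b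

module Isomorphism {m} {w : Word (suc m)} (pw : Perm w) (iso : Isomorphic (Γ_ w) (Γ^ w)) where

  private
    V : Set
    V = Bool × Word (suc m)
    G H : Graph V
    G = Γ_ w
    H = Γ^ w
    f : V → V
    f = proj₁ iso

  pull : ∀ {y} → Vert H y → Σ V λ x → Vert G x × f x ≡ y
  pull = proj₁ (proj₂ (proj₂ (proj₂ iso))) _

  f-adj : ∀ {x y} → Vert G x → Vert G y → Adj G x y → Adj H (f x) (f y)
  f-adj p q = proj₁ (proj₂ (proj₂ (proj₂ (proj₂ iso))) _ _ p q)

  f-adj⁻¹ : ∀ {x y} → Vert G x → Vert G y → Adj H (f x) (f y) → Adj G x y
  f-adj⁻¹ p q = proj₂ (proj₂ (proj₂ (proj₂ (proj₂ iso))) _ _ p q)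

  pull-doubled : ∀ {x y} → Vert G x → Vert G y → Doubled H (f x) (f y) → Doubled G x y
  pull-doubled vx vy (doubled v v′ ne p q p′ q′) with pull v | pull v′
  ... | a , va , refl | a′ , va′ , refl = doubled va va′ (ne ∘ cong f)
        (f-adj⁻¹ vx va p) (f-adj⁻¹ vy va q) (f-adj⁻¹ vx va′ p′) (f-adj⁻¹ vy va′ q′)

  atom-simple : ∀ {u} → Vert G (false , u) → ∃ λ k → u ≡ simple k
  atom-simple {u} (le , q) = len≡1⇒simple (perm-≤ pw le) (trans (len≡ℓ u) q)

  simple-atom : ∀ {k} → simple k ≤B w → Vert G (false , simple k)
  simple-atom {k} le = le , trans (sym (len≡ℓ (simple k))) (len-simple k)

  len-2 : ∀ {u} → Vert G (true , u) → len u ≡ 2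
  len-2 {u} (_ , q) = trans (len≡ℓ u) q

  adj⇒≤ : ∀ {u v} → Vert G (false , u) → Vert G (true , v) → (u ⋖ v) ⊎ (v ⋖ u) → u ≤B v
  adj⇒≤ _ _ (inj₁ ((le , _) , _)) = le
  adj⇒≤ (_ , p) (_ , q) (inj₂ (lt , _)) = ⊥-elim (<⇒≱ (ℓ-strict lt) (≤-trans (≤-reflexive p) (≤-trans (ℕₚ.n≤1+n 1) (≤-reflexive (sym q)))))

  ≤⇒⋖ : ∀ {u v} → Vert G (false , u) → Vert G (true , v) → u ≤B v → u ⋖ v
  ≤⇒⋖ (_ , p) (_ , q) le = ℓ-cover⇒⋖ le (trans q (cong suc (sym p)))

  swap⊎ : ∀ {A B : Set} → A ⊎ B → B ⊎ A
  swap⊎ = [ inj₂ , inj₁ ]′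

  doubled-pair : ∀ {x y} → Vert G x → Vert G y → x ≢ y → Doubled G x y → Pair x y
  doubled-pair {false , u} {false , v} vx vy ne (doubled {false , _} {_} _ _ _ () _ _ _)
  doubled-pair {false , u} {false , v} vx vy ne (doubled {true , _} {false , _} _ _ _ _ _ () _)
  doubled-pair {false , u} {false , v} vx vy ne (doubled {true , a} {true , a′} va va′ a≢a′ p q p′ q′) =
    let (i , r) = atom-simple vx
        (j , t) = atom-simple vy
        below : ∀ {u v k} → u ≡ simple k → u ≤B v → simple k ≤B v
        below {v = v} r = subst (_≤B v) r
    in inj₁ (i , j , cong (false ,_) r , cong (false ,_) t ,
         common-upper⇒adjacent (λ i≡j → ne (cong (false ,_) (trans r (trans (cong simple i≡j) (sym t)))))
           (perm-≤ pw (proj₁ va)) (len-2 va) (below r (adj⇒≤ vx va p)) (below t (adj⇒≤ vy va q))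
           (perm-≤ pw (proj₁ va′)) (len-2 va′) (below r (adj⇒≤ vx va′ p′)) (below t (adj⇒≤ vy va′ q′))
           (a≢a′ ∘ cong (true ,_)))
  doubled-pair {false , u} {true , v} vx vy ne (doubled {false , _} {_} _ _ _ () _ _ _)
  doubled-pair {false , u} {true , v} vx vy ne (doubled {true , _} {_} _ _ _ _ () _ _)
  doubled-pair {true , u} {false , v} vx vy ne (doubled {false , _} {_} _ _ _ _ () _ _)
  doubled-pair {true , u} {false , v} vx vy ne (doubled {true , _} {_} _ _ _ () _ _ _)
  doubled-pair {true , u} {true , v} vx vy ne (doubled {true , _} {_} _ _ _ () _ _ _)
  doubled-pair {true , u} {true , v} vx vy ne (doubled {false , _} {true , _} _ _ _ _ _ () _)
  doubled-pair {true , u} {true , v} vx vy ne (doubled {false , a} {false , a′} va va′ a≢a′ p q p′ q′) =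
    let (i , r) = atom-simple va
        (j , t) = atom-simple va′
        below : ∀ {u v k} → u ≡ simple k → u ≤B v → simple k ≤B v
        below {v = v} r = subst (_≤B v) r
    in inj₂ (u , refl , cong (true ,_)
         (common-lower⇒inv (λ i≡j → a≢a′ (cong (false ,_) (trans r (trans (cong simple i≡j) (sym t)))))
           (perm-≤ pw (proj₁ vx)) (len-2 vx) (below r (adj⇒≤ va vx (swap⊎ p))) (below t (adj⇒≤ va′ vx (swap⊎ p′)))
           (perm-≤ pw (proj₁ vy)) (len-2 vy) (below r (adj⇒≤ va vy (swap⊎ q))) (below t (adj⇒≤ va′ vy (swap⊎ q′)))
           (ne ∘ cong (true ,_))))

  coatom : ∀ {e} → Edge (Inv w) e → Vert H (false , swapped w e)
  coatom {i , j} c@((i<j , lt) , _) = step-down pw i<j lt ◅ ε , corank₁ (w ∙ tr i j) w (cov-ℓ pw c)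

  coatom-doubled : Avoids4231 w → ∀ {e e′} → Edge (Inv w) e → Edge (Inv w) e′ → Linked e e′ →
    Doubled H (false , swapped w e) (false , swapped w e′)
  coatom-doubled av {a , c} {_ , d} p q down = result (consecutive-covers pw av p q)
    where
    result : CommonLower (w ∙ tr a c) (w ∙ tr c d) → Doubled H (false , w ∙ tr a c) (false , w ∙ tr c d)
    result (commonLower {x} {y} x₁ x₂ y₁ y₂ x≢y ℓx ℓy) = doubled {a = true , x} {true , y} (vert x₁ ℓx) (vert y₁ ℓy) (x≢y ∘ cong proj₂)
      (inj₂ x₁) (inj₂ x₂) (inj₂ y₁) (inj₂ y₂)
      where
      vert : ∀ {x} → x ⋖ (w ∙ tr a c) → ℓ (w ∙ tr a c) ≡ suc (ℓ x) → Vert H (true , x)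
      vert {x} ((le , _) , _) q = le ◅◅ proj₁ (coatom p) , corank₂ x (w ∙ tr a c) w q (cov-ℓ pw p)
  coatom-doubled av p q up = doubled-sym {G = H} (coatom-doubled av q p down)

  linked⇒≢ : ∀ {e e′} → Edge (Inv w) e → Edge (Inv w) e′ → Linked e e′ → e ≢ e′
  linked⇒≢ ((lt , _) , _) _ down q = <⇒≢ lt (cong proj₁ q)
  linked⇒≢ ((lt , _) , _) _ up q = <⇒≢ lt (sym (cong proj₂ q))

  swapped≢ : ∀ {e e′} → Edge (Inv w) e → Edge (Inv w) e′ → e ≢ e′ → (false , swapped w e) ≢ (false , swapped w e′)
  swapped≢ ((p , _) , _) ((q , _) , _) ne r = ne (swapped-injective pw p q (cong proj₂ r))

  record Preimage (e : Fin (suc m) × Fin (suc m)) : Set where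
    constructor preimageOf
    field
      {x} : V
      vx  : Vert G x
      fx  : f x ≡ (false , swapped w e)

  pull-coatom : ∀ {e} → Edge (Inv w) e → Preimage e
  pull-coatom c = let (_ , v , q) = pull (coatom c) in preimageOf v q

  preimage≢ : ∀ {e e′} → Edge (Inv w) e → Edge (Inv w) e′ → e ≢ e′ → (P : Preimage e) (Q : Preimage e′) →
    Preimage.x P ≢ Preimage.x Q
  preimage≢ p q ne (preimageOf _ r) (preimageOf _ r′) t =
    swapped≢ p q ne (trans (sym r) (trans (cong f t) r′))

  linked-pair : Avoids4231 w → ∀ {e e′} → Edge (Inv w) e → Edge (Inv w) e′ → Linked e e′ →
    (P : Preimage e) (Q : Preimage e′) → Pair (Preimage.x P) (Preimage.x Q)
  linked-pair av p q l P@(preimageOf vx fx) Q@(preimageOf vy fy) = doubled-pair vx vy (preimage≢ p q (linked⇒≢ p q l) P Q)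
    (pull-doubled vx vy (subst₂ (Doubled H) (sym fx) (sym fy) (coatom-doubled av p q l)))

  claw-⊥ : Avoids4231 w → Claw (Inv w) → ⊥
  claw-⊥ av (claw c e₁ e₂ e₃ l₁ l₂ l₃ n₁₂ n₁₃ n₂₃) = no-claw
    (linked-pair av c e₁ l₁ C P₁) (linked-pair av c e₂ l₂ C P₂) (linked-pair av c e₃ l₃ C P₃)
    (preimage≢ e₁ e₂ n₁₂ P₁ P₂) (preimage≢ e₁ e₃ n₁₃ P₁ P₃) (preimage≢ e₂ e₃ n₂₃ P₂ P₃)
    where
    C = pull-coatom c
    P₁ = pull-coatom e₁
    P₂ = pull-coatom e₂
    P₃ = pull-coatom e₃

  square-⊥ : Avoids4231 w → Square (Inv w) → ⊥
  square-⊥ av (square e₁ e₂ e₃ e₄ l₁ l₂ l₃ l₄ n₁₃ n₂₄) = no-square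
    (linked-pair av e₁ e₂ l₁ P₁ P₂) (linked-pair av e₂ e₃ l₂ P₂ P₃) (linked-pair av e₃ e₄ l₃ P₃ P₄) (linked-pair av e₄ e₁ l₄ P₄ P₁)
    (preimage≢ e₁ e₃ n₁₃ P₁ P₃) (preimage≢ e₂ e₄ n₂₄ P₂ P₄) (vertex-perm (Preimage.vx P₁))
    where
    P₁ = pull-coatom e₁
    P₂ = pull-coatom e₂
    P₃ = pull-coatom e₃
    P₄ = pull-coatom e₄
    vertex-perm : ∀ {x} → Vert G x → Perm (proj₂ x)
    vertex-perm {false , _} (le , _) = perm-≤ pw le
    vertex-perm {true  , _} (le , _) = perm-≤ pw le

-- Counting atoms against coatoms

opaque
  three-simples-below : ∀ {m} {u : Word (suc m)} {i j k} → Perm u → len u ≡ 2 →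
    simple i ≤B u → simple j ≤B u → simple k ≤B u → i ≡ j ⊎ i ≡ k ⊎ j ≡ k
  three-simples-below pu q p p′ p″ with len≡2⇒simple∙simple pu q
  ... | a , b , _ , refl with simple-≤-∙ p | simple-≤-∙ p′ | simple-≤-∙ p″
  ...   | inj₁ r | inj₁ t | _      = inj₁ (trans r (sym t))
  ...   | inj₂ r | inj₂ t | _      = inj₁ (trans r (sym t))
  ...   | inj₁ r | inj₂ _ | inj₁ t = inj₂ (inj₁ (trans r (sym t)))
  ...   | inj₂ r | inj₁ _ | inj₂ t = inj₂ (inj₁ (trans r (sym t)))
  ...   | inj₁ _ | inj₂ r | inj₂ t = inj₂ (inj₂ (trans r (sym t)))
  ...   | inj₂ _ | inj₁ r | inj₁ t = inj₂ (inj₂ (trans r (sym t)))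

opaque
  simple-below : ∀ {m} {u : Word (suc m)} → Perm u → len u ≡ 2 → ∃ λ a → simple a ≤B u
  simple-below pu q with len≡2⇒simple∙simple pu q
  ... | a , b , a≢b , refl = a , simpleˡ-≤ a≢b

opaque
  simples-join-at : ∀ {m} {w : Word (suc m)} {i j} → Perm w → i ≢ j → simple i ≤B w → simple j ≤B w →
    ∃ λ u → u ≤B w × len u ≡ 2 × simple i ≤B u × simple j ≤B u
  simples-join-at {i = i} {j} pw i≢j p q with simples-join pw i≢j p q
  ... | inj₁ le = simple i ∙ simple j , le , len-simple∙simple i≢j , simpleˡ-≤ i≢j , simpleʳ-≤ i≢j
  ... | inj₂ le = simple j ∙ simple i , le , len-simple∙simple (i≢j ∘ sym) , simpleʳ-≤ (i≢j ∘ sym) , simpleˡ-≤ (i≢j ∘ sym)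

bool-⊥ : ∀ {a b : Bool} → a ≢ b → b ≢ false → a ≢ false → ⊥
bool-⊥ {false}         _ _ r = r refl
bool-⊥ {true}  {false} _ q _ = q refl
bool-⊥ {true}  {true}  p _ _ = p refl

levels-≢ : ∀ {n} {w : Word n} {A B} x y → Adj (bipartiteLevels w A B) x y → proj₁ x ≢ proj₁ y
levels-≢ (false , _) (true , _) _ ()
levels-≢ (true , _) (false , _) _ ()

module Counting {m} {w : Word (suc m)} (pw : Perm w) (iso : Isomorphic (Γ_ w) (Γ^ w)) (sup : Superfluous w) where

  open Isomorphism pw iso
  open Superfluous sup

  private
    V : Set
    V = Bool × Word (suc m)
    G H : Graph V
    G = Γ_ w
    H = Γ^ w
    f : V → V
    f = proj₁ iso
    v : Word (suc m)
    v = w ∙ tr x l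
    pv : Perm v
    pv = perm-∙ pw (perm-tr x l)
    v-vert : Vert H (false , v)
    v-vert = coatom {x , l} cover

  lower-vert : ∀ e → Edge (Inv v) e → Vert H (true , swapped v e)
  lower-vert (i , j) c = proj₁ (proj₁ (cov-⋖ pv c)) ◅◅ proj₁ v-vert ,
    corank₂ (v ∙ tr i j) v w (cov-ℓ pv c) (cov-ℓ pw cover)

  Neighbour : V → Fin (suc m) × Fin (suc m) → Set
  Neighbour y e = Σ V λ z → Vert G z × f z ≡ (true , swapped v e) × Adj G y z

  neighbour : ∀ {y} → Vert G y → f y ≡ (false , v) → ∀ e → Edge (Inv v) e → Neighbour y e
  neighbour {y} vy fy e@(i , j) c = let (z , vz , fz) = pull (lower-vert e c) in
    z , vz , fz , f-adj⁻¹ vy vz (subst₂ (Adj H) (sym fy) (sym fz) (inj₂ (cov-⋖ pv c)))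

  top-⊥ : ∀ {t} → Vert G (true , t) → Neighbour (true , t) e₁ → Neighbour (true , t) e₂ → Neighbour (true , t) e₃ → ⊥
  top-⊥ vt ((true , _) , _ , _ , ()) _ _
  top-⊥ vt ((false , _) , _) ((true , _) , _ , _ , ()) _
  top-⊥ vt ((false , _) , _) ((false , _) , _) ((true , _) , _ , _ , ())
  top-⊥ {t} vt ((false , z₁) , v₁ , f₁ , a₁) ((false , z₂) , v₂ , f₂ , a₂) ((false , z₃) , v₃ , f₃ , a₃) =
    decide (three-simples-below (perm-≤ pw (proj₁ vt)) (len-2 vt) (below v₁ a₁) (below v₂ a₂) (below v₃ a₃))
    where
    k : ∀ {z} → Vert G (false , z) → Fin m
    k vz = proj₁ (atom-simple vz)
    below : ∀ {z} (vz : Vert G (false , z)) → (t ⋖ z) ⊎ (z ⋖ t) → simple (k vz) ≤B t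
    below vz a = subst (_≤B t) (proj₂ (atom-simple vz)) (adj⇒≤ vz vt (swap⊎ a))
    clash : ∀ {z z′ e e′} (vz : Vert G (false , z)) (vz′ : Vert G (false , z′)) → k vz ≡ k vz′ →
            f (false , z) ≡ (true , swapped v e) → f (false , z′) ≡ (true , swapped v e′) →
            Edge (Inv v) e → Edge (Inv v) e′ → e ≢ e′ → ⊥
    clash {z} {z′} vz vz′ q fz fz′ ((p , _) , _) ((p′ , _) , _) ne = ne (swapped-injective pv p p′ (cong proj₂ (trans (sym fz) (trans (cong (λ t → f (false , t)) z≡z′) fz′))))
      where
      z≡z′ : z ≡ z′
      z≡z′ = trans (proj₂ (atom-simple vz)) (trans (cong simple q) (sym (proj₂ (atom-simple vz′))))
    decide : k v₁ ≡ k v₂ ⊎ k v₁ ≡ k v₃ ⊎ k v₂ ≡ k v₃ → ⊥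
    decide (inj₁ q)        = clash {e = e₁} {e₂} v₁ v₂ q f₁ f₂ edge₁ edge₂ e₁≢e₂
    decide (inj₂ (inj₁ q)) = clash {e = e₁} {e₃} v₁ v₃ q f₁ f₃ edge₁ edge₃ e₁≢e₃
    decide (inj₂ (inj₂ q)) = clash {e = e₂} {e₃} v₂ v₃ q f₂ f₃ edge₂ edge₃ e₂≢e₃

  AtomOver : Word (suc m) → Set
  AtomOver y = Σ (Fin m) λ k → simple k ≤B w × f (false , simple k) ≡ (false , y)

  atomOver : ∀ {u y} → Vert G (false , u) → f (false , u) ≡ (false , y) → AtomOver y
  atomOver vu fu = let (k , q) = atom-simple vu in
    k , subst (_≤B w) q (proj₁ vu) , trans (cong (λ t → f (false , t)) (sym q)) fu

  base : AtomOver v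
  base = from (pull v-vert)
    where
    from : Σ V (λ y → Vert G y × f y ≡ (false , v)) → AtomOver v
    from ((false , u) , vu , fu) = atomOver vu fu
    from ((true , t) , vt , ft) = ⊥-elim (top-⊥ vt
      (neighbour vt ft e₁ edge₁) (neighbour vt ft e₂ edge₂) (neighbour vt ft e₃ edge₃))

  f-levels : ∀ {a b} → Vert G a → Vert G b → Adj G a b → proj₁ (f a) ≢ proj₁ (f b)
  f-levels {a} {b} va vb adj = levels-≢ (f a) (f b) (f-adj va vb adj)

  -- Take an atom `a` below `t` and the atom `k` over the surplus coatom. Edges change level, so the
  -- image of `a` is not on the level of coatoms while that of `k` is, and the image of a common
  -- upper neighbour of `a` and `k` could be on neither level.
  top-not-coatom : ∀ {t y} → Vert G (true , t) → f (true , t) ≡ (false , y) → ⊥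
  top-not-coatom {t} {y} vt ft with simple-below (perm-≤ pw (proj₁ vt)) (len-2 vt) | base
  ... | a , a≤t | k , k≤w , fk = decide (a ≟ k)
    where
    a≤w : simple a ≤B w
    a≤w = a≤t ◅◅ proj₁ vt
    va : Vert G (false , simple a)
    va = simple-atom a≤w
    vk : Vert G (false , simple k)
    vk = simple-atom k≤w
    fa≢false : proj₁ (f (false , simple a)) ≢ false
    fa≢false q = f-levels va vt (inj₁ (≤⇒⋖ va vt a≤t)) (trans q (sym (cong proj₁ ft)))
    decide : Dec (a ≡ k) → ⊥
    decide (yes q) = fa≢false (trans (cong (λ i → proj₁ (f (false , simple i))) q) (cong proj₁ fk))
    decide (no a≢k) = let (u , u≤w , lu , a≤u , k≤u) = simples-join-at pw a≢k a≤w k≤w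
                          vu : Vert G (true , u)
                          vu = u≤w , trans (sym (len≡ℓ u)) lu
                      in bool-⊥ (f-levels {false , simple a} {true , u} va vu (inj₁ (≤⇒⋖ va vu a≤u)))
                           (λ q → f-levels {false , simple k} {true , u} vk vu (inj₁ (≤⇒⋖ vk vu k≤u)) (trans (cong proj₁ fk) (sym q)))
                           fa≢false

  atomOver-coatom : ∀ {y} → Vert H (false , y) → AtomOver y
  atomOver-coatom {y} vy = from (pull vy)
    where
    from : Σ V (λ z → Vert G z × f z ≡ (false , y)) → AtomOver y
    from ((false , u) , vu , fu) = atomOver vu fu
    from ((true , t) , vt , ft) = ⊥-elim (top-not-coatom vt ft)

  -- The graph of an injection of `suc m` elements into `m` generators: `zero` stands for the
  -- surplus coatom, `suc k` for the tagged cover across `k`, each sent to the atom over it. Sending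
  -- an uncrossed `k` to itself avoids enumerating the support, and there is no collision because
  -- the generator of an atom below `w` is always crossed.
  data Image : Fin (suc m) → Fin m → Set where
    extra  : ∀ {i} → f (false , simple i) ≡ (false , v) → Crossing w i → Image zero i
    tagged : ∀ {k x l i} → Cov w x l → Tag w (suc k) x l → f (false , simple i) ≡ (false , w ∙ tr x l) →
             Crossing w i → Image (suc k) i
    fixed  : ∀ {k} → ¬ Crossing w k → Image (suc k) k

  image : ∀ a → ∃ (Image a)
  image zero = let (k , k≤w , fk) = base in k , extra fk (simple≤⇒crossing pw k≤w)
  image (suc k) = from (crossing? w k)
    where
    from : Dec (Crossing w k) → ∃ (Image (suc k))
    from (no ¬c) = k , fixed ¬c
    from (yes (a , b , a<k , k≤b , lt)) =
      let (x , l , c , t) = tagged-cover pw a<k k≤b lt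
          (i , i≤w , fi) = atomOver-coatom (coatom {x , l} c)
      in i , tagged c t fi (simple≤⇒crossing pw i≤w)

  same-edge : ∀ {i x l x′ l′} → Cov w x l → Cov w x′ l′ → f (false , simple i) ≡ (false , w ∙ tr x l) →
    f (false , simple i) ≡ (false , w ∙ tr x′ l′) → (x , l) ≡ (x′ , l′)
  same-edge ((p , _) , _) ((p′ , _) , _) q q′ = swapped-injective pw p p′ (cong proj₂ (trans (sym q) q′))

  image-injective : ∀ {a b i} → Image a i → Image b i → a ≡ b
  image-injective (extra _ _) (extra _ _) = refl
  image-injective (extra q _) (tagged c t q′ _) = ⊥-elim (clash (same-edge cover c q q′) t)
    where
    clash : ∀ {k x′ l′} → (x , l) ≡ (x′ , l′) → Tag w k x′ l′ → ⊥
    clash refl t = untagged _ t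
  image-injective (extra _ c) (fixed ¬c) = ⊥-elim (¬c c)
  image-injective (tagged c t q _) (extra q′ _) = ⊥-elim (clash (same-edge cover c q′ q) t)
    where
    clash : ∀ {k x′ l′} → (x , l) ≡ (x′ , l′) → Tag w k x′ l′ → ⊥
    clash refl t = untagged _ t
  image-injective (tagged {k} c t q _) (tagged {k′} c′ t′ q′ _) = unify (proj₂ (proj₁ c)) (same-edge c c′ q q′) t t′
    where
    unify : ∀ {x l x′ l′} → w ! l < w ! x → (x , l) ≡ (x′ , l′) →
      Tag w (suc k) x l → Tag w (suc k′) x′ l′ → Fin.suc k ≡ suc k′
    unify lt refl t t′ = tag-injective lt t t′
  image-injective (tagged _ _ _ c) (fixed ¬c) = ⊥-elim (¬c c)
  image-injective (fixed ¬c) (extra _ c) = ⊥-elim (¬c c)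
  image-injective (fixed ¬c) (tagged _ _ _ c) = ⊥-elim (¬c c)
  image-injective (fixed _) (fixed _) = refl

  superfluous-⊥ : ⊥
  superfluous-⊥ = ℕₚ.1+n≰n (Finₚ.injective⇒≤ {f = λ a → proj₁ (image a)}
    λ {a} {b} q → image-injective (proj₂ (image a)) (subst (Image b) (sym q) (proj₂ (image b))))

-- Occurrences of the patterns as forbidden configurations

module Occurrence {n k} {w : Word n} {π : Word k} (occ : Contains w π) where

  at : Fin k → Fin n
  at = proj₁ occ

  pos : ∀ a b → {True (a <? b)} → at a < at b
  pos a b {p} = proj₁ (proj₂ occ) a b (toWitness p)

  val : ∀ a b → {True (lookup π a <? lookup π b)} → w ! at a < w ! at b
  val a b {p} = proj₂ (proj₂ (proj₂ occ) a b) (toWitness p)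

increasing⇒∥ : ∀ {n} (w : Word n) {a b} → a < b → w ! a < w ! b → HasseDiagram._∥_ (inv-spo w) (inv? w) a b
increasing⇒∥ w a<b lt = <⇒≢ a<b , (λ (_ , gt) → <-asym lt gt) , λ (gt , _) → <-asym a<b gt

AvoidsAll : ∀ {n} → Word n → Set
AvoidsAll w = Avoids w p3412 × Avoids w p4231 × Avoids w p34521 × Avoids w p45321 × Avoids w p54123 × Avoids w p54312

module _ {m} {w : Word (suc m)} (pw : Perm w) (iso : Isomorphic (Γ_ w) (Γ^ w)) where

  open HasseDiagram (inv-spo w) (inv? w)
  open HasseDual (inv-spo w) (inv? w) hiding (module Op)
  open Isomorphism pw iso

  isomorphic⇒avoids4231 : Avoids4231 w
  isomorphic⇒avoids4231 zx xj jl lx xj′ jz′ = Counting.superfluous-⊥ pw iso (superfluous-4231 pw zx xj jl lx xj′ jz′)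

  -- In the inversion order 34521 is a chain of two with three incomparable elements on top, and
  -- 45321 a chain of three with two on top; 54123 and 54312 are these turned upside down.
  isomorphic⇒avoids : AvoidsAll w
  isomorphic⇒avoids = c3412 , c4231 , c34521 , c45321 , c54123 , c54312
    where
    av : Avoids4231 w
    av = isomorphic⇒avoids4231
    c4231 : Avoids w p4231
    c4231 occ = av (pos (# 0) (# 1)) (pos (# 1) (# 2)) (pos (# 2) (# 3)) (val (# 3) (# 1)) (val (# 1) (# 2)) (val (# 2) (# 0))
      where open Occurrence {w = w} {p4231} occ
    c3412 : Avoids w p3412
    c3412 occ = [ Counting.superfluous-⊥ pw iso , centred ]′
      (superfluous-3412 pw (pos (# 0) (# 1)) (pos (# 1) (# 2)) (pos (# 2) (# 3)) (val (# 2) (# 3)) (val (# 3) (# 0)) (val (# 0) (# 1)))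
      where
      open Occurrence {w = w} {p3412} occ
      centred : Hourglass w → ⊥
      centred (hourglass a<b b<c c<d d<f wd<wf wf<wc wc<wa wa<wb) = [ claw-⊥ av , square-⊥ av ]′
        (HasseDual.hourglass (inv-spo w) (inv? w)
          (increasing⇒∥ w a<b wa<wb) (increasing⇒∥ w d<f wd<wf)
          (<-trans a<b b<c , wc<wa) (b<c , <-trans wc<wa wa<wb)
          (c<d , <-trans wd<wf wf<wc) (<-trans c<d d<f , wf<wc))
    c34521 : Avoids w p34521
    c34521 occ = claw-⊥ av (claw-three
      (increasing⇒∥ w (pos (# 0) (# 1)) (val (# 0) (# 1))) (increasing⇒∥ w (pos (# 0) (# 2)) (val (# 0) (# 2)))
      (increasing⇒∥ w (pos (# 1) (# 2)) (val (# 1) (# 2)))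
      (pos (# 0) (# 3) , val (# 3) (# 0)) (pos (# 1) (# 3) , val (# 3) (# 1)) (pos (# 2) (# 3) , val (# 3) (# 2))
      (pos (# 3) (# 4) , val (# 4) (# 3)))
      where open Occurrence {w = w} {p34521} occ
    c45321 : Avoids w p45321
    c45321 occ = claw-⊥ av (claw-chain (increasing⇒∥ w (pos (# 0) (# 1)) (val (# 0) (# 1)))
      (pos (# 0) (# 2) , val (# 2) (# 0)) (pos (# 1) (# 2) , val (# 2) (# 1))
      (pos (# 2) (# 3) , val (# 3) (# 2)) (pos (# 3) (# 4) , val (# 4) (# 3)))
      where open Occurrence {w = w} {p45321} occ
    c54123 : Avoids w p54123
    c54123 occ = claw-⊥ av (claw-threeᵒ
      (increasing⇒∥ w (pos (# 2) (# 3)) (val (# 2) (# 3))) (increasing⇒∥ w (pos (# 2) (# 4)) (val (# 2) (# 4)))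
      (increasing⇒∥ w (pos (# 3) (# 4)) (val (# 3) (# 4)))
      (pos (# 1) (# 2) , val (# 2) (# 1)) (pos (# 1) (# 3) , val (# 3) (# 1)) (pos (# 1) (# 4) , val (# 4) (# 1))
      (pos (# 0) (# 1) , val (# 1) (# 0)))
      where open Occurrence {w = w} {p54123} occ
    c54312 : Avoids w p54312
    c54312 occ = claw-⊥ av (claw-chainᵒ (increasing⇒∥ w (pos (# 3) (# 4)) (val (# 3) (# 4)))
      (pos (# 2) (# 3) , val (# 3) (# 2)) (pos (# 2) (# 4) , val (# 4) (# 2))
      (pos (# 1) (# 2) , val (# 2) (# 1)) (pos (# 0) (# 1) , val (# 1) (# 0)))
      where open Occurrence {w = w} {p54312} occ

-- Reversals of intervals

module _ {m : ℕ} {G : Fin m → Set} (G? : ∀ k → Dec (G k)) where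

  subset : Subset m
  subset = tabulate λ k → does (G? k)

  ∈-subset⁺ : ∀ {k} → G k → k ∈ subset
  ∈-subset⁺ {k} g = Vecₚ.lookup⇒[]= k subset (trans (Vecₚ.lookup∘tabulate (does ∘ G?) k) (dec-true (G? k) g))

  ∈-subset⁻ : ∀ {k} → k ∈ subset → G k
  ∈-subset⁻ {k} p with G? k | trans (sym (Vecₚ.lookup∘tabulate (does ∘ G?) k)) (Vecₚ.[]=⇒lookup p)
  ... | yes g | _ = g

module _ {m : ℕ} where

  -- The generators joining consecutive positions of [P , Q].
  InInterval : Fin (suc m) → Fin (suc m) → Fin m → Set
  InInterval P Q k = toℕ P ℕ.≤ toℕ k × toℕ k ℕ.< toℕ Q

  inInterval? : ∀ P Q k → Dec (InInterval P Q k)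
  inInterval? P Q k = (toℕ P ℕₚ.≤? toℕ k) ×-dec (toℕ k ℕₚ.<? toℕ Q)

  interval : Fin (suc m) → Fin (suc m) → Subset m
  interval P Q = subset (inInterval? P Q)

  interval-connected : ∀ P Q → Connected (interval P Q)
  interval-connected P Q a b a∈ b∈ = [ (λ a≤b → ascend (toℕ b ∸ toℕ a) a b a∈ b∈ (ℕₚ.m+[n∸m]≡n a≤b))
    , (λ b≤a → reverse (λ (p , q , adj) → q , p , [ inj₂ , inj₁ ]′ adj)
                 (ascend (toℕ a ∸ toℕ b) b a b∈ a∈ (ℕₚ.m+[n∸m]≡n b≤a))) ]′ (ℕₚ.≤-total (toℕ a) (toℕ b))
    where
    Joined : Fin m → Fin m → Set
    Joined i j = (i ∈ interval P Q) × (j ∈ interval P Q) × DynkinAdj i j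
    ascend : ∀ d a b → a ∈ interval P Q → b ∈ interval P Q → toℕ a + d ≡ toℕ b →
      Star Joined a b
    ascend zero a b a∈ b∈ q = subst (Star _ a) (toℕ-injective (trans (sym (ℕₚ.+-identityʳ (toℕ a))) q)) ε
    ascend (suc d) a b a∈ b∈ q = (a∈ , c∈ , inj₁ (sym c≡)) ◅ ascend d c b c∈ b∈ q′
      where
      a<b : suc (toℕ a) ℕ.≤ toℕ b
      a<b = subst (suc (toℕ a) ℕ.≤_) (trans (sym (ℕₚ.+-suc (toℕ a) d)) q) (s≤s (ℕₚ.m≤m+n (toℕ a) d))
      c = fromℕ< (≤-<-trans a<b (Finₚ.toℕ<n b))
      c≡ : toℕ c ≡ suc (toℕ a)
      c≡ = Finₚ.toℕ-fromℕ< _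
      q′ : toℕ c + d ≡ toℕ b
      q′ = trans (cong (_+ d) c≡) (trans (sym (ℕₚ.+-suc (toℕ a) d)) q)
      c∈ : c ∈ interval P Q
      c∈ = ∈-subset⁺ (inInterval? P Q)
        ( subst (toℕ P ℕ.≤_) (sym c≡) (ℕₚ.m≤n⇒m≤1+n (proj₁ (∈-subset⁻ (inInterval? P Q) a∈)))
        , ≤-<-trans (subst (ℕ._≤ toℕ b) (sym c≡) a<b) (proj₂ (∈-subset⁻ (inInterval? P Q) b∈)))

module _ {n : ℕ} where

  -- The reflection of [P , Q], stated with sums to avoid truncated subtraction.
  Mirror : Fin n → Fin n → Fin n → Fin n → Set
  Mirror P Q i v = toℕ i + toℕ v ≡ toℕ P + toℕ Q

  mirror-sym : ∀ {P Q i v} → Mirror P Q i v → Mirror P Q v i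
  mirror-sym {i = i} {v} q = trans (ℕₚ.+-comm (toℕ v) (toℕ i)) q

  mirror-unique : ∀ {P Q i v v′} → Mirror P Q i v → Mirror P Q i v′ → v ≡ v′
  mirror-unique {i = i} q q′ = toℕ-injective (ℕₚ.+-cancelˡ-≡ (toℕ i) _ _ (trans q (sym q′)))

  mirror-< : ∀ {P Q i v i′ v′} → Mirror P Q i v → Mirror P Q i′ v′ → i < i′ → v′ < v
  mirror-< {i = i} {v} {i′} {v′} q q′ lt = ≰⇒> λ v≤v′ →
    <-irrefl (trans q (sym q′)) (ℕₚ.+-mono-<-≤ lt v≤v′)

  mirror-≤Q : ∀ {P Q i v} → Mirror P Q i v → P ≤ i → v ≤ Q
  mirror-≤Q {P} {Q} {i} {v} q P≤i = ≮⇒≥ λ lt → <-irrefl (sym q) (ℕₚ.+-mono-≤-< P≤i lt)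

  mirror-P≤ : ∀ {P Q i v} → Mirror P Q i v → i ≤ Q → P ≤ v
  mirror-P≤ {P} {Q} {i} {v} q i≤Q = ≮⇒≥ λ lt →
    <-irrefl (trans (ℕₚ.+-comm (toℕ v) (toℕ i)) q) (ℕₚ.+-mono-<-≤ lt i≤Q)

  reflect : ∀ {P Q i : Fin n} → P ≤ i → i ≤ Q → ∃ λ v → Mirror P Q i v
  reflect {P} {Q} {i} P≤i i≤Q = fromℕ< bound , trans (cong (toℕ i +_) (Finₚ.toℕ-fromℕ< bound)) (ℕₚ.m+[n∸m]≡n (≤-trans i≤Q (ℕₚ.m≤n+m (toℕ Q) (toℕ P))))
    where
    bound : toℕ P + toℕ Q ∸ toℕ i ℕ.< n
    bound = ≤-<-trans (≤-trans (ℕₚ.∸-monoʳ-≤ (toℕ P + toℕ Q) P≤i) (≤-reflexive (ℕₚ.m+n∸m≡n (toℕ P) (toℕ Q)))) (Finₚ.toℕ<n Q)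

  mirrorImage : Fin n → Fin n → Fin n → Fin n
  mirrorImage P Q i with P Finₚ.≤? i | i Finₚ.≤? Q
  ... | yes p | yes q = proj₁ (reflect p q)
  ... | yes _ | no _  = i
  ... | no _  | _     = i

  opaque
    rev : Fin n → Fin n → Word n
    rev P Q = tabulate (mirrorImage P Q)

    rev-! : ∀ P Q i → rev P Q ! i ≡ mirrorImage P Q i
    rev-! P Q = Vecₚ.lookup∘tabulate (mirrorImage P Q)

  rev-in : ∀ {P Q i v} → P ≤ i → i ≤ Q → Mirror P Q i v → rev P Q ! i ≡ v
  rev-in {P} {Q} {i} {v} p q r = trans (rev-! P Q i) at
    where
    at : mirrorImage P Q i ≡ v
    at with P Finₚ.≤? i | i Finₚ.≤? Q
    ... | yes p | yes q = mirror-unique {P} {Q} {i} (proj₂ (reflect p q)) r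
    ... | yes _ | no ¬q = ⊥-elim (¬q q)
    ... | no ¬p | _     = ⊥-elim (¬p p)

  rev-out : ∀ {P Q i} → ¬ (P ≤ i × i ≤ Q) → rev P Q ! i ≡ i
  rev-out {P} {Q} {i} h = trans (rev-! P Q i) at
    where
    at : mirrorImage P Q i ≡ i
    at with P Finₚ.≤? i | i Finₚ.≤? Q
    ... | yes p | yes q = ⊥-elim (h (p , q))
    ... | yes _ | no _  = refl
    ... | no _  | _     = refl

  rev-above : ∀ {P Q i} → Q < i → rev P Q ! i ≡ i
  rev-above lt = rev-out λ (_ , q) → <⇒≱ lt q

  rev-below : ∀ {P Q i} → i < P → rev P Q ! i ≡ i
  rev-below lt = rev-out λ (p , _) → <⇒≱ lt p

  rev-rev : ∀ P Q i → rev P Q ! (rev P Q ! i) ≡ i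
  rev-rev P Q i with P Finₚ.≤? i | i Finₚ.≤? Q
  ... | yes p | yes q = let (v , r) = reflect p q in
        trans (cong (rev P Q !_) (rev-in p q r))
          (rev-in (mirror-P≤ {P} {Q} {i} r q) (mirror-≤Q {P} {Q} {i} r p) (mirror-sym {P} {Q} {i} r))
  ... | yes _ | no ¬q = let r = rev-out (λ (_ , q) → ¬q q) in trans (cong (rev P Q !_) r) r
  ... | no ¬p | _     = let r = rev-out (λ (p , _) → ¬p p) in trans (cong (rev P Q !_) r) r

  perm-rev : ∀ P Q → Perm (rev P Q)
  perm-rev P Q = mkPerm λ i j q → trans (sym (rev-rev P Q i)) (trans (cong (rev P Q !_) q) (rev-rev P Q j))

  rev-involutive : ∀ P Q → rev P Q ∙ rev P Q ≡ e
  rev-involutive P Q = word-ext λ i → trans (∙-! (rev P Q) (rev P Q) i) (trans (rev-rev P Q i) (sym (e-! i)))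

module _ {m : ℕ} (P Q : Fin (suc m)) where

  rev-reversal : Blocks.Reversal (blocks (interval P Q)) (rev P Q)
  rev-reversal = Blocks.mkReversal (perm-rev P Q) (Blocks.mkPreserves stays) reverses
    where
    stays : ∀ i k → Between i k (rev P Q ! i) → k ∈ interval P Q
    stays i k b with P Finₚ.≤? i | i Finₚ.≤? Q
    ... | yes p | yes q with reflect p q
    ...   | v , r = from (subst (Between i k) (rev-in p q r) b)
      where
      from : Between i k v → k ∈ interval P Q
      from (inj₁ (l , l′)) = ∈-subset⁺ (inInterval? P Q) (≤-trans p l , <-≤-trans l′ (mirror-≤Q {P = P} {Q} {i} r p))
      from (inj₂ (l , l′)) = ∈-subset⁺ (inInterval? P Q) (≤-trans (mirror-P≤ {P = P} {Q} {i} r q) l , <-≤-trans l′ q)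
    stays i k b | yes _ | no ¬q = ⊥-elim (¬between-self (subst (Between i k) (rev-out λ (_ , q) → ¬q q) b))
    stays i k b | no ¬p | _     = ⊥-elim (¬between-self (subst (Between i k) (rev-out λ (p , _) → ¬p p) b))
    reverses : ∀ {i j} → i < j → (∀ k → Between i k j → k ∈ interval P Q) → rev P Q ! j < rev P Q ! i
    reverses {i} {j} i<j linked with generatorAt i<j
    ... | g , g≡i with ∈-subset⁻ (inInterval? P Q) (linked g (inj₁ (≤-reflexive (sym g≡i) , subst (ℕ._< toℕ j) (sym g≡i) i<j)))
    ...   | P≤g , g<Q = subst₂ _<_ (sym (rev-in P≤j j≤Q (proj₂ rj))) (sym (rev-in P≤i i≤Q (proj₂ ri)))
              (mirror-< {P = P} {Q} {i} {_} {j} (proj₂ ri) (proj₂ rj) i<j)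
      where
      P≤i : P ≤ i
      P≤i = subst (toℕ P ℕ.≤_) g≡i P≤g
      i<Q : i < Q
      i<Q = subst (ℕ._< toℕ Q) g≡i g<Q
      i≤Q : i ≤ Q
      i≤Q = <⇒≤ i<Q
      P≤j : P ≤ j
      P≤j = ≤-trans P≤i (<⇒≤ i<j)
      j≤Q : j ≤ Q
      j≤Q = ≮⇒≥ λ Q<j → let (h , h≡Q) = generatorAt Q<j in
        <-irrefl h≡Q (proj₂ (∈-subset⁻ (inInterval? P Q) (linked h (inj₁
          (subst (toℕ i ℕ.≤_) (sym h≡Q) i≤Q , subst (ℕ._< toℕ j) (sym h≡Q) Q<j)))))
      ri = reflect P≤i i≤Q
      rj = reflect P≤j j≤Q

opaque
  -- A generator of index below `q` only moves positions up to `q`, so a position beyond `q` is a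
  -- block by itself.
  linked-above : ∀ {m} {X : Subset m} {q i j : Fin (suc m)} → (∀ {k} → k ∈ X → toℕ k ℕ.< toℕ q) →
    q < i → (∀ k → Between i k j → k ∈ X) → i ≡ j
  linked-above {X = X} {q} {i} {j} X<q q<i linked with <-cmp i j
  ... | tri≈ _ r _ = r
  ... | tri< i<j _ _ = let (g , g≡i) = generatorAt i<j in ⊥-elim (<-asym q<i (subst (ℕ._< toℕ q) g≡i
          (X<q (linked g (inj₁ (≤-reflexive (sym g≡i) , subst (ℕ._< toℕ j) (sym g≡i) i<j))))))
  ... | tri> _ _ j<i with j Finₚ.≤? q
  ...   | yes j≤q = let (g , g≡q) = generatorAt q<i in ⊥-elim (<-irrefl g≡q
          (X<q (linked g (inj₂ (subst (toℕ j ℕ.≤_) (sym g≡q) j≤q , subst (ℕ._< toℕ i) (sym g≡q) q<i)))))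
  ...   | no j≰q = let (g , g≡j) = generatorAt j<i in ⊥-elim (<⇒≱ (subst (ℕ._< toℕ q) g≡j
          (X<q (linked g (inj₂ (≤-reflexive (sym g≡j) , subst (ℕ._< toℕ i) (sym g≡j) j<i))))) (<⇒≤ (≰⇒> j≰q)))

opaque
  linked-below : ∀ {m} {Y : Subset m} {q i j : Fin (suc m)} → (∀ {k} → k ∈ Y → toℕ q ℕ.< toℕ k) →
    i ≤ q → (∀ k → Between i k j → k ∈ Y) → i ≡ j
  linked-below {Y = Y} {q} {i} {j} q<Y i≤q linked with <-cmp i j
  ... | tri≈ _ r _ = r
  ... | tri< i<j _ _ = let (g , g≡i) = generatorAt i<j in ⊥-elim (<⇒≱ (subst (toℕ q ℕ.<_) g≡i
          (q<Y (linked g (inj₁ (≤-reflexive (sym g≡i) , subst (ℕ._< toℕ j) (sym g≡i) i<j))))) i≤q)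
  ... | tri> _ _ j<i = let (g , g≡j) = generatorAt j<i in ⊥-elim (<⇒≱ (subst (toℕ q ℕ.<_) g≡j
          (q<Y (linked g (inj₂ (≤-reflexive (sym g≡j) , subst (ℕ._< toℕ i) (sym g≡j) j<i))))) (≤-trans (<⇒≤ j<i) i≤q))

opaque
  fixes-image-≤ : ∀ {n} {x : Word n} {q : Fin n} → Perm x → (∀ i → q < i → x ! i ≡ i) → ∀ i → i ≤ q → x ! i ≤ q
  fixes-image-≤ px fix i i≤q = ≮⇒≥ λ lt →
    <⇒≱ (subst (_ <_) (injective px _ _ (fix _ lt)) lt) i≤q

fixes-image-> : ∀ {n} {y : Word n} {q : Fin n} → Perm y → (∀ i → i ≤ q → y ! i ≡ i) → ∀ i → q < i → q < y ! i
fixes-image-> py fix i q<i = ≰⇒> λ le →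
  <⇒≱ q<i (subst (_≤ _) (injective py _ _ (fix _ le)) le)

commute : ∀ {n} {x y : Word n} {q : Fin n} → Perm x → Perm y → (∀ i → q < i → x ! i ≡ i) → (∀ i → i ≤ q → y ! i ≡ i) →
  x ∙ y ≡ y ∙ x
commute {x = x} {y} {q} px py fx fy = word-ext λ i → trans (∙-! x y i) (trans (at i) (sym (∙-! y x i)))
  where
  at : ∀ i → x ! (y ! i) ≡ y ! (x ! i)
  at i with i Finₚ.≤? q
  ... | yes i≤q = trans (cong (x !_) (fy i i≤q)) (sym (fy _ (fixes-image-≤ px fx i i≤q)))
  ... | no i≰q  = let q<i = ≰⇒> i≰q in
                  trans (fx _ (fixes-image-> py fy i q<i)) (cong (y !_) (sym (fx i q<i)))

module _ {m : ℕ} {X Y : Subset m} {q : Fin (suc m)}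
  (X<q : ∀ {k} → k ∈ X → toℕ k ℕ.< toℕ q) (q<Y : ∀ {k} → k ∈ Y → toℕ q ℕ.< toℕ k)
  {x y : Word (suc m)} (rx : Blocks.Reversal (blocks X) x) (ry : Blocks.Reversal (blocks Y) y) where

  private
    module RX = Blocks.Reversal rx
    module RY = Blocks.Reversal ry
    fx : ∀ i → q < i → x ! i ≡ i
    fx i q<i = sym (linked-above X<q q<i (Blocks.stays RX.preserves i))
    fy : ∀ i → i ≤ q → y ! i ≡ i
    fy i i≤q = sym (linked-below q<Y i≤q (Blocks.stays RY.preserves i))

  reversal-∙-commute : x ∙ y ≡ y ∙ x
  reversal-∙-commute = commute RX.perm RY.perm fx fy

  -- The generator of index `q` is in neither set, so a block of the union is a block of `X` on
  -- positions up to `q` or a block of `Y` beyond.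
  reversal-∪ : Blocks.Reversal (blocks (X ∪ Y)) (x ∙ y)
  reversal-∪ = Blocks.mkReversal (perm-∙ RX.perm RY.perm) (Blocks.mkPreserves stays) reverses
    where
    at≤ : ∀ i → i ≤ q → (x ∙ y) ! i ≡ x ! i
    at≤ i i≤q = trans (∙-! x y i) (cong (x !_) (fy i i≤q))
    at> : ∀ i → q < i → (x ∙ y) ! i ≡ y ! i
    at> i q<i = trans (∙-! x y i) (fx _ (fixes-image-> RY.perm fy i q<i))
    stays : ∀ i k → Between i k ((x ∙ y) ! i) → k ∈ X ∪ Y
    stays i k b with i Finₚ.≤? q
    ... | yes i≤q = Subsetₚ.x∈p∪q⁺ (inj₁ (Blocks.stays RX.preserves i k (subst (Between i k) (at≤ i i≤q) b)))
    ... | no i≰q  = Subsetₚ.x∈p∪q⁺ (inj₂ (Blocks.stays RY.preserves i k (subst (Between i k) (at> i (≰⇒> i≰q)) b)))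
    reverses : ∀ {i j} → i < j → (∀ k → Between i k j → k ∈ X ∪ Y) → (x ∙ y) ! j < (x ∙ y) ! i
    reverses {i} {j} i<j linked with j Finₚ.≤? q
    ... | yes j≤q = subst₂ _<_ (sym (at≤ j j≤q)) (sym (at≤ i (≤-trans (<⇒≤ i<j) j≤q)))
            (RX.reverses i<j λ k b → inX k b (Subsetₚ.x∈p∪q⁻ X Y (linked k b)))
      where
      inX : ∀ k → Between i k j → k ∈ X ⊎ k ∈ Y → k ∈ X
      inX k b (inj₁ p) = p
      inX k (inj₁ (_ , k<j)) (inj₂ p) = ⊥-elim (<-asym (q<Y p) (<-≤-trans k<j j≤q))
      inX k (inj₂ (l , l′)) (inj₂ p) = ⊥-elim (<-asym i<j (≤-<-trans l l′))
    ... | no j≰q with i Finₚ.≤? q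
    ...   | yes i≤q = let (g , g≡q) = generatorAt (≰⇒> j≰q) in ⊥-elim (
              [ (λ p → <-irrefl g≡q (X<q p)) , (λ p → <-irrefl (sym g≡q) (q<Y p)) ]′
              (Subsetₚ.x∈p∪q⁻ X Y (linked g (inj₁ (subst (toℕ i ℕ.≤_) (sym g≡q) i≤q , subst (ℕ._< toℕ j) (sym g≡q) (≰⇒> j≰q))))))
    ...   | no i≰q = subst₂ _<_ (sym (at> j (≰⇒> j≰q))) (sym (at> i q<i))
              (RY.reverses i<j λ k b → inY k b (Subsetₚ.x∈p∪q⁻ X Y (linked k b)))
      where
      q<i : q < i
      q<i = ≰⇒> i≰q
      inY : ∀ k → Between i k j → k ∈ X ⊎ k ∈ Y → k ∈ Y
      inY k b (inj₂ p) = p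
      inY k (inj₁ (i≤k , _)) (inj₁ p) = ⊥-elim (<-asym (X<q p) (<-≤-trans q<i i≤k))
      inY k (inj₂ (l , l′)) (inj₁ p) = ⊥-elim (<-asym i<j (≤-<-trans l l′))

-- Pieces of polished elements, their extension by an overlapping block, and their products

reversal-resp : ∀ {m} {X Y : Subset m} {x} → (∀ {k} → k ∈ X → k ∈ Y) → (∀ {k} → k ∈ Y → k ∈ X) →
  Blocks.Reversal (blocks X) x → Blocks.Reversal (blocks Y) x
reversal-resp {X = X} {Y} f g = Reversal-⇔ (blocks X) (blocks Y) (λ h k b → f (h k b)) (λ h k b → g (h k b))

empty-reversal : ∀ {m} {X : Subset m} → (∀ {k} → ¬ (k ∈ X)) → Blocks.Reversal (blocks X) e
empty-reversal {X = X} none = Blocks.mkReversal perm-e (Blocks.preserves-e (blocks X)) λ {i} {j} i<j linked →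
  let (g , g≡i) = generatorAt i<j in
  ⊥-elim (none (linked g (inj₁ (≤-reflexive (sym g≡i) , subst (ℕ._< toℕ j) (sym g≡i) i<j))))

-- One factor w₀(J) w₀(J ∩ J′) w₀(J′) of a polished element.
record Piece {m} (P R : Fin (suc m)) (v : Word (suc m)) : Set where
  field
    J J′   : Subset m
    J⊆     : ∀ {k} → k ∈ J → InInterval P R k
    J′⊆    : ∀ {k} → k ∈ J′ → InInterval P R k
    covers : ∀ {k} → InInterval P R k → k ∈ J ⊎ k ∈ J′
    td     : TotallyDisconnected (J ∩ J′)
    a b c  : Word (suc m)
    rev-a  : Blocks.Reversal (blocks J) a
    rev-b  : Blocks.Reversal (blocks (J ∩ J′)) b
    rev-c  : Blocks.Reversal (blocks J′) c
    v≡     : v ≡ (a ∙ b) ∙ c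

  -- What is needed to attach an overlapping block on the left without making two elements of
  -- the new J ∩ J′ adjacent.
  Firmˡ Firmʳ : Set
  Firmˡ = suc (toℕ P) ℕ.< toℕ R × (∀ {k} → toℕ P ℕ.≤ toℕ k → toℕ k ℕ.≤ suc (toℕ P) → k ∈ J × ¬ (k ∈ J′))
  Firmʳ = suc (toℕ P) ℕ.< toℕ R × (∀ {k} → toℕ P ℕ.≤ toℕ k → toℕ k ℕ.≤ suc (toℕ P) → k ∈ J′ × ¬ (k ∈ J))

module _ {m : ℕ} {P R : Fin (suc m)} where

  single : Piece P R (rev P R)
  single = record
    { J = interval P R ; J′ = Data.Fin.Subset.⊥
    ; J⊆ = ∈-subset⁻ (inInterval? P R) ; J′⊆ = λ p → ⊥-elim (Subsetₚ.∉⊥ p)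
    ; covers = inj₁ ∘ ∈-subset⁺ (inInterval? P R)
    ; td = λ a b a∈ _ _ → none a∈
    ; a = rev P R ; b = e ; c = e
    ; rev-a = rev-reversal P R
    ; rev-b = empty-reversal none
    ; rev-c = empty-reversal Subsetₚ.∉⊥
    ; v≡ = sym (trans (∙-identityʳ _) (∙-identityʳ _))
    }
    where
    none : ∀ {k} → ¬ (k ∈ interval P R ∩ Data.Fin.Subset.⊥)
    none p = Subsetₚ.∉⊥ (proj₂ (Subsetₚ.x∈p∩q⁻ (interval P R) Data.Fin.Subset.⊥ p))

  single-firm : suc (toℕ P) ℕ.< toℕ R → Piece.Firmˡ single
  single-firm lt = lt , λ p q → ∈-subset⁺ (inInterval? P R) (p , ≤-<-trans q lt) , Subsetₚ.∉⊥

  -- The three factors are involutions, so inversion reverses their order. It exchanges `J` with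
  -- `J′`, and therefore `Firmˡ` with `Firmʳ`.
  piece-inv : ∀ {v} → Piece P R v → Piece P R (inv v)
  piece-inv {v} pc = record
    { J = J′ ; J′ = J ; J⊆ = J′⊆ ; J′⊆ = J⊆
    ; covers = λ p → [ inj₂ , inj₁ ]′ (covers p)
    ; td = λ x y x∈ y∈ → td x y (flip-∈ x∈) (flip-∈ y∈)
    ; a = c ; b = b ; c = a ; rev-a = rev-c
    ; rev-b = reversal-resp (λ p → Subsetₚ.x∈p∩q⁺ (swap (Subsetₚ.x∈p∩q⁻ J J′ p))) flip-∈ rev-b
    ; rev-c = rev-a
    ; v≡ = begin
        inv v                         ≡⟨ cong inv v≡ ⟩
        inv ((a ∙ b) ∙ c)             ≡⟨ inv-∙ (perm-∙ A.perm B.perm) C.perm ⟩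
        inv c ∙ inv (a ∙ b)           ≡⟨ cong (inv c ∙_) (inv-∙ A.perm B.perm) ⟩
        inv c ∙ (inv b ∙ inv a)       ≡⟨ cong₂ (λ x y → x ∙ (y ∙ inv a)) (inv-unique C.perm C.involutive) (inv-unique B.perm B.involutive) ⟩
        c ∙ (b ∙ inv a)               ≡⟨ cong (λ x → c ∙ (b ∙ x)) (inv-unique A.perm A.involutive) ⟩
        c ∙ (b ∙ a)                   ≡⟨ sym (∙-assoc c b a) ⟩
        (c ∙ b) ∙ a                   ∎
    }
    where
    open Piece pc
    open ≡-Reasoning
    module A = Blocks.Reversal rev-a
    module B = Blocks.Reversal rev-b
    module C = Blocks.Reversal rev-c
    flip-∈ : ∀ {k} → k ∈ J′ ∩ J → k ∈ J ∩ J′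
    flip-∈ p = Subsetₚ.x∈p∩q⁺ (swap (Subsetₚ.x∈p∩q⁻ J′ J p))

-- The new block `B` joins `J` and meets `J′` only in the generator at `A`, the sole element of `S`.
-- As the generator at `a` is not in `J`, the sets `B` and `J` stay apart, the generator at `A` is
-- not adjacent to any in `J ∩ J′`, and `rev A a` commutes past the longest element for `J` to its
-- place in the middle factor.
module Extension {m : ℕ} {P A a R : Fin (suc m)} {v : Word (suc m)} (P≤A : P ≤ A) (A+1≡a : suc (toℕ A) ≡ toℕ a)
  (pc : Piece A R v) (firm : Piece.Firmʳ pc) where

  open Piece pc renaming (a to x; b to y; c to z; rev-a to rx; rev-b to ry; rev-c to rz)

  a<R : a < R
  a<R = subst (ℕ._< toℕ R) A+1≡a (proj₁ firm)

  A<a : A < a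
  A<a = ≤-reflexive A+1≡a

  B S K : Subset m
  B = interval P a
  S = interval A a
  K = (B ∪ J) ∩ J′

  near : ∀ {k} → toℕ A ℕ.≤ toℕ k → toℕ k ℕ.≤ toℕ a → k ∈ J′ × ¬ (k ∈ J)
  near p q = proj₂ firm p (subst (_ ℕ.≤_) (sym A+1≡a) q)

  B<a : ∀ {k} → k ∈ B → toℕ k ℕ.< toℕ a
  B<a p = proj₂ (∈-subset⁻ (inInterval? P a) p)

  S<a : ∀ {k} → k ∈ S → toℕ k ℕ.< toℕ a
  S<a p = proj₂ (∈-subset⁻ (inInterval? A a) p)

  a<J : ∀ {k} → k ∈ J → toℕ a ℕ.< toℕ k
  a<J p = ≰⇒> λ k≤a → proj₂ (near (proj₁ (J⊆ p)) k≤a) p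

  a<J∩J′ : ∀ {k} → k ∈ J ∩ J′ → toℕ a ℕ.< toℕ k
  a<J∩J′ p = a<J (proj₁ (Subsetₚ.x∈p∩q⁻ J J′ p))

  K⁺ : ∀ {k} → k ∈ S ∪ (J ∩ J′) → k ∈ K
  K⁺ {k} p = [ from-S , from-J∩J′ ]′ (Subsetₚ.x∈p∪q⁻ S (J ∩ J′) p)
    where
    from-S : k ∈ S → k ∈ K
    from-S q = let (A≤k , k<a) = ∈-subset⁻ (inInterval? A a) q in
      Subsetₚ.x∈p∩q⁺ (Subsetₚ.x∈p∪q⁺ (inj₁ (∈-subset⁺ (inInterval? P a) (≤-trans P≤A A≤k , k<a))) ,
        proj₁ (near A≤k (<⇒≤ k<a)))
    from-J∩J′ : k ∈ J ∩ J′ → k ∈ K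
    from-J∩J′ q = let (q₁ , q₂) = Subsetₚ.x∈p∩q⁻ J J′ q in Subsetₚ.x∈p∩q⁺ (Subsetₚ.x∈p∪q⁺ (inj₂ q₁) , q₂)

  K⁻ : ∀ {k} → k ∈ K → k ∈ S ⊎ k ∈ J ∩ J′
  K⁻ {k} p = let (q₁ , q₂) = Subsetₚ.x∈p∩q⁻ (B ∪ J) J′ p in
    [ (λ b → inj₁ (∈-subset⁺ (inInterval? A a) (proj₁ (J′⊆ q₂) , B<a b)))
    , (λ j → inj₂ (Subsetₚ.x∈p∩q⁺ (j , q₂))) ]′ (Subsetₚ.x∈p∪q⁻ B J q₁)

  S≡A : ∀ {k} → k ∈ S → toℕ k ≡ toℕ A
  S≡A p = let (A≤k , k<a) = ∈-subset⁻ (inInterval? A a) p in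
    ≤-antisym (≤-pred (subst (_ ℕ.<_) (sym A+1≡a) k<a)) A≤k

  apart : ∀ {k l} → k ∈ S → l ∈ J ∩ J′ → ¬ DynkinAdj k l
  apart p q (inj₁ r) = <-irrefl (trans (sym A+1≡a) (trans (cong suc (sym (S≡A p))) r)) (a<J∩J′ q)
  apart p q (inj₂ r) = <-asym (<-trans (S<a p) (a<J∩J′ q)) (≤-reflexive r)

  K-td : TotallyDisconnected K
  K-td k l k∈ l∈ adj with K⁻ k∈ | K⁻ l∈
  ... | inj₂ p | inj₂ q = td k l p q adj
  ... | inj₁ p | inj₂ q = apart p q adj
  ... | inj₂ p | inj₁ q = apart q p ([ inj₂ , inj₁ ]′ adj)
  ... | inj₁ p | inj₁ q = [ (λ r → ℕₚ.1+n≢n (trans r (trans (S≡A q) (sym (S≡A p)))))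
                          , (λ r → ℕₚ.1+n≢n (trans r (trans (S≡A p) (sym (S≡A q))))) ]′ adj

  s∙x≡x∙s : rev A a ∙ x ≡ x ∙ rev A a
  s∙x≡x∙s = reversal-∙-commute S<a a<J (rev-reversal A a) rx

  piece : Piece P R (rev P a ∙ (rev A a ∙ v))
  piece = record
    { J = B ∪ J ; J′ = J′
    ; J⊆ = λ p → [ (λ b → let (l , l′) = ∈-subset⁻ (inInterval? P a) b in l , <-trans l′ a<R)
                 , (λ j → let (l , l′) = J⊆ j in ≤-trans P≤A l , l′) ]′ (Subsetₚ.x∈p∪q⁻ B J p)
    ; J′⊆ = λ p → let (l , l′) = J′⊆ p in ≤-trans P≤A l , l′
    ; covers = cov
    ; td = K-td
    ; a = rev P a ∙ x ; b = rev A a ∙ y ; c = z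
    ; rev-a = reversal-∪ B<a a<J (rev-reversal P a) rx
    ; rev-b = reversal-resp K⁺ (λ p → Subsetₚ.x∈p∪q⁺ (K⁻ p)) (reversal-∪ S<a a<J∩J′ (rev-reversal A a) ry)
    ; rev-c = rz
    ; v≡ = begin
        ρ ∙ (s′ ∙ v)                  ≡⟨ cong (λ t → ρ ∙ (s′ ∙ t)) v≡ ⟩
        ρ ∙ (s′ ∙ ((x ∙ y) ∙ z))      ≡⟨ cong (ρ ∙_) (sym (∙-assoc s′ (x ∙ y) z)) ⟩
        ρ ∙ ((s′ ∙ (x ∙ y)) ∙ z)      ≡⟨ cong (λ t → ρ ∙ (t ∙ z)) (sym (∙-assoc s′ x y)) ⟩
        ρ ∙ (((s′ ∙ x) ∙ y) ∙ z)      ≡⟨ cong (λ t → ρ ∙ ((t ∙ y) ∙ z)) s∙x≡x∙s ⟩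
        ρ ∙ (((x ∙ s′) ∙ y) ∙ z)      ≡⟨ cong (λ t → ρ ∙ (t ∙ z)) (∙-assoc x s′ y) ⟩
        ρ ∙ ((x ∙ (s′ ∙ y)) ∙ z)      ≡⟨ sym (∙-assoc ρ (x ∙ (s′ ∙ y)) z) ⟩
        (ρ ∙ (x ∙ (s′ ∙ y))) ∙ z      ≡⟨ cong (_∙ z) (sym (∙-assoc ρ x (s′ ∙ y))) ⟩
        ((ρ ∙ x) ∙ (s′ ∙ y)) ∙ z      ∎
    }
    where
    open ≡-Reasoning
    ρ = rev P a
    s′ = rev A a
    cov : ∀ {k} → InInterval P R k → k ∈ B ∪ J ⊎ k ∈ J′
    cov {k} (l , l′) with toℕ k ℕₚ.<? toℕ a
    ... | yes k<a = inj₁ (Subsetₚ.x∈p∪q⁺ (inj₁ (∈-subset⁺ (inInterval? P a) (l , k<a))))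
    ... | no k≮a = [ (λ j → inj₁ (Subsetₚ.x∈p∪q⁺ (inj₂ j))) , inj₂ ]′
                     (covers (≤-trans (<⇒≤ A<a) (≮⇒≥ k≮a) , l′))

  -- The first two generators lie in the new block, and `J′` begins only at `A`.
  piece-firm : suc (toℕ P) ℕ.< toℕ A → Piece.Firmˡ piece
  piece-firm lt = <-trans lt (<-trans A<a a<R) , λ p q →
    Subsetₚ.x∈p∪q⁺ (inj₁ (∈-subset⁺ (inInterval? P a) (p , ≤-<-trans q (<-trans lt A<a)))) ,
    λ j′ → <⇒≱ (≤-<-trans q lt) (proj₁ (J′⊆ j′))

record Component (m : ℕ) : Set where
  field
    S J J′ : Subset m
    a b c  : Word (suc m)
    conn   : Connected S
    S≡     : S ≡ J ∪ J′
    td     : TotallyDisconnected (J ∩ J′)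
    long-a : IsLongest J a
    long-b : IsLongest (J ∩ J′) b
    long-c : IsLongest J′ c

  value : Word (suc m)
  value = (a ∙ b) ∙ c

component : ∀ {m} {P R : Fin (suc m)} {v} → Piece P R v → Component m
component {P = P} {R} pc = record
  { S = interval P R ; J = J ; J′ = J′ ; a = a ; b = b ; c = c
  ; conn = interval-connected P R
  ; S≡ = Subsetₚ.⊆-antisym (λ p → Subsetₚ.x∈p∪q⁺ (covers (∈-subset⁻ (inInterval? P R) p)))
           (λ p → ∈-subset⁺ (inInterval? P R) ([ J⊆ , J′⊆ ]′ (Subsetₚ.x∈p∪q⁻ J J′ p)))
  ; td = td
  ; long-a = reversal⇒longest J rev-a ; long-b = reversal⇒longest (J ∩ J′) rev-b ; long-c = reversal⇒longest J′ rev-c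
  }
  where open Piece pc

productOf : ∀ {m} → List (Component m) → Word (suc m)
productOf = List.foldr (λ C w → Component.value C ∙ w) e

productOf-++ : ∀ {m} (xs : List (Component m)) C → productOf (xs List.++ List.[ C ]) ≡ productOf xs ∙ Component.value C
productOf-++ List.[] C = trans (∙-identityʳ _) (sym (∙-identityˡ _))
productOf-++ (D List.∷ xs) C = trans (cong (Component.value D ∙_) (productOf-++ xs C)) (sym (∙-assoc _ _ _))

DisjointSupports : ∀ {m} → Component m → Component m → Set
DisjointSupports C D = Disjoint (Component.S C) (Component.S D)

record Decomposition {m} (p : ℕ) (w : Word (suc m)) : Set where
  field
    parts    : List (Component m)
    product  : productOf parts ≡ w
    above    : All (λ C → ∀ k → k ∈ Component.S C → p ℕ.≤ toℕ k) parts
    disjoint : AllPairs DisjointSupports parts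

module _ {m : ℕ} where

  decomposition-e : ∀ {p} → Decomposition {m} p e
  decomposition-e = record { parts = List.[] ; product = refl ; above = All.[] ; disjoint = AllPairs.[] }

  decomposition-≤ : ∀ {p q} {w : Word (suc m)} → p ℕ.≤ q → Decomposition q w → Decomposition p w
  decomposition-≤ p≤q D = record
    { parts = parts ; product = product ; above = All.map (λ h k k∈ → ≤-trans p≤q (h k k∈)) above ; disjoint = disjoint }
    where open Decomposition D

  -- The generators of the piece are below `R` and those of the rest are not, but the two need not
  -- commute. The component therefore goes to the end of the list given by the side on which it was
  -- split off.
  attach : ∀ {P R : Fin (suc m)} {v w″ w} → P ≤ R → Piece P R v → Decomposition (toℕ R) w″ →
    w ≡ v ∙ w″ ⊎ w ≡ w″ ∙ v → Decomposition (toℕ P) w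
  attach {P} {R} P≤R pc D (inj₁ w≡) = record
    { parts    = component pc List.∷ parts
    ; product  = trans (cong₂ _∙_ (sym (Piece.v≡ pc)) product) (sym w≡)
    ; above    = (λ k k∈ → proj₁ (∈-subset⁻ (inInterval? P R) k∈)) All.∷ Decomposition.above (decomposition-≤ P≤R D)
    ; disjoint = All.map (λ h k k∈ k∈′ → <⇒≱ (proj₂ (∈-subset⁻ (inInterval? P R) k∈)) (h k k∈′)) above AllPairs.∷ disjoint
    }
    where open Decomposition D
  attach {P} {R} P≤R pc D (inj₂ w≡) = record
    { parts    = parts List.++ List.[ component pc ]
    ; product  = trans (productOf-++ parts (component pc)) (trans (cong₂ _∙_ product (sym (Piece.v≡ pc))) (sym w≡))
    ; above    = Allₚ.++⁺ (Decomposition.above (decomposition-≤ P≤R D))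
                   ((λ k k∈ → proj₁ (∈-subset⁻ (inInterval? P R) k∈)) All.∷ All.[])
    ; disjoint = AllPairsₚ.++⁺ disjoint (All.[] AllPairs.∷ AllPairs.[])
        (All.map (λ h → (λ k k∈′ k∈ → <⇒≱ (proj₂ (∈-subset⁻ (inInterval? P R) k∈)) (h k k∈′)) All.∷ All.[]) above)
    }
    where open Decomposition D

  all-at : ∀ {P : Component m → Set} {xs} → All P xs → ∀ i → P (List.lookup xs i)
  all-at (p All.∷ _)  zero    = p
  all-at (_ All.∷ ps) (suc i) = all-at ps i

  pairs-at : ∀ {xs : List (Component m)} → AllPairs DisjointSupports xs → ∀ i j → i ≢ j →
    DisjointSupports (List.lookup xs i) (List.lookup xs j)
  pairs-at (_  AllPairs.∷ _)  zero    zero    ne = ⊥-elim (ne refl)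
  pairs-at (ps AllPairs.∷ _)  zero    (suc j) ne = all-at ps j
  pairs-at (ps AllPairs.∷ _)  (suc i) zero    ne = λ k x y → all-at ps i k y x
  pairs-at (_  AllPairs.∷ qs) (suc i) (suc j) ne = pairs-at qs i j (ne ∘ cong suc)

  decomposition⇒polished : ∀ {p} {w : Word (suc m)} → Decomposition p w → Polished w
  decomposition⇒polished D = List.length parts , at S , at J , at J′ , pairs-at disjoint , at conn , at S≡ , at td
    , at a , at b , at c , at long-a , at long-b , at long-c , trans (sym product) (product≡ parts)
    where
    open Decomposition D
    open Component
    at : ∀ {B : Component m → Set} → (∀ C → B C) → ∀ i → B (List.lookup parts i)
    at f i = f (List.lookup parts i)
    product≡ : ∀ xs → productOf xs ≡ prod (λ i → (a (List.lookup xs i) · b (List.lookup xs i)) · c (List.lookup xs i))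
    product≡ List.[] = refl
    product≡ (C List.∷ xs) = trans (∙≡· _ _) (cong₂ _·_ (trans (∙≡· _ _) (cong (_· c C) (∙≡· _ _))) (product≡ xs))

-- Peeling blocks off a permutation that avoids the patterns

-- Positions are listed from left to right and values from small to large, so that passing to the
-- inverse just exchanges the two lists of inequalities.
record Avoiding {n} (w : Word n) : Set where
  field
    no3412  : ∀ {i j k l} → i < j → j < k → k < l → w ! k < w ! l → w ! l < w ! i → w ! i < w ! j → ⊥
    no4231  : Avoids4231 w
    no34521 : ∀ {i j k l r} → i < j → j < k → k < l → l < r →
              w ! r < w ! l → w ! l < w ! i → w ! i < w ! j → w ! j < w ! k → ⊥
    no45321 : ∀ {i j k l r} → i < j → j < k → k < l → l < r →
              w ! r < w ! l → w ! l < w ! k → w ! k < w ! i → w ! i < w ! j → ⊥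
    no54123 : ∀ {i j k l r} → i < j → j < k → k < l → l < r →
              w ! k < w ! l → w ! l < w ! r → w ! r < w ! j → w ! j < w ! i → ⊥
    no54312 : ∀ {i j k l r} → i < j → j < k → k < l → l < r →
              w ! l < w ! r → w ! r < w ! k → w ! k < w ! j → w ! j < w ! i → ⊥

-- κ lists the positions of π in increasing order of value.
occurrence : ∀ {n k} (w : Word n) (π κ : Word (suc k)) → (∀ a → κ ! (π ! a) ≡ a) → (ι : Fin (suc k) → Fin n) →
  (∀ i → ι (inject₁ i) < ι (suc i)) → (∀ i → w ! ι (κ ! inject₁ i) < w ! ι (κ ! suc i)) → Contains w π
occurrence w π κ κπ ι pos val = ι ,
  (λ a b → consecutive {R = λ i j → ι i < ι j} <-trans (λ i _ _ → pos i)) ,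
  λ a b → reflects a b , preserves a b
  where
  preserves : ∀ a b → π ! a < π ! b → w ! ι a < w ! ι b
  preserves a b lt = subst₂ (λ x y → w ! ι x < w ! ι y) (κπ a) (κπ b)
    (consecutive {R = λ i j → w ! ι (κ ! i) < w ! ι (κ ! j)} <-trans (λ i _ _ → val i) lt)
  reflects : ∀ a b → w ! ι a < w ! ι b → π ! a < π ! b
  reflects a b lt with <-cmp (π ! a) (π ! b)
  ... | tri< p _ _ = p
  ... | tri≈ _ q _ = ⊥-elim (<-irrefl (cong (λ x → toℕ (w ! ι x)) (trans (sym (κπ a)) (trans (cong (κ !_) q) (κπ b)))) lt)
  ... | tri> _ _ p = ⊥-elim (<-asym lt (preserves b a p))

avoidsAll⇒avoiding : ∀ {n} {w : Word n} → AvoidsAll w → Avoiding w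
avoidsAll⇒avoiding {w = w} (a3412 , a4231 , a34521 , a45321 , a54123 , a54312) = record
  { no3412  = four p3412 (# 2 ∷ # 3 ∷ # 0 ∷ # 1 ∷ []) a3412
  ; no4231  = four p4231 (# 3 ∷ # 1 ∷ # 2 ∷ # 0 ∷ []) a4231
  ; no34521 = five p34521 (# 4 ∷ # 3 ∷ # 0 ∷ # 1 ∷ # 2 ∷ []) a34521
  ; no45321 = five p45321 (# 4 ∷ # 3 ∷ # 2 ∷ # 0 ∷ # 1 ∷ []) a45321
  ; no54123 = five p54123 (# 2 ∷ # 3 ∷ # 4 ∷ # 1 ∷ # 0 ∷ []) a54123
  ; no54312 = five p54312 (# 3 ∷ # 4 ∷ # 2 ∷ # 1 ∷ # 0 ∷ []) a54312
  }
  where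
  four : (π κ : Word 4) {ok : True (all? λ a → κ ! (π ! a) ≟ a)} → Avoids w π → ∀ {i j k l} → i < j → j < k → k < l →
    let ι = lookup (i ∷ j ∷ k ∷ l ∷ []) in
    w ! ι (κ ! # 0) < w ! ι (κ ! # 1) → w ! ι (κ ! # 1) < w ! ι (κ ! # 2) → w ! ι (κ ! # 2) < w ! ι (κ ! # 3) → ⊥
  four π κ {ok} av {i} {j} {k} {l} p₁ p₂ p₃ v₁ v₂ v₃ = av (occurrence w π κ (toWitness ok) (lookup (i ∷ j ∷ k ∷ l ∷ []))
    (λ { zero → p₁ ; (suc zero) → p₂ ; (suc (suc zero)) → p₃ })
    (λ { zero → v₁ ; (suc zero) → v₂ ; (suc (suc zero)) → v₃ }))
  five : (π κ : Word 5) {ok : True (all? λ a → κ ! (π ! a) ≟ a)} → Avoids w π →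
    ∀ {i j k l r} → i < j → j < k → k < l → l < r →
    let ι = lookup (i ∷ j ∷ k ∷ l ∷ r ∷ []) in
    w ! ι (κ ! # 0) < w ! ι (κ ! # 1) → w ! ι (κ ! # 1) < w ! ι (κ ! # 2) →
    w ! ι (κ ! # 2) < w ! ι (κ ! # 3) → w ! ι (κ ! # 3) < w ! ι (κ ! # 4) → ⊥
  five π κ {ok} av {i} {j} {k} {l} {r} p₁ p₂ p₃ p₄ v₁ v₂ v₃ v₄ = av (occurrence w π κ (toWitness ok) (lookup (i ∷ j ∷ k ∷ l ∷ r ∷ []))
    (λ { zero → p₁ ; (suc zero) → p₂ ; (suc (suc zero)) → p₃ ; (suc (suc (suc zero))) → p₄ })
    (λ { zero → v₁ ; (suc zero) → v₂ ; (suc (suc zero)) → v₃ ; (suc (suc (suc zero))) → v₄ }))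

-- The set of patterns is closed under inversion, which exchanges positions and values.
avoiding-inv : ∀ {n} {w : Word n} → Perm w → Avoiding w → Avoiding (inv w)
avoiding-inv {w = w} pw av = record
  { no3412  = λ p q r x y z → no3412 x y z (v p) (v q) (v r)
  ; no4231  = λ p q r x y z → no4231 x y z (v p) (v q) (v r)
  ; no34521 = λ p q r t x y z u → no54123 x y z u (v p) (v q) (v r) (v t)
  ; no45321 = λ p q r t x y z u → no54312 x y z u (v p) (v q) (v r) (v t)
  ; no54123 = λ p q r t x y z u → no34521 x y z u (v p) (v q) (v r) (v t)
  ; no54312 = λ p q r t x y z u → no45321 x y z u (v p) (v q) (v r) (v t)
  }
  where
  open Avoiding av
  v : ∀ {i j} → i < j → w ! (inv w ! i) < w ! (inv w ! j)
  v {i} {j} = subst₂ _<_ (sym (!-inv pw i)) (sym (!-inv pw j))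

Fixes : ∀ {n} → ℕ → Word n → Set
Fixes {n} p w = ∀ (i : Fin n) → toℕ i ℕ.< p → w ! i ≡ i

module _ {n : ℕ} {w : Word n} {p : ℕ} (pw : Perm w) (fix : Fixes p w) where

  fixes-inv : Fixes p (inv w)
  fixes-inv i lt = trans (cong (inv w !_) (sym (fix i lt))) (inv-! pw i)

  image-≥ : ∀ {i : Fin n} → p ℕ.≤ toℕ i → p ℕ.≤ toℕ (w ! i)
  image-≥ {i} p≤i = ≮⇒≥ λ lt → <⇒≱ lt (subst (λ x → p ℕ.≤ toℕ x) (sym (injective pw _ _ (fix _ lt))) p≤i)

  inversion-≥ : ∀ {i j : Fin n} → i < j → w ! j < w ! i → p ℕ.≤ toℕ i
  inversion-≥ {i} {j} i<j lt = ≮⇒≥ λ i<p →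
    let wi = fix i i<p
        wj<i = subst (w ! j <_) wi lt
    in <-asym i<j (subst (_< i) (injective pw _ _ (fix _ (<-trans wj<i i<p))) wj<i)

-- The first entry of each pattern has a smaller one to its right. An occurrence thus starts at an
-- inversion, which lies beyond the fixed positions, where the order agrees with that of `w`.
avoiding-transport : ∀ {n p} {w w′ : Word n} → Perm w′ → Fixes p w′ →
  (∀ {i j} → p ℕ.≤ toℕ i → p ℕ.≤ toℕ j → w′ ! i < w′ ! j → w ! i < w ! j) → Avoiding w → Avoiding w′
avoiding-transport {p = p} {w} {w′} pw′ fix order av = record
  { no3412 = λ ij jk kl x y z →
      let i≥ = inversion-≥ pw′ fix (<-trans ij (<-trans jk kl)) y
          j≥ = later i≥ ij ; k≥ = later j≥ jk ; l≥ = later k≥ kl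
      in no3412 ij jk kl (order k≥ l≥ x) (order l≥ i≥ y) (order i≥ j≥ z)
  ; no4231 = λ ij jk kl x y z →
      let i≥ = inversion-≥ pw′ fix (<-trans ij jk) z
          j≥ = later i≥ ij ; k≥ = later j≥ jk ; l≥ = later k≥ kl
      in no4231 ij jk kl (order l≥ j≥ x) (order j≥ k≥ y) (order k≥ i≥ z)
  ; no34521 = λ ij jk kl lr x y z u →
      let i≥ = inversion-≥ pw′ fix (<-trans ij (<-trans jk kl)) y
          j≥ = later i≥ ij ; k≥ = later j≥ jk ; l≥ = later k≥ kl ; r≥ = later l≥ lr
      in no34521 ij jk kl lr (order r≥ l≥ x) (order l≥ i≥ y) (order i≥ j≥ z) (order j≥ k≥ u)
  ; no45321 = λ ij jk kl lr x y z u →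
      let i≥ = inversion-≥ pw′ fix (<-trans ij jk) z
          j≥ = later i≥ ij ; k≥ = later j≥ jk ; l≥ = later k≥ kl ; r≥ = later l≥ lr
      in no45321 ij jk kl lr (order r≥ l≥ x) (order l≥ k≥ y) (order k≥ i≥ z) (order i≥ j≥ u)
  ; no54123 = λ ij jk kl lr x y z u →
      let i≥ = inversion-≥ pw′ fix ij u
          j≥ = later i≥ ij ; k≥ = later j≥ jk ; l≥ = later k≥ kl ; r≥ = later l≥ lr
      in no54123 ij jk kl lr (order k≥ l≥ x) (order l≥ r≥ y) (order r≥ j≥ z) (order j≥ i≥ u)
  ; no54312 = λ ij jk kl lr x y z u →
      let i≥ = inversion-≥ pw′ fix ij u
          j≥ = later i≥ ij ; k≥ = later j≥ jk ; l≥ = later k≥ kl ; r≥ = later l≥ lr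
      in no54312 ij jk kl lr (order l≥ r≥ x) (order r≥ k≥ y) (order k≥ j≥ z) (order j≥ i≥ u)
  }
  where
  open Avoiding av
  later : ∀ {i j : Fin _} → p ℕ.≤ toℕ i → i < j → p ℕ.≤ toℕ j
  later p≤i i<j = ≤-trans p≤i (<⇒≤ i<j)

-- The first block of w: a = w P and b = w⁻¹ P for the first position P that may move.
-- With no value below a after position b, the values a , … , P appear in decreasing order.
module FirstBlock {m : ℕ} {w : Word (suc m)} {P : Fin (suc m)} (pw : Perm w) (fix : Fixes (toℕ P) w)
  (av : Avoiding w) (moved : w ! P ≢ P)
  (tail-large : ∀ y → inv w ! P < y → ¬ (w ! y < w ! P)) where

  open Avoiding av

  a b : Fin (suc m)
  a = w ! P
  b = inv w ! P

  w⁻ : Fin (suc m) → Fin (suc m)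
  w⁻ = inv w !_

  P<a : P < a
  P<a = ≤∧≢⇒< (image-≥ pw fix ≤-refl) (moved ∘ sym)

  w⁻a : w⁻ a ≡ P
  w⁻a = inv-! pw P

  w⁻-≥ : ∀ {v} → P ≤ v → P ≤ w⁻ v
  w⁻-≥ = image-≥ (perm-inv pw) (fixes-inv pw fix)

  w⁻-> : ∀ {v} → P ≤ v → v ≢ a → P < w⁻ v
  w⁻-> p ne = ≤∧≢⇒< (w⁻-≥ p) λ q → ne (trans (sym (!-inv pw _)) (cong (w !_) (sym q)))

  val : ∀ {u v} → u < v → w ! w⁻ u < w ! w⁻ v
  val {u} {v} = subst₂ _<_ (sym (!-inv pw u)) (sym (!-inv pw v))

  w⁻<b : ∀ {v} → P < v → v < a → w⁻ v < b
  w⁻<b {v} P<v v<a with <-cmp (w⁻ v) b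
  ... | tri< lt _ _ = lt
  ... | tri≈ _ q _  = ⊥-elim (<⇒≢ P<v (sym (injective (perm-inv pw) _ _ q)))
  ... | tri> _ _ gt = ⊥-elim (tail-large _ gt (subst (_< a) (sym (!-inv pw v)) v<a))

  -- Two increasing intermediate values between `a` at position `P` and the value `P` at position
  -- `b` would complete a 4231.
  descending : ∀ {u v} → P ≤ u → u < v → v ≤ a → w⁻ v < w⁻ u
  descending {u} {v} P≤u u<v v≤a with v ≟ a
  ... | yes refl = subst (_< w⁻ u) (sym w⁻a) (w⁻-> P≤u (<⇒≢ u<v))
  ... | no v≢a with ≤∧≢⇒< v≤a v≢a | P ≟ u
  ...   | v<a | yes refl = w⁻<b u<v v<a
  ...   | v<a | no P≢u with ≤∧≢⇒< P≤u P≢u | <-cmp (w⁻ v) (w⁻ u)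
  ...     | _   | tri< lt _ _ = lt
  ...     | _   | tri≈ _ q _  = ⊥-elim (<⇒≢ u<v (sym (injective (perm-inv pw) _ _ q)))
  ...     | P<u | tri> _ _ gt = ⊥-elim (no4231
            (w⁻-> P≤u (<⇒≢ (<-≤-trans u<v v≤a))) gt (w⁻<b (<-trans P<u u<v) v<a)
            (val P<u) (val u<v) (subst (_< a) (sym (!-inv pw v)) v<a))

  -- Induction on the position `i`. If `v` stood further left, that position would by induction hold
  -- a larger value. If it stood further right, `i` would hold a smaller value, against
  -- `descending`, or a larger one, which is already placed if it is at most `a` and excluded by
  -- `clear` if not. `M` will be `P + 1` or `P + 2`, leaving one or two small values to be found
  -- elsewhere.
  antidiagonal : ∀ {M} → toℕ P ℕ.≤ M → (∀ {x v} → a < w ! x → x < w⁻ v → M ℕ.≤ toℕ v → v ≤ a → ⊥) →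
    ∀ i {v} → P ≤ i → Mirror P a i v → M ℕ.≤ toℕ v → w ! i ≡ v
  antidiagonal {M} P≤M clear i = go i (<-wellFounded i)
    where
    go : ∀ i → Acc Fin._<_ i → ∀ {v} → P ≤ i → Mirror P a i v → M ℕ.≤ toℕ v → w ! i ≡ v
    go i (acc rs) {v} P≤i mi M≤v = decide (<-cmp (w⁻ v) i)
      where
      P≤v : P ≤ v
      P≤v = ≤-trans P≤M M≤v
      v≤a : v ≤ a
      v≤a = mirror-≤Q {P = P} {a} {i} mi P≤i
      i≤a : i ≤ a
      i≤a = mirror-≤Q {P = P} {a} {v} (mirror-sym {P = P} {a} {i} mi) P≤v
      decide : _ → w ! i ≡ v
      decide (tri≈ _ q _) = trans (cong (w !_) (sym q)) (!-inv pw v)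
      decide (tri< j<i _ _) =
        let P≤j = w⁻-≥ P≤v
            (v′ , mj) = reflect {P = P} {a} P≤j (≤-trans (<⇒≤ j<i) i≤a)
            v<v′ = mirror-< {P = P} {a} {w⁻ v} {_} {i} mj mi j<i
            wj≡v′ = go (w⁻ v) (rs j<i) P≤j mj (≤-trans M≤v (<⇒≤ v<v′))
        in ⊥-elim (<⇒≢ v<v′ (trans (sym (!-inv pw v)) wj≡v′))
      decide (tri> _ _ i<j) with <-cmp (w ! i) v
      ... | tri≈ _ q _ = q
      ... | tri< u<v _ _ = ⊥-elim (<-asym i<j (subst (w⁻ v <_) (inv-! pw i) (descending (image-≥ pw fix P≤i) u<v v≤a)))
      ... | tri> _ _ v<u with (w ! i) Finₚ.≤? a
      ...   | no u≰a = ⊥-elim (clear (≰⇒> u≰a) i<j M≤v v≤a)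
      ...   | yes u≤a =
        let (i′ , mu) = reflect {P = P} {a} (image-≥ pw fix P≤i) u≤a
            P≤i′ = mirror-P≤ {P = P} {a} {w ! i} mu u≤a
            mi′ = mirror-sym {P = P} {a} {w ! i} mu
            i′<i = mirror-< {P = P} {a} {v} {_} {w ! i} (mirror-sym {P = P} {a} {i} mi) mu v<u
            wi′≡u = go i′ (rs i′<i) P≤i′ mi′ (≤-trans M≤v (<⇒≤ v<u))
        in ⊥-elim (<⇒≢ i′<i (injective pw _ _ wi′≡u))

  -- The values from `M` to `a` are used up by the positions before `q`.
  beyond : ∀ {M q} → toℕ P ℕ.≤ M → (∀ i {v} → P ≤ i → Mirror P a i v → M ℕ.≤ toℕ v → w ! i ≡ v) →
    (∀ i {v : Fin (suc m)} → Mirror P a i v → M ℕ.≤ toℕ v → toℕ i ℕ.< q) → toℕ P ℕ.≤ q →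
    ∀ i → q ℕ.≤ toℕ i → (P ≤ (w ! i) × toℕ (w ! i) ℕ.< M) ⊎ a < w ! i
  beyond {M} {q} P≤M anti short P≤q i q≤i with a <? w ! i | toℕ (w ! i) ℕₚ.<? M
  ... | yes gt | _ = inj₂ gt
  ... | no _ | yes lt = inj₁ (image-≥ pw fix (≤-trans P≤q q≤i) , lt)
  ... | no ≯a | no ≮M =
    let u≤a = ≮⇒≥ ≯a
        M≤u = ≮⇒≥ ≮M
        (i′ , mu) = reflect {P = P} {a} (≤-trans P≤M M≤u) u≤a
        mi′ = mirror-sym {P = P} {a} {w ! i} mu
        w≡ = anti i′ (mirror-P≤ {P = P} {a} {w ! i} mu u≤a) mi′ M≤u
    in ⊥-elim (<⇒≱ (short i′ mi′ M≤u) (subst (λ x → q ℕ.≤ toℕ x) (sym (injective pw _ _ w≡)) q≤i))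

piece-resp : ∀ {m} {P R : Fin (suc m)} {v v′} → v ≡ v′ → Piece P R v → Piece P R v′
piece-resp q pc = record { Piece pc ; v≡ = trans (sym q) (Piece.v≡ pc) }

singleʳ : ∀ {m} {P R : Fin (suc m)} → Piece P R (rev P R)
singleʳ {P = P} {R} = piece-resp (inv-unique (perm-rev P R) (rev-involutive P R)) (piece-inv single)

record Peeling {m} (w : Word (suc m)) (P : Fin (suc m)) : Set where
  constructor peeling
  field
    {R}    : Fin (suc m)
    {v w″} : Word (suc m)
    P<R    : P < R
    piece  : Piece P R v
    perm″  : Perm w″
    fixes″ : Fixes (toℕ R) w″
    av″    : Avoiding w″
    w≡     : w ≡ v ∙ w″ ⊎ w ≡ w″ ∙ v

piece-perm : ∀ {m} {P R : Fin (suc m)} {v} → Piece P R v → Perm v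
piece-perm pc = subst Perm (sym v≡) (perm-∙ (perm-∙ (Blocks.Reversal.perm rev-a) (Blocks.Reversal.perm rev-b)) (Blocks.Reversal.perm rev-c))
  where open Piece pc

peeling-inv : ∀ {m} {w : Word (suc m)} {P} → Perm w → Peeling (inv w) P → Peeling w P
peeling-inv {w = w} pw (peeling {v = v} {w″} P<R piece perm″ fixes″ av″ w≡) =
  peeling P<R (piece-inv piece) (perm-inv perm″) (fixes-inv perm″ fixes″) (avoiding-inv perm″ av″)
    ([ (λ q → inj₂ (flipped q (piece-perm piece) perm″)) , (λ q → inj₁ (flipped q perm″ (piece-perm piece))) ]′ w≡)
  where
  flipped : ∀ {x y} → inv w ≡ x ∙ y → Perm x → Perm y → w ≡ inv y ∙ inv x
  flipped q px py = trans (sym (inv-involutive pw)) (trans (cong inv q) (inv-∙ px py))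

-- The shape of what is left after removing a first block that overlaps the next one in two positions.
record Ready {m} (w : Word (suc m)) (P : Fin (suc m)) : Set where
  constructor ready
  field
    {P₁}  : Fin (suc m)
    pw    : Perm w
    fixes : Fixes (toℕ P) w
    av    : Avoiding w
    P+1   : suc (toℕ P) ≡ toℕ P₁
    order : inv w ! P₁ < inv w ! P
    large : P₁ < w ! P
    clear : ∀ x → P < x → x < inv w ! P₁ → ¬ (w ! P < w ! x)

FirmPeeling : ∀ {m} → Word (suc m) → Fin (suc m) → Set
FirmPeeling w P = Σ (Peeling w P) λ o → Piece.Firmʳ (Peeling.piece o)

rev-cancel : ∀ {n} (P Q : Fin n) (w : Word n) → rev P Q ∙ (rev P Q ∙ w) ≡ w
rev-cancel P Q w = trans (sym (∙-assoc (rev P Q) (rev P Q) w))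
  (trans (cong (_∙ w) (rev-involutive P Q)) (∙-identityˡ w))

module Peel {m : ℕ} {w : Word (suc m)} {P : Fin (suc m)} (pw : Perm w) (fix : Fixes (toℕ P) w)
  (av : Avoiding w) (moved : w ! P ≢ P) (tail-large : ∀ y → inv w ! P < y → ¬ (w ! y < w ! P)) where

  open FirstBlock pw fix av moved tail-large
  open Avoiding av

  P₁ : Fin (suc m)
  P₁ = fromℕ< (≤-<-trans P<a (Finₚ.toℕ<n a))

  P+1 : toℕ P₁ ≡ suc (toℕ P)
  P+1 = Finₚ.toℕ-fromℕ< (≤-<-trans P<a (Finₚ.toℕ<n a))

  P<P₁ : P < P₁
  P<P₁ = ≤-reflexive (sym P+1)

  P₁≤a : P₁ ≤ a
  P₁≤a = subst (ℕ._≤ toℕ a) (sym P+1) P<a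

  -- The obstruction to the values from `a` down to `P + 1` filling consecutive positions.
  Overlap : Set
  Overlap = ∃ λ x → x < w⁻ P₁ × a < w ! x

  overlap? : Dec Overlap
  overlap? = any? λ x → (x <? w⁻ P₁) ×-dec (a <? w ! x)

  large⇒> : ∀ {x} → a < w ! x → P < x
  large⇒> {x} lt with <-cmp P x
  ... | tri< p _ _ = p
  ... | tri≈ _ refl _ = ⊥-elim (<-irrefl refl lt)
  ... | tri> _ _ x<P = ⊥-elim (<-asym (<-trans P<a lt) (subst (_< P) (sym (fix x x<P)) x<P))

  w′ : Word (suc m)
  w′ = rev P a ∙ w

  module Cut (none : ¬ Overlap) where

    anti : ∀ i {v} → P ≤ i → Mirror P a i v → suc (toℕ P) ℕ.≤ toℕ v → w ! i ≡ v
    anti = antidiagonal (ℕₚ.n≤1+n _) λ {x} {v} a<wx x<w⁻v P<v v≤a →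
      none (x , <-≤-trans x<w⁻v (before P<v v≤a) , a<wx)
      where
      before : ∀ {v} → P < v → v ≤ a → w⁻ v ≤ w⁻ P₁
      before {v} P<v v≤a with P₁ ≟ v
      ... | yes refl = ≤-refl
      ... | no ne = <⇒≤ (descending (<⇒≤ P<P₁) (≤∧≢⇒< (subst (ℕ._≤ toℕ v) (sym P+1) P<v) ne) v≤a)

    pw′ : Perm w′
    pw′ = perm-∙ (perm-rev P a) pw

    fix′ : Fixes (toℕ a) w′
    fix′ i i<a with i <? P
    ... | yes i<P = trans (∙-! (rev P a) w i) (trans (cong (rev P a !_) (fix i i<P)) (rev-below i<P))
    ... | no i≮P =
      let P≤i = ≮⇒≥ i≮P
          (v , mi) = reflect {P = P} {a} P≤i (<⇒≤ i<a)
          mi′ = mirror-sym {P = P} {a} {i} mi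
          P<v = mirror-< {P = P} {a} {i} {v} {a} mi (ℕₚ.+-comm (toℕ a) (toℕ P)) i<a
      in trans (∙-! (rev P a) w i) (trans (cong (rev P a !_) (anti i P≤i mi P<v))
           (rev-in (<⇒≤ P<v) (mirror-≤Q {P = P} {a} {i} mi P≤i) mi′))

    classify : ∀ i → a ≤ i → w ! i ≡ P ⊎ a < w ! i
    classify i a≤i = [ (λ (p , q) → inj₁ (toℕ-injective (≤-antisym (≤-pred q) p))) , inj₂ ]′
      (beyond (ℕₚ.n≤1+n _) anti
        (λ i {v} mi P<v → mirror-< {P = P} {a} {P} {a} {v} refl (mirror-sym {P = P} {a} {i} mi) P<v)
        (<⇒≤ P<a) i a≤i)

    at-P : ∀ {i} → w ! i ≡ P → w′ ! i ≡ a
    at-P {i} q = trans (∙-! (rev P a) w i) (trans (cong (rev P a !_) q) (rev-in ≤-refl (<⇒≤ P<a) refl))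

    at-large : ∀ {i} → a < w ! i → w′ ! i ≡ w ! i
    at-large {i} lt = trans (∙-! (rev P a) w i) (rev-above lt)

    -- On the positions from `a` on, only the value `P` is changed, into `a`; it is the smallest one
    -- there both before and after.
    order′ : ∀ {i j} → a ≤ i → a ≤ j → w′ ! i < w′ ! j → w ! i < w ! j
    order′ {i} {j} a≤i a≤j lt with classify i a≤i | classify j a≤j
    ... | inj₁ p | inj₁ q = ⊥-elim (<-irrefl refl (subst₂ _<_ (at-P p) (at-P q) lt))
    ... | inj₁ p | inj₂ q = subst (_< w ! j) (sym p) (<-trans P<a q)
    ... | inj₂ p | inj₁ q = ⊥-elim (<-asym p (subst₂ _<_ (at-large p) (at-P q) lt))
    ... | inj₂ p | inj₂ q = subst₂ _<_ (at-large p) (at-large q) lt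

    peel : Piece P a (rev P a) → Peeling w P
    peel pc = peeling P<a pc pw′ fix′ (avoiding-transport pw′ fix′ order′ av) (inj₁ (sym (rev-cancel P a w)))

  module Overlapping (x₀ : Fin (suc m)) (x₀<w⁻P₁ : x₀ < w⁻ P₁) (a<wx₀ : a < w ! x₀) where

    P₁<a : P₁ < a
    P₁<a = ≤∧≢⇒< P₁≤a λ q → <-asym (large⇒> a<wx₀) (subst (x₀ <_) (trans (cong w⁻ q) w⁻a) x₀<w⁻P₁)

    A : Fin (suc m)
    A = proj₁ (reflect {P = P} {a} {P₁} (<⇒≤ P<P₁) P₁≤a)

    mA : Mirror P a P₁ A
    mA = proj₂ (reflect {P = P} {a} {P₁} (<⇒≤ P<P₁) P₁≤a)

    A+1≡a : suc (toℕ A) ≡ toℕ a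
    A+1≡a = ℕₚ.+-cancelˡ-≡ (toℕ P) _ _ (trans (ℕₚ.+-suc (toℕ P) (toℕ A)) (trans (cong (_+ toℕ A) (sym P+1)) mA))

    A<a : A < a
    A<a = ≤-reflexive A+1≡a

    P<A : P < A
    P<A = ≤-pred (subst₂ ℕ._≤_ (cong suc P+1) (sym A+1≡a) P₁<a)

    w⁻P₁<b : w⁻ P₁ < b
    w⁻P₁<b = w⁻<b P<P₁ P₁<a

    P<v⇒P₁<v : ∀ {v : Fin (suc m)} → suc (suc (toℕ P)) ℕ.≤ toℕ v → P₁ < v
    P<v⇒P₁<v {v} = subst (λ k → suc k ℕ.≤ toℕ v) (sym P+1)

    anti : ∀ i {v} → P ≤ i → Mirror P a i v → suc (suc (toℕ P)) ℕ.≤ toℕ v → w ! i ≡ v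
    anti = antidiagonal (ℕₚ.m≤n⇒m≤1+n (ℕₚ.n≤1+n _)) clear
      where
      clear : ∀ {x v} → a < w ! x → x < w⁻ v → suc (suc (toℕ P)) ℕ.≤ toℕ v → v ≤ a → ⊥
      clear {x} {v} a<wx x<w⁻v le v≤a with v ≟ a
      ... | yes refl = <-asym (large⇒> a<wx) (subst (x <_) w⁻a x<w⁻v)
      -- The entries at `P` and `x`, followed by the values `v`, `P + 1` and `P`, read 45321.
      ... | no ne = no45321 (large⇒> a<wx) x<w⁻v (descending (<⇒≤ P<P₁) (P<v⇒P₁<v le) v≤a) w⁻P₁<b
              (val P<P₁) (val (P<v⇒P₁<v le)) (subst (_< a) (sym (!-inv pw v)) (≤∧≢⇒< v≤a ne)) a<wx

    -- The first reversal exchanges the order of the values `P` and `P + 1`; the second one repairs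
    -- this, taking them to `A` and `a`. The two reversals are the factors that `Extension` puts in
    -- front of a piece.
    u : Word (suc m)
    u = rev A a ∙ w′

    u-! : ∀ i → u ! i ≡ rev A a ! (rev P a ! (w ! i))
    u-! i = trans (∙-! (rev A a) w′ i) (cong (rev A a !_) (∙-! (rev P a) w i))

    pu : Perm u
    pu = perm-∙ (perm-rev A a) (perm-∙ (perm-rev P a) pw)

    fix-u : Fixes (toℕ A) u
    fix-u i i<A with i <? P
    ... | yes i<P = trans (u-! i) (trans (cong (λ t → rev A a ! (rev P a ! t)) (fix i i<P))
            (trans (cong (rev A a !_) (rev-below i<P)) (rev-below i<A)))
    ... | no i≮P =
      let P≤i = ≮⇒≥ i≮P
          (v , mi) = reflect {P = P} {a} P≤i (<⇒≤ (<-trans i<A A<a))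
          mi′ = mirror-sym {P = P} {a} {i} mi
          P₁<v = mirror-< {P = P} {a} {i} {v} {A} mi (mirror-sym {P = P} {a} {P₁} mA) i<A
      in trans (u-! i) (trans (cong (λ t → rev A a ! (rev P a ! t)) (anti i P≤i mi (subst (λ k → suc k ℕ.≤ toℕ v) P+1 P₁<v)))
           (trans (cong (rev A a !_) (rev-in (<⇒≤ (<-trans P<P₁ P₁<v)) (mirror-≤Q {P = P} {a} {i} mi P≤i) mi′)) (rev-below i<A)))

    classify : ∀ i → A ≤ i → w ! i ≡ P ⊎ w ! i ≡ P₁ ⊎ a < w ! i
    classify i A≤i = [ (λ (p , q) → small p q) , inj₂ ∘ inj₂ ]′
      (beyond (ℕₚ.m≤n⇒m≤1+n (ℕₚ.n≤1+n _)) anti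
        (λ i {v} mi le → mirror-< {P = P} {a} {P₁} {A} {v} mA (mirror-sym {P = P} {a} {i} mi) (P<v⇒P₁<v le))
        (<⇒≤ P<A) i A≤i)
      where
      small : P ≤ (w ! i) → toℕ (w ! i) ℕ.< suc (suc (toℕ P)) → w ! i ≡ P ⊎ w ! i ≡ P₁ ⊎ a < w ! i
      small p q with ℕₚ.m≤n⇒m<n∨m≡n p
      ... | inj₂ r = inj₁ (toℕ-injective (sym r))
      ... | inj₁ r = inj₂ (inj₁ (toℕ-injective (trans (≤-antisym (≤-pred q) r) (sym P+1))))

    at-P : ∀ {i} → w ! i ≡ P → u ! i ≡ A
    at-P {i} q = trans (u-! i) (trans (cong (λ t → rev A a ! (rev P a ! t)) q)
      (trans (cong (rev A a !_) (rev-in ≤-refl (<⇒≤ P<a) refl)) (rev-in (<⇒≤ A<a) ≤-refl (ℕₚ.+-comm (toℕ a) (toℕ A)))))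

    at-P₁ : ∀ {i} → w ! i ≡ P₁ → u ! i ≡ a
    at-P₁ {i} q = trans (u-! i) (trans (cong (λ t → rev A a ! (rev P a ! t)) q)
      (trans (cong (rev A a !_) (rev-in (<⇒≤ P<P₁) P₁≤a mA)) (rev-in ≤-refl (<⇒≤ A<a) refl)))

    at-large : ∀ {i} → a < w ! i → u ! i ≡ w ! i
    at-large {i} lt = trans (u-! i) (trans (cong (rev A a !_) (rev-above lt)) (rev-above lt))

    order-u : ∀ {i j} → A ≤ i → A ≤ j → u ! i < u ! j → w ! i < w ! j
    order-u {i} {j} A≤i A≤j lt with classify i A≤i | classify j A≤j
    ... | inj₁ p | inj₁ q = ⊥-elim (<-irrefl refl (subst₂ _<_ (at-P p) (at-P q) lt))
    ... | inj₁ p | inj₂ (inj₁ q) = subst₂ _<_ (sym p) (sym q) P<P₁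
    ... | inj₁ p | inj₂ (inj₂ q) = subst (_< w ! j) (sym p) (<-trans P<a q)
    ... | inj₂ (inj₁ p) | inj₁ q = ⊥-elim (<-asym A<a (subst₂ _<_ (at-P₁ p) (at-P q) lt))
    ... | inj₂ (inj₁ p) | inj₂ (inj₁ q) = ⊥-elim (<-irrefl refl (subst₂ _<_ (at-P₁ p) (at-P₁ q) lt))
    ... | inj₂ (inj₁ p) | inj₂ (inj₂ q) = subst (_< w ! j) (sym p) (<-trans P₁<a q)
    ... | inj₂ (inj₂ p) | inj₁ q = ⊥-elim (<-asym (<-trans A<a p) (subst₂ _<_ (at-large p) (at-P q) lt))
    ... | inj₂ (inj₂ p) | inj₂ (inj₁ q) = ⊥-elim (<-asym p (subst₂ _<_ (at-large p) (at-P₁ q) lt))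
    ... | inj₂ (inj₂ p) | inj₂ (inj₂ q) = subst₂ _<_ (at-large p) (at-large q) lt

    u⁻a : inv u ! a ≡ w⁻ P₁
    u⁻a = trans (cong (inv u !_) (sym (at-P₁ (!-inv pw P₁)))) (inv-! pu _)

    u⁻A : inv u ! A ≡ b
    u⁻A = trans (cong (inv u !_) (sym (at-P (!-inv pw P)))) (inv-! pu _)

    -- Otherwise the position of the value `P + 1`, or `x₀`, would come before `A` and be fixed by
    -- `u`, although `u` takes it to `a` or beyond.
    a<wA : a < w ! A
    a<wA with classify A ≤-refl
    ... | inj₂ (inj₂ r) = r
    ... | inj₁ q = ⊥-elim (<-asym A<a (subst (_< A) (trans (sym (fix-u _ j<A)) (at-P₁ (!-inv pw P₁))) j<A))
      where
      j<A : w⁻ P₁ < A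
      j<A = subst (w⁻ P₁ <_) (trans (cong w⁻ (sym q)) (inv-! pw A)) w⁻P₁<b
    ... | inj₂ (inj₁ q) = ⊥-elim (<-asym (<-trans A<a a<wx₀)
            (subst (_< A) (trans (sym (fix-u _ x₀<A)) (at-large a<wx₀)) x₀<A))
      where
      x₀<A : x₀ < A
      x₀<A = subst (x₀ <_) (trans (cong w⁻ (sym q)) (inv-! pw A)) x₀<w⁻P₁

    ready-u : Ready u A
    ready-u = ready pu fix-u (avoiding-transport pu fix-u order-u av) A+1≡a
      (subst₂ _<_ (sym u⁻a) (sym u⁻A) w⁻P₁<b) (subst (a <_) (sym uA) a<wA) clear
      where
      uA : u ! A ≡ w ! A
      uA = at-large a<wA
      clear : ∀ x → A < x → x < inv u ! a → ¬ (u ! A < u ! x)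
      clear x A<x x<u⁻a lt with classify x (<⇒≤ A<x)
      ... | inj₁ q = <-asym (<-trans A<a a<wA) (subst₂ _<_ uA (at-P q) lt)
      ... | inj₂ (inj₁ q) = <-asym a<wA (subst₂ _<_ uA (at-P₁ q) lt)
      -- The entries at `P`, `A` and `x`, followed by the values `P + 1` and `P`, read 34521.
      ... | inj₂ (inj₂ q) = no34521 P<A A<x (subst (x <_) u⁻a x<u⁻a) w⁻P₁<b
              (val P<P₁) (subst (_< a) (sym (!-inv pw P₁)) P₁<a) a<wA (subst₂ _<_ uA (at-large q) lt)

    peel : FirmPeeling u A → Σ (Peeling w P) λ o → suc (suc (toℕ P)) ℕ.< toℕ a → Piece.Firmˡ (Peeling.piece o)
    peel (peeling {R} {v} {w″} A<R pc perm″ fixes″ av″ u≡ , firm) =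
      peeling (<-trans P<A A<R) E.piece perm″ fixes″ av″ ([ inj₁ ∘ left , inj₂ ∘ right ]′ u≡) ,
      λ lt → E.piece-firm (≤-pred (subst (suc (suc (suc (toℕ P))) ℕ.≤_) (sym A+1≡a) lt))
      where
      module E = Extension (<⇒≤ P<A) A+1≡a pc firm
      open ≡-Reasoning
      ρ s′ : Word (suc m)
      ρ = rev P a
      s′ = rev A a
      w≡ρs′u : w ≡ ρ ∙ (s′ ∙ u)
      w≡ρs′u = sym (trans (cong (ρ ∙_) (rev-cancel A a w′)) (rev-cancel P a w))
      left : u ≡ v ∙ w″ → w ≡ (ρ ∙ (s′ ∙ v)) ∙ w″
      left q = begin
        w                          ≡⟨ w≡ρs′u ⟩
        ρ ∙ (s′ ∙ u)               ≡⟨ cong (λ t → ρ ∙ (s′ ∙ t)) q ⟩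
        ρ ∙ (s′ ∙ (v ∙ w″))        ≡⟨ cong (ρ ∙_) (sym (∙-assoc s′ v w″)) ⟩
        ρ ∙ ((s′ ∙ v) ∙ w″)        ≡⟨ sym (∙-assoc ρ (s′ ∙ v) w″) ⟩
        (ρ ∙ (s′ ∙ v)) ∙ w″        ∎
      fixed : ∀ i → i ≤ a → w″ ! i ≡ i
      fixed i i≤a = fixes″ i (≤-<-trans i≤a E.a<R)
      -- The factor `w″` fixes everything up to `a`, so it can be moved to the left of both
      -- reversals.
      right : u ≡ w″ ∙ v → w ≡ w″ ∙ (ρ ∙ (s′ ∙ v))
      right q = begin
        w                          ≡⟨ w≡ρs′u ⟩
        ρ ∙ (s′ ∙ u)               ≡⟨ cong (λ t → ρ ∙ (s′ ∙ t)) q ⟩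
        ρ ∙ (s′ ∙ (w″ ∙ v))        ≡⟨ cong (ρ ∙_) (sym (∙-assoc s′ w″ v)) ⟩
        ρ ∙ ((s′ ∙ w″) ∙ v)        ≡⟨ cong (λ t → ρ ∙ (t ∙ v)) (commute (perm-rev A a) perm″ (λ _ → rev-above) fixed) ⟩
        ρ ∙ ((w″ ∙ s′) ∙ v)        ≡⟨ cong (ρ ∙_) (∙-assoc w″ s′ v) ⟩
        ρ ∙ (w″ ∙ (s′ ∙ v))        ≡⟨ sym (∙-assoc ρ w″ (s′ ∙ v)) ⟩
        (ρ ∙ w″) ∙ (s′ ∙ v)        ≡⟨ cong (_∙ (s′ ∙ v)) (commute (perm-rev P a) perm″ (λ _ → rev-above) fixed) ⟩
        (w″ ∙ ρ) ∙ (s′ ∙ v)        ≡⟨ ∙-assoc w″ ρ (s′ ∙ v) ⟩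
        w″ ∙ (ρ ∙ (s′ ∙ v))        ∎

module _ {m : ℕ} {w : Word (suc m)} {P : Fin (suc m)} (pw : Perm w) (fix : Fixes (toℕ P) w)
  (av : Avoiding w) (moved : w ! P ≢ P) where

  SmallTail : Set
  SmallTail = ∃ λ y → inv w ! P < y × w ! y < w ! P

  smallTail? : Dec SmallTail
  smallTail? = any? λ y → (inv w ! P <? y) ×-dec (w ! y <? w ! P)

  moved-inv : inv w ! P ≢ P
  moved-inv q = moved (trans (cong (w !_) (sym q)) (!-inv pw P))

  -- Small tails of `w` and of its inverse together give a 3412 at the positions `P`, `inv w ! y`,
  -- `inv w ! P`, `y₀`. Hence the analysis of the first block applies to `w` or to its inverse.
  tail-inv : SmallTail → ∀ y → inv (inv w) ! P < y → ¬ (inv w ! y < inv w ! P)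
  tail-inv (y₀ , b<y₀ , wy₀<a) y a<y z<b = Avoiding.no3412 av P<z z<b b<y₀
    (subst (_< w ! y₀) (sym (!-inv pw P)) P<wy₀) wy₀<a (subst (w ! P <_) (sym (!-inv pw y)) a<y′)
    where
    a<y′ : w ! P < y
    a<y′ = subst (λ x → (x ! P) < y) (inv-involutive pw) a<y
    P≤b : P ≤ (inv w ! P)
    P≤b = image-≥ (perm-inv pw) (fixes-inv pw fix) ≤-refl
    P<wy₀ : P < w ! y₀
    P<wy₀ = ≤∧≢⇒< (image-≥ pw fix (≤-trans P≤b (<⇒≤ b<y₀)))
      λ q → <⇒≢ b<y₀ (trans (cong (inv w !_) q) (inv-! pw y₀))
    P≤z : P ≤ (inv w ! y)
    P≤z = image-≥ (perm-inv pw) (fixes-inv pw fix)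
      (≤-trans (image-≥ pw fix ≤-refl) (<⇒≤ a<y′))
    P<z : P < inv w ! y
    P<z = ≤∧≢⇒< P≤z λ q → <⇒≢ a<y′ (trans (cong (w !_) q) (!-inv pw y))

-- Without a small tail `Ready` excludes an overlap, and the block is a piece of its own, placed in
-- `J′`. With one, the inverse is peeled instead, where the first block is placed in `J`; inverting
-- back moves it to `J′`. An overlap there leads to a recursive call with a larger starting
-- position, which `d` bounds.
firm-peel : ∀ {m} d {w : Word (suc m)} {P} → suc m ℕ.≤ d + toℕ P → Ready w P → FirmPeeling w P
firm-peel zero {P = P} le _ = ⊥-elim (<⇒≱ (Finₚ.toℕ<n P) le)
firm-peel {m} (suc d) {w} {P} le (ready {P₁} pw fix av P+1 order large clear) = decide (smallTail? pw fix av moved)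
  where
  P<P₁ : P < P₁
  P<P₁ = ≤-reflexive P+1
  moved : w ! P ≢ P
  moved q = <-asym P<P₁ (subst (P₁ <_) q large)
  same : ∀ {Q : Fin (suc m)} → toℕ Q ≡ suc (toℕ P) → Q ≡ P₁
  same q = toℕ-injective (trans q P+1)
  P<w⁻P₁ : P < inv w ! P₁
  P<w⁻P₁ = ≤∧≢⇒< (image-≥ (perm-inv pw) (fixes-inv pw fix) (<⇒≤ P<P₁))
    λ q → <⇒≢ large (sym (trans (cong (w !_) q) (!-inv pw P₁)))
  decide : Dec (SmallTail pw fix av moved) → FirmPeeling w P
  decide (no none) = F.Cut.peel no-overlap singleʳ , single-firm (subst (ℕ._< toℕ (w ! P)) (sym P+1) large)
    where
    module F = Peel pw fix av moved (λ y p q → none (y , p , q))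
    no-overlap : ¬ F.Overlap
    no-overlap (x , x< , a<wx) = clear x (F.large⇒> a<wx) (subst (λ Q → x < inv w ! Q) (same F.P+1) x<) a<wx
  decide (yes tail) = from F.overlap?
    where
    module F = Peel (perm-inv pw) (fixes-inv pw fix) (avoiding-inv pw av) (moved-inv pw fix av moved) (tail-inv pw fix av moved tail)
    2+P≤b : suc (toℕ P) ℕ.< toℕ (inv w ! P)
    2+P≤b = ≤-<-trans P<w⁻P₁ order
    inv-firm : Σ (Peeling (inv w) P) (λ o → Piece.Firmˡ (Peeling.piece o)) → FirmPeeling w P
    inv-firm (o , firm) = peeling-inv pw o , firm
    from : Dec F.Overlap → FirmPeeling w P
    from (no none) = inv-firm (F.Cut.peel none single , single-firm 2+P≤b)
    from (yes (x , x< , b<)) = inv-firm (let (o , firm) = O.peel (firm-peel d (shorten d le O.P<A) O.ready-u) in o , firm long)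
      where
      module O = F.Overlapping x x< b<
      x<wP₁ : x < w ! P₁
      x<wP₁ = subst₂ (λ v Q → x < v ! Q) (inv-involutive pw) (same F.P+1) x<
      -- If `inv w ! P` were `P + 2`, the value `P + 1` would stand at position `P + 1`, and no room
      -- would be left for `x` strictly between `P` and `P + 1`.
      long : suc (suc (toℕ P)) ℕ.< toℕ (inv w ! P)
      long = ℕₚ.≤∧≢⇒< 2+P≤b λ q →
        let w⁻P₁≡P₁ = toℕ-injective (trans (≤-antisym (≤-pred (subst (toℕ (inv w ! P₁) ℕ.<_) (sym q) order)) P<w⁻P₁) P+1)
            x<P₁ = subst (x <_) (trans (cong (w !_) (sym w⁻P₁≡P₁)) (!-inv pw P₁)) x<wP₁
        in <⇒≱ (F.large⇒> b<) (≤-pred (subst (suc (toℕ x) ℕ.≤_) (sym P+1) x<P₁))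

peel-off : ∀ {m} {w : Word (suc m)} {P} → Perm w → Fixes (toℕ P) w → Avoiding w → w ! P ≢ P → Peeling w P
peel-off {m} {w} {P} pw fix av moved = decide (smallTail? pw fix av moved)
  where
  first : ∀ {w : Word (suc m)} (pw : Perm w) (fix : Fixes (toℕ P) w) (av : Avoiding w) (moved : w ! P ≢ P) →
    (∀ y → inv w ! P < y → ¬ (w ! y < w ! P)) → Peeling w P
  first {w} pw fix av moved tail-large = from F.overlap?
    where
    module F = Peel pw fix av moved tail-large
    from : Dec F.Overlap → Peeling w P
    from (no none) = F.Cut.peel none single
    from (yes (x , x< , a<)) = proj₁ (F.Overlapping.peel x x< a<
      (firm-peel (suc m) (ℕₚ.m≤m+n (suc m) _) (F.Overlapping.ready-u x x< a<)))
  decide : Dec (SmallTail pw fix av moved) → Peeling w P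
  decide (no none) = first pw fix av moved λ y p q → none (y , p , q)
  decide (yes tail) = peeling-inv pw (first (perm-inv pw) (fixes-inv pw fix) (avoiding-inv pw av)
    (moved-inv pw fix av moved) (tail-inv pw fix av moved tail))

decompose : ∀ {m} d {w : Word (suc m)} {p} → suc m ℕ.≤ d + p → Perm w → Fixes p w → Avoiding w → Decomposition p w
decompose {m} d {w} {p} le pw fix av with p ℕₚ.<? suc m
decompose {m} d {w} {p} le pw fix av | no p≮ = subst (Decomposition p)
  (sym (word-ext λ i → trans (fix i (<-≤-trans (Finₚ.toℕ<n i) (≮⇒≥ p≮))) (sym (e-! i)))) decomposition-e
decompose zero le pw fix av | yes p< = ⊥-elim (<⇒≱ p< le)
decompose {m} (suc d) {w} {p} le pw fix av | yes p< = from (w ! P ≟ P)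
  where
  P : Fin (suc m)
  P = fromℕ< p<
  P≡p : toℕ P ≡ p
  P≡p = Finₚ.toℕ-fromℕ< p<
  from : Dec (w ! P ≡ P) → Decomposition p w
  from (yes q) = decomposition-≤ (ℕₚ.n≤1+n p) (decompose d (shorten d le ≤-refl) pw fix′ av)
    where
    fix′ : Fixes (suc p) w
    fix′ i i≤p with ℕₚ.m≤n⇒m<n∨m≡n (≤-pred i≤p)
    ... | inj₁ i<p = fix i i<p
    ... | inj₂ i≡p = subst (λ j → w ! j ≡ j) (toℕ-injective (trans P≡p (sym i≡p))) q
  from (no moved) with peel-off pw (subst (λ k → Fixes k w) (sym P≡p) fix) av moved
  ... | peeling {R} P<R pc perm″ fixes″ av″ w≡ = subst (λ k → Decomposition k w) P≡p
    (attach (<⇒≤ P<R) pc (decompose d (shorten d le (subst (ℕ._< toℕ R) P≡p P<R)) perm″ fixes″ av″) w≡)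

avoids⇒polished : ∀ {n} {w : Word n} → IsPerm w → AvoidsAll w → Polished w
avoids⇒polished {zero} {[]} _ _ = 0 , (λ ()) , (λ ()) , (λ ()) , (λ ()) , (λ ()) , (λ ()) , (λ ()) , (λ ()) , (λ ()) , (λ ()) ,
  (λ ()) , (λ ()) , (λ ()) , refl
avoids⇒polished {suc m} {w} pw av = decomposition⇒polished
  (decompose (suc m) {p = 0} (ℕₚ.m≤m+n (suc m) 0) (mkPerm pw) (λ i ()) (avoidsAll⇒avoiding av))

isomorphic⇒avoidsAll : ∀ {n} {w : Word n} → IsPerm w → Isomorphic (Γ_ w) (Γ^ w) → AvoidsAll w
isomorphic⇒avoidsAll {zero} {w} _ _ = none p3412 , none p4231 , none p34521 , none p45321 , none p54123 , none p54312
  where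
  none : ∀ {k} (π : Word (suc k)) → Avoids w π
  none π (ι , _) with ι zero
  ... | ()
isomorphic⇒avoidsAll {suc m} pw iso = isomorphic⇒avoids (mkPerm pw) iso

theorem1p4 : (n : ℕ) (w : Word n) → IsPerm w →
    let C1 = Isomorphic (Γ_ w) (Γ^ w)
        C2 = Avoids w p3412 × Avoids w p4231 × Avoids w p34521
             × Avoids w p45321 × Avoids w p54123 × Avoids w p54312
        C3 = Polished w
        C4 = SelfDualInterval w
    in (C1 ⇔ C2) × (C2 ⇔ C3) × (C3 ⇔ C4)
theorem1p4 n w pw =
    mk⇔ 1⇒2 (4⇒1 ∘ 3⇒4 ∘ 2⇒3)
  , mk⇔ 2⇒3 (1⇒2 ∘ 4⇒1 ∘ 3⇒4)
  , mk⇔ 3⇒4 (2⇒3 ∘ 1⇒2 ∘ 4⇒1)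
  where
  1⇒2 : Isomorphic (Γ_ w) (Γ^ w) → AvoidsAll w
  1⇒2 = isomorphic⇒avoidsAll pw
  2⇒3 : AvoidsAll w → Polished w
  2⇒3 = avoids⇒polished pw
  3⇒4 : Polished w → SelfDualInterval w
  3⇒4 = polished⇒selfDual
  4⇒1 : SelfDualInterval w → Isomorphic (Γ_ w) (Γ^ w)
  4⇒1 = SelfDual⇒Isomorphic.isomorphic (mkPerm pw)
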